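{- Let $1<\alpha\le\sqrt2$. Then the set of minimal vectors of $E_8^\alpha$ is $S(E_8^\alpha)=\{\pm\mathbf{b}_1,\dots,\pm\mathbf{b}_8\}$. In particular $\lambda_1^2(E_8^\alpha)=2$ and $E_8^\alpha$ is generic well-rounded.
   Context: Let $\mathbf{e}_1,\dots,\mathbf{e}_8$ be the standard basis of $\mathbb{R}^8$. For $1\le\alpha\le\sqrt2$ and $\overline\alpha:=\sqrt{2-\alpha^2}$, $E_8^\alpha$ is the lattice with basis $\mathbf{b}_1=\frac12(1,1,1,1,1,1,-1,1)^T$ and $\mathbf{b}_k=\alpha\mathbf{e}_{k-1}+\overline\alpha\mathbf{e}_k$ for $2\le k\le8$. $S(\Lambda)$ is the set of vectors of $\Lambda$ of norm $\lambda_1(\Lambda)=\min_{0\ne\mathbf{x}\in\Lambda}\|\mathbf{x}\|$. A lattice in $\mathbb{R}^n$ is generic well-rounded if $S(\Lambda)$ spans $\mathbb{R}^n$ and $|S(\Lambda)|=2n$. -}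

module Defs where

open import Algebra.Bundles.Raw using (RawMonoid)
open import Data.Bool.Base using (if_then_else_)
open import Data.Fin.Base using (Fin; zero; suc; inject₁)
import Data.Fin.Properties as Fin
open import Data.Integer.Base as ℤ using (ℤ; +_; -[1+_])
import Data.Integer.Properties as ℤ
open import Data.Nat.Base as ℕ using (ℕ; zero; suc)
import Data.Nat.Properties as ℕ
open import Data.Nat.Tactic.RingSolver using (solve-∀)
open import Data.Product.Base using (Σ-syntax; ∃; ∃-syntax; _×_; _,_; proj₁; proj₂)
open import Data.Rational.Base as ℚ using (ℚ; mkℚ; 0ℚ; 1ℚ; ½; ↥_; ↧ₙ_; toℚᵘ)
import Data.Rational.Properties as ℚ
open import Data.Rational.Solver using (module +-*-Solver)
open import Data.Rational.Unnormalised.Base as ℚᵘ using (ℚᵘ; mkℚᵘ)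
import Data.Rational.Unnormalised.Properties as ℚᵘ
open import Data.Sum.Base using (_⊎_; inj₁; inj₂)
open import Data.Vec.Base using (_∷_; []; lookup)
open import Data.Vec.Functional using (Vector)
open import Function.Base using (_∘_)
open import Function.Bundles using (Bijection)
open import Level using (0ℓ)
open import Relation.Binary.Bundles using (Setoid)
import Relation.Binary.Construct.On as On
open import Relation.Binary.PropositionalEquality
  using (_≡_; refl; sym; trans; cong; cong₂; subst; setoid)
open import Relation.Nullary.Decidable.Core using (does; yes; no)
open import Relation.Nullary.Negation.Core using (¬_; contradiction)
open import Relation.Unary using (Pred; _∈_; _≐_)

0<½ : 0ℚ ℚ.< ½
0<½ = ℚ.positive⁻¹ ½

pos* : ∀ {p q} → 0ℚ ℚ.< p → 0ℚ ℚ.< q → 0ℚ ℚ.< p ℚ.* q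
pos* {p} {q} 0<p 0<q =
  ℚ.positive⁻¹ _ {{ℚ.pos*pos⇒pos p {{ℚ.positive 0<p}} q {{ℚ.positive 0<q}}}}

half+half : ∀ ε → ε ℚ.* ½ ℚ.+ ε ℚ.* ½ ≡ ε
half+half ε = trans (sym (ℚ.*-distribˡ-+ ε ½ ½)) (ℚ.*-identityʳ ε)

p≤∣p∣ : ∀ p → p ℚ.≤ ℚ.∣ p ∣
p≤∣p∣ p with ℚ.≤-total 0ℚ p
... | inj₁ 0≤p = ℚ.≤-reflexive (sym (ℚ.0≤p⇒∣p∣≡p 0≤p))
... | inj₂ p≤0 = ℚ.≤-trans p≤0 (ℚ.0≤∣p∣ p)

∣∣< : ∀ {p e} → p ℚ.< e → ℚ.- p ℚ.< e → ℚ.∣ p ∣ ℚ.< e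
∣∣< {p} {e} p<e -p<e with ℚ.∣p∣≡p∨∣p∣≡-p p
... | inj₁ eq = subst (ℚ._< e) (sym eq) p<e
... | inj₂ eq = subst (ℚ._< e) (sym eq) -p<e

neg-minus : ∀ p q → ℚ.- (p ℚ.- q) ≡ q ℚ.- p
neg-minus = solve 2 (λ p q → :- (p :- q) := q :- p) refl
  where open +-*-Solver

∣-∣-comm : ∀ p q → ℚ.∣ p ℚ.- q ∣ ≡ ℚ.∣ q ℚ.- p ∣
∣-∣-comm p q = trans (sym (ℚ.∣-p∣≡∣p∣ (p ℚ.- q))) (cong ℚ.∣_∣ (neg-minus p q))

from-diff : ∀ p q {e} → ℚ.∣ p ℚ.- q ∣ ℚ.< e → p ℚ.≤ q ℚ.+ e
from-diff p q {e} d = begin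
  p                 ≡⟨ lem p q ⟩
  q ℚ.+ (p ℚ.- q)   ≤⟨ ℚ.+-monoʳ-≤ q (ℚ.≤-trans (p≤∣p∣ _) (ℚ.<⇒≤ d)) ⟩
  q ℚ.+ e           ∎
  where
  open ℚ.≤-Reasoning
  open +-*-Solver
  lem : ∀ p q → p ≡ q ℚ.+ (p ℚ.- q)
  lem = solve 2 (λ p q → p := q :+ (p :- q)) refl

to-diff : ∀ p q {e} → p ℚ.< q ℚ.+ e → p ℚ.- q ℚ.< e
to-diff p q {e} h = subst (p ℚ.- q ℚ.<_) (lem q e) (ℚ.+-monoˡ-< (ℚ.- q) h)
  where
  open +-*-Solver
  lem : ∀ q e → q ℚ.+ e ℚ.- q ≡ e
  lem = solve 2 (λ q e → q :+ e :- q := e) refl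

sq-mono-≤ : ∀ {p q} → 0ℚ ℚ.≤ p → p ℚ.≤ q → p ℚ.* p ℚ.≤ q ℚ.* q
sq-mono-≤ {p} {q} 0≤p p≤q = ℚ.≤-trans
  (ℚ.*-monoˡ-≤-nonNeg p {{ℚ.nonNegative 0≤p}} p≤q)
  (ℚ.*-monoʳ-≤-nonNeg q {{ℚ.nonNegative (ℚ.≤-trans 0≤p p≤q)}} p≤q)

sq-cancel-< : ∀ {p q} → 0ℚ ℚ.≤ q → p ℚ.* p ℚ.< q ℚ.* q → p ℚ.< q
sq-cancel-< {p} {q} 0≤q h with p ℚ.<? q
... | yes p<q = p<q
... | no  p≮q =
  contradiction (ℚ.<-≤-trans h (sq-mono-≤ 0≤q (ℚ.≮⇒≥ p≮q))) (ℚ.<-irrefl refl)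

1/suc : ℕ → ℚ
1/suc k = + 1 ℚ./ suc k

toℚᵘ-/ : ∀ i m → toℚᵘ (i ℚ./ suc m) ℚᵘ.≃ mkℚᵘ i m
toℚᵘ-/ i m = ℚ.toℚᵘ-fromℚᵘ (mkℚᵘ i m)

archimedean : ∀ ε → 0ℚ ℚ.< ε → ∀ k → ↧ₙ ε ℕ.≤ k → 1/suc k ℚ.≤ ε
archimedean ε@(mkℚ (+ suc n) d-1 _) _ k d≤k = ℚ.toℚᵘ-cancel-≤ (begin
  toℚᵘ (1/suc k)      ≃⟨ toℚᵘ-/ (+ 1) k ⟩
  mkℚᵘ (+ 1) k        ≤⟨ ℚᵘ.*≤* (ℤ.+≤+ lem) ⟩
  mkℚᵘ (+ suc n) d-1  ∎)
  where
  open ℚᵘ.≤-Reasoning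
  lem : 1 ℕ.* suc d-1 ℕ.≤ suc n ℕ.* suc k
  lem = ℕ.*-mono-≤ {1} {suc n} (ℕ.s≤s ℕ.z≤n) (ℕ.≤-trans d≤k (ℕ.n≤1+n k))
archimedean (mkℚ (+ 0) _ _)    0<ε = contradiction 0<ε λ where (ℚ.*<* (ℤ.+<+ ()))
archimedean (mkℚ -[1+ _ ] _ _) 0<ε = contradiction 0<ε λ where (ℚ.*<* ())

IsCauchy : (ℕ → ℚ) → Set
IsCauchy x = ∀ ε → 0ℚ ℚ.< ε →
  ∃[ N ] ∀ m n → N ℕ.≤ m → N ℕ.≤ n → ℚ.∣ x m ℚ.- x n ∣ ℚ.< ε

record ℝ : Set where
  constructor mkℝ
  field
    seq    : ℕ → ℚ
    cauchy : IsCauchy seq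

open ℝ public

infix 4 _≈_ _≤_ _<_

_≈_ : ℝ → ℝ → Set
x ≈ y = ∀ ε → 0ℚ ℚ.< ε →
  ∃[ N ] ∀ n → N ℕ.≤ n → ℚ.∣ seq x n ℚ.- seq y n ∣ ℚ.< ε

_≤_ : ℝ → ℝ → Set
x ≤ y = ∀ ε → 0ℚ ℚ.< ε →
  ∃[ N ] ∀ n → N ℕ.≤ n → seq x n ℚ.≤ seq y n ℚ.+ ε

_<_ : ℝ → ℝ → Set
x < y = ∃[ ε ] 0ℚ ℚ.< ε ×
  ∃[ N ] ∀ n → N ℕ.≤ n → seq x n ℚ.+ ε ℚ.≤ seq y n

∣∣-split : ∀ {p q r e f} → r ≡ p ℚ.+ q →
           ℚ.∣ p ∣ ℚ.< e → ℚ.∣ q ∣ ℚ.< f → ℚ.∣ r ∣ ℚ.< e ℚ.+ f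
∣∣-split {p} {q} refl h k = ℚ.≤-<-trans (ℚ.∣p+q∣≤∣p∣+∣q∣ p q) (ℚ.+-mono-< h k)

telescope : ∀ p q r → p ℚ.- r ≡ (p ℚ.- q) ℚ.+ (q ℚ.- r)
telescope = solve 3 (λ p q r → p :- r := (p :- q) :+ (q :- r)) refl
  where open +-*-Solver

∣p-p∣≡0 : ∀ p → ℚ.∣ p ℚ.- p ∣ ≡ 0ℚ
∣p-p∣≡0 p = cong ℚ.∣_∣ (ℚ.+-inverseʳ p)

≈-refl : ∀ {x} → x ≈ x
≈-refl {x} ε 0<ε = 0 , λ n _ → subst (ℚ._< ε) (sym (∣p-p∣≡0 (seq x n))) 0<ε

≈-sym : ∀ {x y} → x ≈ y → y ≈ x
≈-sym {x} {y} x≈y ε 0<ε with x≈y ε 0<ε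
... | N , h = N , λ n N≤n → subst (ℚ._< ε) (∣-∣-comm (seq x n) (seq y n)) (h n N≤n)

≈-trans : ∀ {x y z} → x ≈ y → y ≈ z → x ≈ z
≈-trans {x} {y} {z} x≈y y≈z ε 0<ε
  with x≈y (ε ℚ.* ½) (pos* 0<ε 0<½) | y≈z (ε ℚ.* ½) (pos* 0<ε 0<½)
... | M , h | N , k = M ℕ.⊔ N , λ n le → subst (_ ℚ.<_) (half+half ε)
  (∣∣-split (telescope (seq x n) (seq y n) (seq z n))
    (h n (ℕ.≤-trans (ℕ.m≤m⊔n M N) le)) (k n (ℕ.≤-trans (ℕ.m≤n⊔m M N) le)))

ℝ-setoid : Setoid 0ℓ 0ℓ
ℝ-setoid = record
  { Carrier = ℝ
  ; _≈_ = _≈_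
  ; isEquivalence = record
    { refl  = λ {x} → ≈-refl {x}
    ; sym   = λ {x} {y} → ≈-sym {x} {y}
    ; trans = λ {x} {y} {z} → ≈-trans {x} {y} {z}
    }
  }

fromℚ : ℚ → ℝ
fromℚ q = mkℝ (λ _ → q) λ ε 0<ε →
  0 , λ _ _ _ _ → subst (ℚ._< ε) (sym (∣p-p∣≡0 q)) 0<ε

fromℤ : ℤ → ℝ
fromℤ i = fromℚ (i ℚ./ 1)

0ℝ 1ℝ 2ℝ : ℝ
0ℝ = fromℤ (+ 0)
1ℝ = fromℤ (+ 1)
2ℝ = fromℤ (+ 2)

infixl 6 _+_ _-_
infixl 7 _*_
infix  8 -_

_+_ : ℝ → ℝ → ℝ
x + y = mkℝ (λ n → seq x n ℚ.+ seq y n) isC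
  where
  open +-*-Solver
  lem : ∀ a b c d → (a ℚ.+ b) ℚ.- (c ℚ.+ d) ≡ (a ℚ.- c) ℚ.+ (b ℚ.- d)
  lem = solve 4 (λ a b c d → (a :+ b) :- (c :+ d) := (a :- c) :+ (b :- d)) refl
  isC : IsCauchy (λ n → seq x n ℚ.+ seq y n)
  isC ε 0<ε with cauchy x (ε ℚ.* ½) (pos* 0<ε 0<½) | cauchy y (ε ℚ.* ½) (pos* 0<ε 0<½)
  ... | M , h | N , k = M ℕ.⊔ N , λ m n ≤m ≤n → subst (_ ℚ.<_) (half+half ε)
    (∣∣-split (lem (seq x m) (seq y m) (seq x n) (seq y n))
      (h m n (ℕ.≤-trans (ℕ.m≤m⊔n M N) ≤m) (ℕ.≤-trans (ℕ.m≤m⊔n M N) ≤n))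
      (k m n (ℕ.≤-trans (ℕ.m≤n⊔m M N) ≤m) (ℕ.≤-trans (ℕ.m≤n⊔m M N) ≤n)))

-_ : ℝ → ℝ
- x = mkℝ (λ n → ℚ.- seq x n) isC
  where
  open +-*-Solver
  lem : ∀ a b → (ℚ.- a) ℚ.- (ℚ.- b) ≡ b ℚ.- a
  lem = solve 2 (λ a b → (:- a) :- (:- b) := b :- a) refl
  isC : IsCauchy (λ n → ℚ.- seq x n)
  isC ε 0<ε with cauchy x ε 0<ε
  ... | N , h = N , λ m n ≤m ≤n →
    subst (λ p → ℚ.∣ p ∣ ℚ.< ε) (sym (lem (seq x m) (seq x n))) (h n m ≤n ≤m)

_-_ : ℝ → ℝ → ℝ
x - y = x + (- y)

bounded : ∀ (x : ℝ) → ∃[ N ] ∃[ B ] 0ℚ ℚ.< B × (∀ n → N ℕ.≤ n → ℚ.∣ seq x n ∣ ℚ.< B)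
bounded x with cauchy x 1ℚ (ℚ.positive⁻¹ 1ℚ)
... | N , h = N , 1ℚ ℚ.+ ℚ.∣ seq x N ∣ ,
  ℚ.+-mono-<-≤ (ℚ.positive⁻¹ 1ℚ) (ℚ.0≤∣p∣ (seq x N)) ,
  λ n N≤n → ℚ.≤-<-trans
    (ℚ.≤-trans (ℚ.≤-reflexive (cong ℚ.∣_∣ (lem (seq x n) (seq x N))))
      (ℚ.∣p+q∣≤∣p∣+∣q∣ (seq x n ℚ.- seq x N) (seq x N)))
    (ℚ.+-monoˡ-< ℚ.∣ seq x N ∣ (h n N N≤n ℕ.≤-refl))
  where
  open +-*-Solver
  lem : ∀ a b → a ≡ (a ℚ.- b) ℚ.+ b
  lem = solve 2 (λ a b → a := (a :- b) :+ b) refl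

∣*∣≤ : ∀ p q {A e} → ℚ.∣ p ∣ ℚ.< A → 0ℚ ℚ.< A → ℚ.∣ q ∣ ℚ.< e → ℚ.∣ p ℚ.* q ∣ ℚ.< A ℚ.* e
∣*∣≤ p q {A} {e} h 0<A k = begin-strict
  ℚ.∣ p ℚ.* q ∣         ≡⟨ ℚ.∣p*q∣≡∣p∣*∣q∣ p q ⟩
  ℚ.∣ p ∣ ℚ.* ℚ.∣ q ∣   ≤⟨ ℚ.*-monoʳ-≤-nonNeg ℚ.∣ q ∣ {{ℚ.∣-∣-nonNeg q}} (ℚ.<⇒≤ h) ⟩
  A ℚ.* ℚ.∣ q ∣         <⟨ ℚ.*-monoʳ-<-pos A {{ℚ.positive 0<A}} k ⟩
  A ℚ.* e               ∎
  where open ℚ.≤-Reasoning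

-- δ = ε / 2A
tolerance : ∀ {A ε} → 0ℚ ℚ.< A → 0ℚ ℚ.< ε → ∃[ δ ] 0ℚ ℚ.< δ × A ℚ.* δ ≡ ε ℚ.* ½
tolerance {A} {ε} 0<A 0<ε = 1/A ℚ.* (ε ℚ.* ½) ,
  pos* (ℚ.positive⁻¹ 1/A {{ℚ.1/pos⇒pos A}}) (pos* 0<ε 0<½) ,
  trans (sym (ℚ.*-assoc A 1/A (ε ℚ.* ½)))
    (trans (cong (ℚ._* (ε ℚ.* ½)) (ℚ.*-inverseʳ A)) (ℚ.*-identityˡ (ε ℚ.* ½)))
  where
  instance
    A-pos : ℚ.Positive A
    A-pos = ℚ.positive 0<A
    A-nonZero : ℚ.NonZero A
    A-nonZero = ℚ.pos⇒nonZero A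
  1/A : ℚ
  1/A = ℚ.1/ A

*-isCauchy : ∀ x y → IsCauchy (λ n → seq x n ℚ.* seq y n)
*-isCauchy x y ε 0<ε = assemble (bounded x) (bounded y)
  where
  open +-*-Solver
  diff : ∀ a b c d → a ℚ.* b ℚ.- c ℚ.* d ≡ a ℚ.* (b ℚ.- d) ℚ.+ d ℚ.* (a ℚ.- c)
  diff = solve 4 (λ a b c d → a :* b :- c :* d := a :* (b :- d) :+ d :* (a :- c)) refl
  Result : Set
  Result = ∃[ N ] ∀ m n → N ℕ.≤ m → N ℕ.≤ n →
    ℚ.∣ seq x m ℚ.* seq y m ℚ.- seq x n ℚ.* seq y n ∣ ℚ.< ε
  assemble :
    (∃[ M ] ∃[ A ] 0ℚ ℚ.< A × (∀ n → M ℕ.≤ n → ℚ.∣ seq x n ∣ ℚ.< A)) →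
    (∃[ N ] ∃[ B ] 0ℚ ℚ.< B × (∀ n → N ℕ.≤ n → ℚ.∣ seq y n ∣ ℚ.< B)) → Result
  assemble (M , A , 0<A , hx) (N , B , 0<B , hy) =
    finish (tolerance 0<A 0<ε) (tolerance 0<B 0<ε)
    where
    finish : (∃[ δ ] 0ℚ ℚ.< δ × A ℚ.* δ ≡ ε ℚ.* ½) →
             (∃[ η ] 0ℚ ℚ.< η × B ℚ.* η ≡ ε ℚ.* ½) → Result
    finish (δ , 0<δ , Aδ) (η , 0<η , Bη) = index , λ m n ≤m ≤n →
      subst (_ ℚ.<_) (trans (cong₂ ℚ._+_ Aδ Bη) (half+half ε))
        (∣∣-split (diff (seq x m) (seq y m) (seq x n) (seq y n))
          (∣*∣≤ (seq x m) (seq y m ℚ.- seq y n) (hx m (ℕ.≤-trans M≤ ≤m)) 0<A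
            (proj₂ cy m n (ℕ.≤-trans P≤ ≤m) (ℕ.≤-trans P≤ ≤n)))
          (∣*∣≤ (seq y n) (seq x m ℚ.- seq x n) (hy n (ℕ.≤-trans N≤ ≤n)) 0<B
            (proj₂ cx m n (ℕ.≤-trans Q≤ ≤m) (ℕ.≤-trans Q≤ ≤n))))
      where
      cy = cauchy y δ 0<δ
      cx = cauchy x η 0<η
      P = proj₁ cy
      Q = proj₁ cx
      index : ℕ
      index = (M ℕ.⊔ N) ℕ.⊔ (P ℕ.⊔ Q)
      M≤ : M ℕ.≤ index
      M≤ = ℕ.≤-trans (ℕ.m≤m⊔n M N) (ℕ.m≤m⊔n _ _)
      N≤ : N ℕ.≤ index
      N≤ = ℕ.≤-trans (ℕ.m≤n⊔m M N) (ℕ.m≤m⊔n _ _)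
      P≤ : P ℕ.≤ index
      P≤ = ℕ.≤-trans (ℕ.m≤m⊔n P Q) (ℕ.m≤n⊔m (M ℕ.⊔ N) _)
      Q≤ : Q ℕ.≤ index
      Q≤ = ℕ.≤-trans (ℕ.m≤n⊔m P Q) (ℕ.m≤n⊔m (M ℕ.⊔ N) _)

_*_ : ℝ → ℝ → ℝ
x * y = mkℝ (λ n → seq x n ℚ.* seq y n) (*-isCauchy x y)

-- The integer part of the square root.
isqrt : ℕ → ℕ
isqrt zero = 0
isqrt (suc m) with suc (isqrt m) ℕ.* suc (isqrt m) ℕ.≤? suc m
... | yes _ = suc (isqrt m)
... | no  _ = isqrt m

isqrt-lower : ∀ m → isqrt m ℕ.* isqrt m ℕ.≤ m
isqrt-lower zero = ℕ.z≤n
isqrt-lower (suc m) with suc (isqrt m) ℕ.* suc (isqrt m) ℕ.≤? suc m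
... | yes le = le
... | no  _  = ℕ.≤-trans (isqrt-lower m) (ℕ.n≤1+n m)

isqrt-upper : ∀ m → m ℕ.< suc (isqrt m) ℕ.* suc (isqrt m)
isqrt-upper zero = ℕ.s≤s ℕ.z≤n
isqrt-upper (suc m) with suc (isqrt m) ℕ.* suc (isqrt m) ℕ.≤? suc m
... | yes le = ℕ.≤-<-trans (isqrt-upper m)
                 (ℕ.*-mono-< (ℕ.n<1+n (suc (isqrt m))) (ℕ.n<1+n (suc (isqrt m))))
... | no  ≰  = ℕ.≰⇒> ≰

-- With K = suc k, for q = p / d ≥ 0 this is ⌊ √ (p d K²) ⌋ / (d K), which
-- differs from √ q by less than 1 / (d K).
√approx : ℚ → ℕ → ℚ
√approx q k =
  + isqrt (ℤ.∣ ↥ q ∣ ℕ.* ↧ₙ q ℕ.* (suc k ℕ.* suc k)) ℚ./ (↧ₙ q ℕ.* suc k)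

√approx-nonNeg : ∀ q k → 0ℚ ℚ.≤ √approx q k
√approx-nonNeg q@(mkℚ _ _ _) k = ℚ.nonNegative⁻¹ _ 
  {{ℚ.normalize-nonNeg (isqrt (ℤ.∣ ↥ q ∣ ℕ.* ↧ₙ q ℕ.* (suc k ℕ.* suc k))) (↧ₙ q ℕ.* suc k)}}

√approx-lower : ∀ q k → 0ℚ ℚ.≤ q → √approx q k ℚ.* √approx q k ℚ.≤ q
√approx-lower q@(mkℚ (+ p) d-1 _) k _ = ℚ.toℚᵘ-cancel-≤ (begin
  toℚᵘ (r ℚ.* r)                      ≃⟨ ℚ.toℚᵘ-homo-* r r ⟩
  toℚᵘ r ℚᵘ.* toℚᵘ r                  ≃⟨ ℚᵘ.*-cong (toℚᵘ-/ (+ n) dK-1) (toℚᵘ-/ (+ n) dK-1) ⟩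
  mkℚᵘ (+ n) dK-1 ℚᵘ.* mkℚᵘ (+ n) dK-1 ≤⟨ ℚᵘ.*≤* le ⟩
  mkℚᵘ (+ p) d-1                      ∎)
  where
  open ℚᵘ.≤-Reasoning
  K d n dK-1 : ℕ
  K = suc k
  d = suc d-1
  n = isqrt (p ℕ.* d ℕ.* (K ℕ.* K))
  dK-1 = k ℕ.+ d-1 ℕ.* K
  r : ℚ
  r = + n ℚ./ suc dK-1
  rearrange : ∀ p d K → p ℕ.* d ℕ.* (K ℕ.* K) ℕ.* d ≡ p ℕ.* (d ℕ.* K ℕ.* (d ℕ.* K))
  rearrange = solve-∀
  nat : n ℕ.* n ℕ.* d ℕ.≤ p ℕ.* (d ℕ.* K ℕ.* (d ℕ.* K))
  nat = ℕ.≤-trans (ℕ.*-monoˡ-≤ d (isqrt-lower (p ℕ.* d ℕ.* (K ℕ.* K))))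
          (ℕ.≤-reflexive (rearrange p d K))
  le : (+ n ℤ.* + n) ℤ.* + d ℤ.≤ + p ℤ.* + (d ℕ.* K ℕ.* (d ℕ.* K))
  le = subst (ℤ._≤ + p ℤ.* + (d ℕ.* K ℕ.* (d ℕ.* K)))
         (trans (ℤ.pos-* (n ℕ.* n) d) (cong (ℤ._* + d) (ℤ.pos-* n n)))
         (subst (+ (n ℕ.* n ℕ.* d) ℤ.≤_) (ℤ.pos-* p _) (ℤ.+≤+ nat))
√approx-lower (mkℚ -[1+ _ ] _ _) k 0≤q = contradiction 0≤q λ where (ℚ.*≤* ())

√approx-upper : ∀ q k → 0ℚ ℚ.≤ q →
  q ℚ.< (√approx q k ℚ.+ 1/suc k) ℚ.* (√approx q k ℚ.+ 1/suc k)
√approx-upper q@(mkℚ (+ p) d-1 _) k _ = ℚ.<-≤-trans q<s² (sq-mono-≤ 0≤s s≤r+1/K)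
  where
  K d n dK-1 : ℕ
  K = suc k
  d = suc d-1
  n = isqrt (p ℕ.* d ℕ.* (K ℕ.* K))
  dK-1 = k ℕ.+ d-1 ℕ.* K
  r s : ℚ
  r = + n ℚ./ suc dK-1
  s = + suc n ℚ./ suc dK-1
  0≤s : 0ℚ ℚ.≤ s
  0≤s = ℚ.nonNegative⁻¹ s {{ℚ.normalize-nonNeg (suc n) (suc dK-1)}}

  q<s² : q ℚ.< s ℚ.* s
  q<s² = ℚ.toℚᵘ-cancel-< (begin-strict
    mkℚᵘ (+ p) d-1                                <⟨ ℚᵘ.*<* lt ⟩
    mkℚᵘ (+ suc n) dK-1 ℚᵘ.* mkℚᵘ (+ suc n) dK-1  ≃⟨ ℚᵘ.*-cong (toℚᵘ-/ (+ suc n) dK-1) (toℚᵘ-/ (+ suc n) dK-1) ⟨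
    toℚᵘ s ℚᵘ.* toℚᵘ s                            ≃⟨ ℚ.toℚᵘ-homo-* s s ⟨
    toℚᵘ (s ℚ.* s)                                ∎)
    where
    open ℚᵘ.≤-Reasoning
    rearrange : ∀ p d K → p ℕ.* d ℕ.* (K ℕ.* K) ℕ.* d ≡ p ℕ.* (d ℕ.* K ℕ.* (d ℕ.* K))
    rearrange = solve-∀
    nat : p ℕ.* (d ℕ.* K ℕ.* (d ℕ.* K)) ℕ.< suc n ℕ.* suc n ℕ.* d
    nat = ℕ.≤-<-trans (ℕ.≤-reflexive (sym (rearrange p d K)))
            (ℕ.*-monoˡ-< d (isqrt-upper (p ℕ.* d ℕ.* (K ℕ.* K))))
    lt : + p ℤ.* + (d ℕ.* K ℕ.* (d ℕ.* K)) ℤ.< (+ suc n ℤ.* + suc n) ℤ.* + d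
    lt = subst (+ p ℤ.* + (d ℕ.* K ℕ.* (d ℕ.* K)) ℤ.<_)
           (trans (ℤ.pos-* (suc n ℕ.* suc n) d) (cong (ℤ._* + d) (ℤ.pos-* (suc n) (suc n))))
           (subst (ℤ._< + (suc n ℕ.* suc n ℕ.* d)) (ℤ.pos-* p _) (ℤ.+<+ nat))

  s≤r+1/K : s ℚ.≤ r ℚ.+ 1/suc k
  s≤r+1/K = ℚ.toℚᵘ-cancel-≤ (begin
    toℚᵘ s                                 ≃⟨ toℚᵘ-/ (+ suc n) dK-1 ⟩
    mkℚᵘ (+ suc n) dK-1                    ≤⟨ ℚᵘ.*≤* le ⟩
    mkℚᵘ (+ n) dK-1 ℚᵘ.+ mkℚᵘ (+ 1) k      ≃⟨ ℚᵘ.+-cong (toℚᵘ-/ (+ n) dK-1) (toℚᵘ-/ (+ 1) k) ⟨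
    toℚᵘ r ℚᵘ.+ toℚᵘ (1/suc k)             ≃⟨ ℚ.toℚᵘ-homo-+ r (1/suc k) ⟨
    toℚᵘ (r ℚ.+ 1/suc k)                   ∎)
    where
    open ℚᵘ.≤-Reasoning
    D : ℕ
    D = suc dK-1
    expand : ∀ n D K → suc n ℕ.* (D ℕ.* K) ≡ n ℕ.* K ℕ.* D ℕ.+ D ℕ.* K
    expand = solve-∀
    collect : ∀ n D K → n ℕ.* K ℕ.* D ℕ.+ D ℕ.* D ≡ (n ℕ.* K ℕ.+ 1 ℕ.* D) ℕ.* D
    collect = solve-∀
    nat : suc n ℕ.* (D ℕ.* K) ℕ.≤ (n ℕ.* K ℕ.+ 1 ℕ.* D) ℕ.* D
    nat = ℕ.≤-trans (ℕ.≤-reflexive (expand n D K))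
      (ℕ.≤-trans (ℕ.+-monoʳ-≤ (n ℕ.* K ℕ.* D) (ℕ.*-monoʳ-≤ D (ℕ.m≤n*m K d)))
        (ℕ.≤-reflexive (collect n D K)))
    le : + suc n ℤ.* + (D ℕ.* K) ℤ.≤ (+ n ℤ.* + K ℤ.+ + 1 ℤ.* + D) ℤ.* + D
    le = subst (+ suc n ℤ.* + (D ℕ.* K) ℤ.≤_)
      (trans (ℤ.pos-* (n ℕ.* K ℕ.+ 1 ℕ.* D) D) (cong (ℤ._* + D)
        (trans (ℤ.pos-+ (n ℕ.* K) (1 ℕ.* D)) (cong₂ ℤ._+_ (ℤ.pos-* n K) (ℤ.pos-* 1 D)))))
      (subst (ℤ._≤ + ((n ℕ.* K ℕ.+ 1 ℕ.* D) ℕ.* D)) (ℤ.pos-* (suc n) (D ℕ.* K)) (ℤ.+≤+ nat))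
√approx-upper (mkℚ -[1+ _ ] _ _) k 0≤q = contradiction 0≤q λ where (ℚ.*≤* ())

_⁺ : ℚ → ℚ
q ⁺ = q ℚ.⊔ 0ℚ

0≤⁺ : ∀ q → 0ℚ ℚ.≤ q ⁺
0≤⁺ q = ℚ.p≤q⊔p q 0ℚ

⁺-mono : ∀ p q e → 0ℚ ℚ.≤ e → p ℚ.≤ q ℚ.+ e → p ⁺ ℚ.≤ q ⁺ ℚ.+ e
⁺-mono p q e 0≤e h = ℚ.⊔-lub
  (ℚ.≤-trans h (ℚ.+-monoˡ-≤ e (ℚ.p≤p⊔q q 0ℚ)))
  (ℚ.+-mono-≤ (0≤⁺ q) 0≤e)

-- p ≤ q + e² gives √p < √q + κ + e with κ the tolerance of √approx.
√approx-mono : ∀ p q e i j → 0ℚ ℚ.≤ e → 0ℚ ℚ.≤ q → 0ℚ ℚ.≤ p → p ℚ.≤ q ℚ.+ e ℚ.* e →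
  √approx p i ℚ.< √approx q j ℚ.+ (1/suc j ℚ.+ e)
√approx-mono p q e i j 0≤e 0≤q 0≤p h = sq-cancel-< 0≤t (begin-strict
  r ℚ.* r                   ≤⟨ √approx-lower p i 0≤p ⟩
  p                         ≤⟨ h ⟩
  q ℚ.+ e ℚ.* e             <⟨ ℚ.+-monoˡ-< (e ℚ.* e) (√approx-upper q j 0≤q) ⟩
  s ℚ.* s ℚ.+ e ℚ.* e       ≤⟨ ℚ.+-monoʳ-≤ (s ℚ.* s) (subst (ℚ._≤ e ℚ.* e ℚ.+ (2se)) (ℚ.+-identityʳ (e ℚ.* e)) (ℚ.+-monoʳ-≤ (e ℚ.* e) 0≤2se)) ⟩
  s ℚ.* s ℚ.+ (e ℚ.* e ℚ.+ 2se) ≡⟨ square s e ⟩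
  (s ℚ.+ e) ℚ.* (s ℚ.+ e)   ≡⟨ cong₂ ℚ._*_ assoc assoc ⟩
  t ℚ.* t                   ∎)
  where
  open ℚ.≤-Reasoning
  open +-*-Solver
  r κ s t 2se : ℚ
  r = √approx p i
  κ = 1/suc j
  s = √approx q j ℚ.+ κ
  t = √approx q j ℚ.+ (κ ℚ.+ e)
  2se = s ℚ.* e ℚ.+ s ℚ.* e
  0≤s : 0ℚ ℚ.≤ s
  0≤s = ℚ.+-mono-≤ (√approx-nonNeg q j) (ℚ.nonNegative⁻¹ κ {{ℚ.normalize-nonNeg 1 (suc j)}})
  0≤se : 0ℚ ℚ.≤ s ℚ.* e
  0≤se = ℚ.nonNegative⁻¹ _ {{ℚ.nonNeg*nonNeg⇒nonNeg s {{ℚ.nonNegative 0≤s}} e {{ℚ.nonNegative 0≤e}}}}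
  0≤2se : 0ℚ ℚ.≤ 2se
  0≤2se = ℚ.+-mono-≤ 0≤se 0≤se
  assoc : s ℚ.+ e ≡ t
  assoc = ℚ.+-assoc (√approx q j) κ e
  0≤t : 0ℚ ℚ.≤ t
  0≤t = subst (0ℚ ℚ.≤_) assoc (ℚ.+-mono-≤ 0≤s 0≤e)
  square : ∀ s e → s ℚ.* s ℚ.+ (e ℚ.* e ℚ.+ (s ℚ.* e ℚ.+ s ℚ.* e)) ≡ (s ℚ.+ e) ℚ.* (s ℚ.+ e)
  square = solve 2 (λ s e → s :* s :+ (e :* e :+ (s :* e :+ s :* e)) := (s :+ e) :* (s :+ e)) refl

√-isCauchy : ∀ x → IsCauchy (λ n → √approx (seq x n ⁺) n)
√-isCauchy x ε 0<ε = M ℕ.⊔ N , λ m n ≤m ≤n →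
  ∣∣< (half m n ≤m ≤n) (subst (ℚ._< ε) (sym (neg-minus (a m) (a n))) (half n m ≤n ≤m))
  where
  a : ℕ → ℚ
  a n = √approx (seq x n ⁺) n
  e : ℚ
  e = ε ℚ.* ½
  0<e : 0ℚ ℚ.< e
  0<e = pos* 0<ε 0<½
  cx : ∃[ N ] ∀ m n → N ℕ.≤ m → N ℕ.≤ n → ℚ.∣ seq x m ℚ.- seq x n ∣ ℚ.< e ℚ.* e
  cx = cauchy x (e ℚ.* e) (pos* 0<e 0<e)
  M N : ℕ
  M = proj₁ cx
  N = ↧ₙ e
  half : ∀ m n → M ℕ.⊔ N ℕ.≤ m → M ℕ.⊔ N ℕ.≤ n → a m ℚ.- a n ℚ.< ε
  half m n ≤m ≤n = to-diff (a m) (a n) (ℚ.<-≤-trans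
    (√approx-mono (seq x m ⁺) (seq x n ⁺) e m n (ℚ.<⇒≤ 0<e) (0≤⁺ (seq x n)) (0≤⁺ (seq x m))
      (⁺-mono (seq x m) (seq x n) (e ℚ.* e) (ℚ.<⇒≤ (pos* 0<e 0<e))
        (from-diff (seq x m) (seq x n)
          (proj₂ cx m n (ℕ.≤-trans (ℕ.m≤m⊔n M N) ≤m) (ℕ.≤-trans (ℕ.m≤m⊔n M N) ≤n)))))
    (ℚ.+-monoʳ-≤ (a n) (ℚ.≤-trans
      (ℚ.+-monoˡ-≤ e (archimedean e 0<e n (ℕ.≤-trans (ℕ.m≤n⊔m M N) ≤n)))
      (ℚ.≤-reflexive (half+half ε)))))

-- The nonnegative square root of max(x, 0).
√ : ℝ → ℝ
√ x = mkℝ (λ n → √approx (seq x n ℚ.⊔ 0ℚ) n) (√-isCauchy x)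

√-nonNeg : ∀ x → 0ℝ ≤ √ x
√-nonNeg x ε 0<ε =
  0 , λ n _ → ℚ.+-mono-≤ (√approx-nonNeg (seq x n ⁺) n) (ℚ.<⇒≤ 0<ε)

√-square : ∀ x → 0ℝ ≤ x → √ x * √ x ≈ x
√-square x 0≤x ε 0<ε = from-bound (bounded (√ x))
  where
  open ℚ.≤-Reasoning
  open +-*-Solver
  e : ℚ
  e = ε ℚ.* ½
  0<e : 0ℚ ℚ.< e
  0<e = pos* 0<ε 0<½
  e<ε : e ℚ.< ε
  e<ε = begin-strict
    e           ≡⟨ ℚ.+-identityʳ e ⟨
    e ℚ.+ 0ℚ    <⟨ ℚ.+-monoʳ-< e 0<e ⟩
    e ℚ.+ e     ≡⟨ half+half ε ⟩
    ε           ∎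
  a : ℕ → ℚ
  a = seq (√ x)
  expand : ∀ r κ → (r ℚ.+ κ) ℚ.* (r ℚ.+ κ) ≡ r ℚ.* r ℚ.+ (r ℚ.+ (r ℚ.+ κ)) ℚ.* κ
  expand = solve 2 (λ r κ → (r :+ κ) :* (r :+ κ) := r :* r :+ (r :+ (r :+ κ)) :* κ) refl

  below : ∀ n → 0ℚ ℚ.≤ seq x n ℚ.+ e → a n ℚ.* a n ℚ.- seq x n ℚ.< ε
  below n h = to-diff (a n ℚ.* a n) (seq x n) (begin-strict
    a n ℚ.* a n       ≤⟨ √approx-lower (seq x n ⁺) n (0≤⁺ (seq x n)) ⟩
    seq x n ⁺         ≤⟨ ℚ.⊔-lub (subst (ℚ._≤ seq x n ℚ.+ e) (ℚ.+-identityʳ (seq x n))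
                            (ℚ.+-monoʳ-≤ (seq x n) (ℚ.<⇒≤ 0<e))) h ⟩
    seq x n ℚ.+ e     <⟨ ℚ.+-monoʳ-< (seq x n) e<ε ⟩
    seq x n ℚ.+ ε     ∎)

  from-bound : (∃[ N ] ∃[ B ] 0ℚ ℚ.< B × (∀ n → N ℕ.≤ n → ℚ.∣ a n ∣ ℚ.< B)) →
    ∃[ N ] ∀ n → N ℕ.≤ n → ℚ.∣ a n ℚ.* a n ℚ.- seq x n ∣ ℚ.< ε
  from-bound (N , B , 0<B , bd) = from-tolerance (tolerance 0<C 0<ε)
    where
    C : ℚ
    C = B ℚ.+ (B ℚ.+ 1ℚ)
    0<C : 0ℚ ℚ.< C
    0<C = ℚ.+-mono-< 0<B (ℚ.+-mono-< 0<B (ℚ.positive⁻¹ 1ℚ))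
    from-tolerance : (∃[ δ ] 0ℚ ℚ.< δ × C ℚ.* δ ≡ e) →
      ∃[ N ] ∀ n → N ℕ.≤ n → ℚ.∣ a n ℚ.* a n ℚ.- seq x n ∣ ℚ.< ε
    from-tolerance (δ , 0<δ , Cδ) = P ℕ.⊔ (N ℕ.⊔ ↧ₙ δ) , λ n ≤n →
      ∣∣< (below n (proj₂ (0≤x e 0<e) n (ℕ.≤-trans (ℕ.m≤m⊔n P _) ≤n)))
        (subst (ℚ._< ε) (sym (neg-minus (a n ℚ.* a n) (seq x n)))
          (above n (ℕ.≤-trans (ℕ.m≤m⊔n N _) (ℕ.≤-trans (ℕ.m≤n⊔m P _) ≤n))
                   (ℕ.≤-trans (ℕ.m≤n⊔m N _) (ℕ.≤-trans (ℕ.m≤n⊔m P _) ≤n))))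
      where
      P : ℕ
      P = proj₁ (0≤x e 0<e)
      above : ∀ n → N ℕ.≤ n → ↧ₙ δ ℕ.≤ n → seq x n ℚ.- a n ℚ.* a n ℚ.< ε
      above n N≤n δ≤n = to-diff (seq x n) (a n ℚ.* a n) (begin-strict
        seq x n                                    ≤⟨ ℚ.p≤p⊔q (seq x n) 0ℚ ⟩
        seq x n ⁺                                  <⟨ √approx-upper (seq x n ⁺) n (0≤⁺ (seq x n)) ⟩
        (a n ℚ.+ κ) ℚ.* (a n ℚ.+ κ)                ≡⟨ expand (a n) κ ⟩
        a n ℚ.* a n ℚ.+ (a n ℚ.+ (a n ℚ.+ κ)) ℚ.* κ ≤⟨ ℚ.+-monoʳ-≤ (a n ℚ.* a n) small ⟩
        a n ℚ.* a n ℚ.+ e                          <⟨ ℚ.+-monoʳ-< (a n ℚ.* a n) e<ε ⟩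
        a n ℚ.* a n ℚ.+ ε                          ∎)
        where
        κ : ℚ
        κ = 1/suc n
        κ≤1 : κ ℚ.≤ 1ℚ
        κ≤1 = archimedean 1ℚ (ℚ.positive⁻¹ 1ℚ) n
          (ℕ.≤-trans {1} {↧ₙ δ} (ℕ.s≤s ℕ.z≤n) δ≤n)
        a≤B : a n ℚ.≤ B
        a≤B = ℚ.≤-trans (p≤∣p∣ (a n)) (ℚ.<⇒≤ (bd n N≤n))
        small : (a n ℚ.+ (a n ℚ.+ κ)) ℚ.* κ ℚ.≤ e
        small = begin
          (a n ℚ.+ (a n ℚ.+ κ)) ℚ.* κ
            ≤⟨ ℚ.*-monoʳ-≤-nonNeg κ {{ℚ.normalize-nonNeg 1 (suc n)}}
                 (ℚ.+-mono-≤ a≤B (ℚ.+-mono-≤ a≤B κ≤1)) ⟩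
          C ℚ.* κ
            ≤⟨ ℚ.*-monoˡ-≤-nonNeg C {{ℚ.nonNegative (ℚ.<⇒≤ 0<C)}} (archimedean δ 0<δ n δ≤n) ⟩
          C ℚ.* δ   ≡⟨ Cδ ⟩
          e         ∎

open import Data.Vec.Functional.Relation.Binary.Equality.Setoid ℝ-setoid
  using (_≋_; ≋-setoid)

+-rawMonoid : RawMonoid 0ℓ 0ℓ
+-rawMonoid = record { Carrier = ℝ ; _≈_ = _≈_ ; _∙_ = _+_ ; ε = 0ℝ }

open import Algebra.Definitions.RawMonoid +-rawMonoid using (sum)

0ᵛ : ∀ {n} → Vector ℝ n
0ᵛ _ = 0ℝ

infixl 6 _+ᵛ_
infix  8 -ᵛ_
infixr 7 _·_

_+ᵛ_ : ∀ {n} → Vector ℝ n → Vector ℝ n → Vector ℝ n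
(x +ᵛ y) i = x i + y i

-ᵛ_ : ∀ {n} → Vector ℝ n → Vector ℝ n
(-ᵛ x) i = - x i

_·_ : ∀ {n} → ℝ → Vector ℝ n → Vector ℝ n
(r · x) i = r * x i

⟨_,_⟩ : ∀ {n} → Vector ℝ n → Vector ℝ n → ℝ
⟨ x , y ⟩ = sum (λ i → x i * y i)

‖_‖ : ∀ {n} → Vector ℝ n → ℝ
‖ x ‖ = √ ⟨ x , x ⟩

linComb : ∀ {m n} → Vector ℝ m → Vector (Vector ℝ n) m → Vector ℝ n
linComb c b i = sum (λ j → c j * b j i)

LinearlyIndependent : ∀ {m n} → Vector (Vector ℝ n) m → Set
LinearlyIndependent {m} b = (c : Vector ℝ m) → linComb c b ≋ 0ᵛ → c ≋ 0ᵛ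

ℤ-span : ∀ {m n} → Vector (Vector ℝ n) m → Pred (Vector ℝ n) 0ℓ
ℤ-span {m} b x = Σ[ c ∈ Vector ℤ m ] x ≋ linComb (fromℤ ∘ c) b

Spans : ∀ {n} → Pred (Vector ℝ n) 0ℓ → Set
Spans {n} P = (x : Vector ℝ n) →
  ∃[ m ] Σ[ s ∈ Vector (Vector ℝ n) m ] Σ[ c ∈ Vector ℝ m ]
    (∀ j → s j ∈ P) × x ≋ linComb c s

IsLattice : ∀ {n} → Pred (Vector ℝ n) 0ℓ → Set
IsLattice {n} Λ = ∃[ m ] Σ[ b ∈ Vector (Vector ℝ n) m ]
  LinearlyIndependent b × Λ ≐ ℤ-span b

-- The relation  λ₁(Λ) = ℓ.
IsMinNorm : ∀ {n} → Pred (Vector ℝ n) 0ℓ → ℝ → Set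
IsMinNorm Λ ℓ =
  (∃[ x ] x ∈ Λ × ¬ x ≋ 0ᵛ × ‖ x ‖ ≈ ℓ) ×
  (∀ x → x ∈ Λ → ¬ x ≋ 0ᵛ → ℓ ≤ ‖ x ‖)

S : ∀ {n} → Pred (Vector ℝ n) 0ℓ → Pred (Vector ℝ n) 0ℓ
S Λ x = x ∈ Λ × ∃[ ℓ ] IsMinNorm Λ ℓ × ‖ x ‖ ≈ ℓ

-- Vectors are counted up to equality of real coordinates.
HasCardinality : ∀ {n} → Pred (Vector ℝ n) 0ℓ → ℕ → Set
HasCardinality {n} P k =
  Bijection (setoid (Fin k)) (On.setoid {B = ∃ P} (≋-setoid n) proj₁)

GenericWellRounded : ∀ {n} → Pred (Vector ℝ n) 0ℓ → Set
GenericWellRounded {n} Λ =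
  IsLattice Λ × Spans (S Λ) × HasCardinality (S Λ) (2 ℕ.* n)

e : ∀ {n} → Fin n → Vector ℝ n
e i j = if does (i Fin.≟ j) then 1ℝ else 0ℝ

conj : ℝ → ℝ
conj α = √ (2ℝ - α * α)

-- Indices start at 0: basis α j is b_{j+1}, and e j is e_{j+1}.
basis : ℝ → Vector (Vector ℝ 8) 8
basis α zero    = fromℚ ½ · lookup (1ℝ ∷ 1ℝ ∷ 1ℝ ∷ 1ℝ ∷ 1ℝ ∷ 1ℝ ∷ - 1ℝ ∷ 1ℝ ∷ [])
basis α (suc k) = α · e (inject₁ k) +ᵛ conj α · e (suc k)

E₈ : ℝ → Pred (Vector ℝ 8) 0ℓ
E₈ α = ℤ-span (basis α)

±basis : ℝ → Pred (Vector ℝ 8) 0ℓ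
±basis α x = ∃[ k ] (x ≋ basis α k ⊎ x ≋ -ᵛ basis α k)

{-# OPTIONS --safe #-}
-- Let x have coefficients (a, u₁, …, u₅, v, w) in b₁, …, b₈. With s = α + ᾱ, d = α - ᾱ and
-- p = αᾱ one has s² = 2 + 2p, d² = 2 - 2p and
--   ‖x‖² = 2a² + a s A + a d B + 2N + 2p M,
-- where A = Σ uᵢ, B = v - w, N is the sum of the squares of u₁, …, w and M the
-- sum of the products of neighbours. Chords and tangents of the concave functions
-- s and d of p bound a s A and a d B below by functions that are linear in p, so that
-- 120 ‖x‖² ≥ p F₁ + (1 - p) F₀ with integers F₁ and F₀ depending on the chosen
-- lines. Both F₁ (essentially the norm of E₈, at p = 1) and F₀ (at p = 0) are
-- separable over the integers. Unless x is 0 or ± b_k, suitable lines give F₁ ≥ 240 and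
-- F₀ > 240, so ‖x‖² > 2 because p < 1.
module Submission where

open import Data.Bool.Base using (if_then_else_)
open import Data.Fin.Base using (Fin; zero; suc; toℕ; fromℕ<; inject₁; splitAt; join)
open import Data.Fin.Patterns using (0F; 1F; 2F; 3F; 4F; 5F; 6F; 7F)
import Data.Fin.Properties as Fin
open import Data.Integer.Base as ℤ using (ℤ; +_; -[1+_])
import Data.Integer.Properties as ℤ
import Data.Integer.Tactic.RingSolver as ℤ-Ring
open import Data.Nat.Base as ℕ using (ℕ; zero; suc)
import Data.Nat.Properties as ℕ
open import Data.Product.Base using (∃-syntax; _×_; _,_; proj₁; proj₂)
open import Data.Rational.Base as ℚ using (ℚ; 0ℚ; 1ℚ; ½; ↧ₙ_; toℚᵘ)
import Data.Rational.Properties as ℚ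
open import Data.Rational.Solver using (module +-*-Solver)
open import Data.Rational.Unnormalised.Base as ℚᵘ using (mkℚᵘ; *≡*; *≤*)
import Data.Rational.Unnormalised.Properties as ℚᵘ
open import Data.Sum.Base using (_⊎_; inj₁; inj₂)
open import Data.Vec.Base using (_∷_; []; lookup)
open import Data.Vec.Functional using (Vector; foldr)
open import Function.Base using (_∘_; case_of_)
open import Relation.Binary.PropositionalEquality
  using (_≡_; _≗_; refl; sym; trans; cong; cong₂; subst; subst₂; module ≡-Reasoning)
open import Relation.Nullary.Decidable.Core using (Dec; does; yes; no)
open import Relation.Nullary.Negation.Core using (¬_; contradiction)
open import Relation.Unary using (_≐_)

-- At p = 1 the lattice is E₈, which has minimal vectors besides ± b_k, so F₁ = 240 cannot be
-- avoided. Strictness must come from F₀ alone, where it carries the weight 1 - p; this is why F₀ ≥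
-- 241 is paired with an explicit lower bound for 1 - p.
--
-- The chords join p = -1 to p = 1, where s and d take the values 0 and 2. They are exact at p = 1,
-- and so is `tangent₁`, the tangent to s there; with these lines F₁ is the E₈ form. But d = √(2 -
-- 2p) has a vertical tangent at p = 1. So `tangent` touches d at p = 7/32, d = 5/4, and F₁ drops
-- below the E₈ form when aB < 0; integrality has to make up for this. `tangent₂` touches s at p =
-- 1/8, s = 3/2. It gives up 10 at p = 1 to gain 10 at p = 0, which is needed for |a| ≥ 2 when aA
-- and aB are both negative. The lines have denominators 1, 4, 12 and 40, hence the factor 120.

module IntegerForm where
  open import Data.Integer.Base using (_≤_; _+_; _*_; _-_; -_; +≤+; nonNegative)

  -- Integer inequalities and short coefficient vectors.

  0≤+ : ∀ {i j} → + 0 ≤ i → + 0 ≤ j → + 0 ≤ i + j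
  0≤+ = ℤ.+-mono-≤

  0≤* : ∀ {i j} → + 0 ≤ i → + 0 ≤ j → + 0 ≤ i * j
  0≤* {i} {j} 0≤i 0≤j = subst (_≤ i * j) (ℤ.*-zeroʳ i)
    (ℤ.*-monoˡ-≤-nonNeg i {{nonNegative 0≤i}} 0≤j)

  0≤-const : ∀ n → + 0 ≤ + n
  0≤-const n = +≤+ ℕ.z≤n

  0≤scale : ∀ n {i} → + 0 ≤ i → + 0 ≤ + n * i
  0≤scale n = 0≤* (0≤-const n)

  0≤sq : ∀ i → + 0 ≤ i * i
  0≤sq (+ n)      = 0≤* (0≤-const n) (0≤-const n)
  0≤sq (-[1+ n ]) = +≤+ ℕ.z≤n

  -- The roots -1 and 0 are consecutive integers, so the negative part of the parabola contains no
  -- integer. In the certificates below, these products are what integrality adds to the squares.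
  0≤n[n+1] : ∀ i → + 0 ≤ i * (i + + 1)
  0≤n[n+1] (+ n)          = 0≤* (0≤-const n) (0≤-const (n ℕ.+ 1))
  0≤n[n+1] (-[1+ zero ])  = +≤+ ℕ.z≤n
  0≤n[n+1] (-[1+ suc n ]) = +≤+ ℕ.z≤n

  1≤sq : ∀ i → ¬ i ≡ + 0 → + 1 ≤ i * i
  1≤sq (+ zero)  i≢0 = contradiction refl i≢0
  1≤sq (+ suc n) _   = +≤+ (ℕ.s≤s ℕ.z≤n)
  1≤sq (-[1+ n ]) _  = +≤+ (ℕ.s≤s ℕ.z≤n)

  ≤-gap : ∀ {i j r} → + 0 ≤ r → j ≡ i + r → i ≤ j
  ≤-gap {i} {j} {r} 0≤r eq =
    subst₂ _≤_ (ℤ.+-identityʳ i) (sym eq) (ℤ.+-monoʳ-≤ i 0≤r)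

  *-cancel-≤ : ∀ n {i j} → + suc n * i ≤ + suc n * j → i ≤ j
  *-cancel-≤ n {i} {j} = ℤ.*-cancelˡ-≤-pos i j (+ suc n)

  sumSq : ∀ {n} → Vector ℤ n → ℤ
  sumSq {zero}  c = + 0
  sumSq {suc n} c = c zero * c zero + sumSq (c ∘ suc)

  0≤sumSq : ∀ {n} (c : Vector ℤ n) → + 0 ≤ sumSq c
  0≤sumSq {zero}  c = +≤+ ℕ.z≤n
  0≤sumSq {suc n} c = 0≤+ (0≤sq (c zero)) (0≤sumSq (c ∘ suc))

  δ : ∀ {n} → Fin n → Vector ℤ n
  δ zero    zero    = + 1
  δ zero    (suc j) = + 0
  δ (suc i) zero    = + 0
  δ (suc i) (suc j) = δ i j

  zero? : ∀ {n} (c : Vector ℤ n) → (∀ i → c i ≡ + 0) ⊎ + 1 ≤ sumSq c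
  zero? {zero}  c = inj₁ λ ()
  zero? {suc n} c with c zero ℤ.≟ + 0 | zero? (c ∘ suc)
  ... | no c₀≢0  | _        = inj₂ (ℤ.+-mono-≤ (1≤sq (c zero) c₀≢0) (0≤sumSq (c ∘ suc)))
  ... | yes c₀≡0 | inj₁ c≡0 = inj₁ λ { zero → c₀≡0 ; (suc i) → c≡0 i }
  ... | yes _    | inj₂ 1≤  = inj₂ (ℤ.+-mono-≤ (0≤sq (c zero)) 1≤)

  Short : ∀ {n} → Vector ℤ n → Set
  Short c = (∀ i → c i ≡ + 0) ⊎ (∃[ k ] (c ≗ δ k ⊎ c ≗ -_ ∘ δ k))

  -- Two nonzero entries contribute at least 1 each, and one entry of absolute value at least 2
  -- contributes at least 4. The case distinction on lattice vectors goes back to this one, because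
  -- integers can be compared effectively and reals cannot.
  short? : ∀ {n} (c : Vector ℤ n) → Short c ⊎ + 2 ≤ sumSq c
  short? {zero}  c = inj₁ (inj₁ λ ())
  short? {suc n} c = split (c zero) refl (zero? (c ∘ suc)) (short? (c ∘ suc))
    where
    split : ∀ z → c zero ≡ z → (∀ i → c (suc i) ≡ + 0) ⊎ + 1 ≤ sumSq (c ∘ suc) →
            Short (c ∘ suc) ⊎ + 2 ≤ sumSq (c ∘ suc) → Short c ⊎ + 2 ≤ sumSq c
    split z eq _ (inj₂ 2≤) = inj₂ (ℤ.+-mono-≤ (0≤sq (c zero)) 2≤)
    split (+ 0) eq _ (inj₁ (inj₁ c≡0)) = inj₁ (inj₁ λ { zero → eq ; (suc i) → c≡0 i })
    split (+ 0) eq _ (inj₁ (inj₂ (k , inj₁ c≡δ))) =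
      inj₁ (inj₂ (suc k , inj₁ λ { zero → eq ; (suc i) → c≡δ i }))
    split (+ 0) eq _ (inj₁ (inj₂ (k , inj₂ c≡-δ))) =
      inj₁ (inj₂ (suc k , inj₂ λ { zero → eq ; (suc i) → c≡-δ i }))
    split (+ 1) eq (inj₁ c≡0) _ = inj₁ (inj₂ (zero , inj₁ λ { zero → eq ; (suc i) → c≡0 i }))
    split (-[1+ 0 ]) eq (inj₁ c≡0) _ =
      inj₁ (inj₂ (zero , inj₂ λ { zero → eq ; (suc i) → c≡0 i }))
    split (+ suc (suc n)) eq (inj₁ c≡0) _ = inj₂ (ℤ.+-mono-≤ {+ 2}
      (subst (λ z → + 2 ≤ z * z) (sym eq) (+≤+ (ℕ.s≤s (ℕ.s≤s ℕ.z≤n)))) (0≤sumSq (c ∘ suc)))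
    split (-[1+ suc n ]) eq (inj₁ c≡0) _ = inj₂ (ℤ.+-mono-≤ {+ 2}
      (subst (λ z → + 2 ≤ z * z) (sym eq) (+≤+ (ℕ.s≤s (ℕ.s≤s ℕ.z≤n)))) (0≤sumSq (c ∘ suc)))
    split (+ suc n) eq (inj₂ 1≤) _ = inj₂ (ℤ.+-mono-≤ {+ 1}
      (1≤sq (c zero) λ c₀≡0 → case trans (sym c₀≡0) eq of λ ()) 1≤)
    split (-[1+ n ]) eq (inj₂ 1≤) _ = inj₂ (ℤ.+-mono-≤ {+ 1}
      (1≤sq (c zero) λ c₀≡0 → case trans (sym c₀≡0) eq of λ ()) 1≤)

  -- The integer forms and the bounding lines.

  A : (u₁ u₂ u₃ u₄ u₅ : ℤ) → ℤ
  A u₁ u₂ u₃ u₄ u₅ = u₁ + u₂ + u₃ + u₄ + u₅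

  N : (u₁ u₂ u₃ u₄ u₅ v w : ℤ) → ℤ
  N u₁ u₂ u₃ u₄ u₅ v w =
    u₁ * u₁ + u₂ * u₂ + u₃ * u₃ + u₄ * u₄ + u₅ * u₅ + v * v + w * w

  M : (u₁ u₂ u₃ u₄ u₅ v w : ℤ) → ℤ
  M u₁ u₂ u₃ u₄ u₅ v w =
    u₁ * u₂ + u₂ * u₃ + u₃ * u₄ + u₄ * u₅ + u₅ * v + v * w

  F₁ F₀ : (σ δ a² aA aB N M : ℤ) → ℤ
  F₁ σ δ a² aA aB N M = + 240 * a² + σ * aA + δ * aB + + 240 * N + + 240 * M
  F₀ σ δ a² aA aB N M = + 240 * a² + σ * aA + δ * aB + + 240 * N

  -- Index (σ₁, σ₀) records the bound 120 s t ≥ (σ₁ p + σ₀ (1 - p)) t; likewise for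
  -- SlopeD and d.
  data SlopeS (t : ℤ) : ℤ → ℤ → Set where
    chord : + 0 ≤ t → SlopeS t (+ 240) (+ 120)
    tangent₁ : t ≤ + 0 → SlopeS t (+ 240) (+ 180)
    tangent₂ : t ≤ + 0 → SlopeS t (+ 250) (+ 170)

  data SlopeD (t : ℤ) : ℤ → ℤ → Set where
    chord   : + 0 ≤ t → SlopeD t (+ 0) (+ 120)
    tangent : t ≤ + 0 → SlopeD t (+ 75) (+ 171)

  -- The products are indices because the choice of lines depends on their signs, and because all
  -- five indices stay the same when x is replaced by -x.
  record Certificate (a² aA aB N M : ℤ) : Set where
    constructor certificate
    field
      {σ₁ σ₀ δ₁ δ₀} : ℤ
      slopeS : SlopeS aA σ₁ σ₀
      slopeD : SlopeD aB δ₁ δ₀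
      F₁-large : + 240 ≤ F₁ σ₁ δ₁ a² aA aB N M
      F₀-large : + 241 ≤ F₀ σ₀ δ₀ a² aA aB N M

  -- Without products of neighbours the variables separate. Taking `- w` as the seventh variable
  -- turns `v - w` into a sum, so one bound in a single variable serves both `v` and `w`.
  separate : ∀ ℓ k k′ {m m′} →
    (∀ n → m ≤ ℓ * (n * n) + k * n) → (∀ n → m′ ≤ ℓ * (n * n) + k′ * n) →
    ∀ u₁ u₂ u₃ u₄ u₅ v w →
    + 5 * m + + 2 * m′ ≤
      ℓ * N u₁ u₂ u₃ u₄ u₅ v w + k * A u₁ u₂ u₃ u₄ u₅ + k′ * (v - w)
  separate ℓ k k′ {m} {m′} hu hv u₁ u₂ u₃ u₄ u₅ v w = subst₂ _≤_
    (left m m′) (right ℓ k k′ u₁ u₂ u₃ u₄ u₅ v w)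
    (ℤ.+-mono-≤ (hu u₁) (ℤ.+-mono-≤ (hu u₂) (ℤ.+-mono-≤ (hu u₃) (ℤ.+-mono-≤ (hu u₄)
      (ℤ.+-mono-≤ (hu u₅) (ℤ.+-mono-≤ (hv v) (hv (- w))))))))
    where
    left : ∀ m m′ → m + (m + (m + (m + (m + (m′ + m′))))) ≡ + 5 * m + + 2 * m′
    left = ℤ-Ring.solve-∀
    right : ∀ ℓ k k′ u₁ u₂ u₃ u₄ u₅ v w →
      ℓ * (u₁ * u₁) + k * u₁ + (ℓ * (u₂ * u₂) + k * u₂ + (ℓ * (u₃ * u₃) + k * u₃ +
        (ℓ * (u₄ * u₄) + k * u₄ + (ℓ * (u₅ * u₅) + k * u₅ +
          (ℓ * (v * v) + k′ * v + (ℓ * (- w * - w) + k′ * - w)))))) ≡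
      ℓ * (u₁ * u₁ + u₂ * u₂ + u₃ * u₃ + u₄ * u₄ + u₅ * u₅ + v * v + w * w) +
        k * (u₁ + u₂ + u₃ + u₄ + u₅) + k′ * (v - w)
    right = ℤ-Ring.solve-∀

  quad-nonNeg : ∀ i j n → + 0 ≤ (+ i + + j) * (n * n) + + j * n
  quad-nonNeg i j n = subst (+ 0 ≤_) (regroup (+ i) (+ j) n)
    (0≤+ (0≤scale i (0≤sq n)) (0≤scale j (0≤n[n+1] n)))
    where
    regroup : ∀ i j n → i * (n * n) + j * (n * (n + + 1)) ≡ (i + j) * (n * n) + j * n
    regroup = ℤ-Ring.solve-∀

  -- The left-hand side is the value at n = -1.
  quad-min : ∀ i j n → - (+ 2 * + j) ≤
    (+ 2 * (+ i + + j)) * (n * n) + (+ 2 * (+ i + + j) + + 2 * + j) * n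
  quad-min i j n = ≤-gap (0≤scale 2 (0≤+ (0≤scale i (0≤n[n+1] n)) (0≤scale j (0≤sq (n + + 1)))))
    (regroup (+ i) (+ j) n)
    where
    regroup : ∀ i j n → (+ 2 * (i + j)) * (n * n) + (+ 2 * (i + j) + + 2 * j) * n ≡
      - (+ 2 * j) + + 2 * (i * (n * (n + + 1)) + j * ((n + + 1) * (n + + 1)))
    regroup = ℤ-Ring.solve-∀

  quad-complete : ∀ h k n → - (k * k) ≤ (h * h) * (n * n) + (+ 2 * h * k) * n
  quad-complete h k n = ≤-gap (0≤sq (h * n + k)) (regroup h k n)
    where
    regroup : ∀ h k n → (h * h) * (n * n) + (+ 2 * h * k) * n ≡
      - (k * k) + (h * n + k) * (h * n + k)
    regroup = ℤ-Ring.solve-∀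

  -- Lower bounds for `F₁`.

  N-nonNeg : ∀ u₁ u₂ u₃ u₄ u₅ v w → + 0 ≤ N u₁ u₂ u₃ u₄ u₅ v w
  N-nonNeg u₁ u₂ u₃ u₄ u₅ v w =
    0≤+ (0≤+ (0≤+ (0≤+ (0≤+ (0≤+ (0≤sq u₁) (0≤sq u₂)) (0≤sq u₃)) (0≤sq u₄))
      (0≤sq u₅)) (0≤sq v)) (0≤sq w)

  -- Twice the coordinates of the lattice vector at α = 1.
  coords : (a u₁ u₂ u₃ u₄ u₅ v w : ℤ) → Vector ℤ 8
  coords a u₁ u₂ u₃ u₄ u₅ v w = lookup
    (a + + 2 * u₁ ∷ a + + 2 * (u₁ + u₂) ∷ a + + 2 * (u₂ + u₃) ∷
     a + + 2 * (u₃ + u₄) ∷ a + + 2 * (u₄ + u₅) ∷ a + + 2 * (u₅ + v) ∷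
     - a + + 2 * (v + w) ∷ a + + 2 * w ∷ [])

  -- Doubling the vector accounts for a factor 4. The remaining 2 reflects that E₈ is even: the
  -- bracket is half the squared norm.
  sumSq-coords : ∀ a u₁ u₂ u₃ u₄ u₅ v w →
    sumSq (coords a u₁ u₂ u₃ u₄ u₅ v w) ≡
    + 8 * (a * a + a * A u₁ u₂ u₃ u₄ u₅ + N u₁ u₂ u₃ u₄ u₅ v w + M u₁ u₂ u₃ u₄ u₅ v w)
  sumSq-coords = expand
    where
    expand : ∀ a u₁ u₂ u₃ u₄ u₅ v w →
      (a + + 2 * u₁) * (a + + 2 * u₁) +
        ((a + + 2 * (u₁ + u₂)) * (a + + 2 * (u₁ + u₂)) +
        ((a + + 2 * (u₂ + u₃)) * (a + + 2 * (u₂ + u₃)) +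
        ((a + + 2 * (u₃ + u₄)) * (a + + 2 * (u₃ + u₄)) +
        ((a + + 2 * (u₄ + u₅)) * (a + + 2 * (u₄ + u₅)) +
        ((a + + 2 * (u₅ + v)) * (a + + 2 * (u₅ + v)) +
        ((- a + + 2 * (v + w)) * (- a + + 2 * (v + w)) +
        ((a + + 2 * w) * (a + + 2 * w) + + 0))))))) ≡
      + 8 * (a * a + a * (u₁ + u₂ + u₃ + u₄ + u₅) +
        (u₁ * u₁ + u₂ * u₂ + u₃ * u₃ + u₄ * u₄ + u₅ * u₅ + v * v + w * w) +
        (u₁ * u₂ + u₂ * u₃ + u₃ * u₄ + u₄ * u₅ + u₅ * v + v * w))
    expand = ℤ-Ring.solve-∀

  -- In the alternating sum of the coordinates each of u₁, ..., w cancels, since it occurs in two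
  -- adjacent ones, while the minus sign in the seventh coordinate of b₁ leaves 2a instead of 0.
  -- Once a = 0, the other coefficients follow one at a time.
  coords-injective : ∀ a u₁ u₂ u₃ u₄ u₅ v w →
    (∀ i → coords a u₁ u₂ u₃ u₄ u₅ v w i ≡ + 0) → a * a + N u₁ u₂ u₃ u₄ u₅ v w ≡ + 0
  coords-injective a u₁ u₂ u₃ u₄ u₅ v w y≡0 =
    all-zero a≡0 u₁≡0 u₂≡0 u₃≡0 u₄≡0 u₅≡0 v≡0 w≡0
    where
    alternating : ∀ a u₁ u₂ u₃ u₄ u₅ v w → + 2 * a ≡
      (a + + 2 * w) - (- a + + 2 * (v + w)) + (a + + 2 * (u₅ + v)) - (a + + 2 * (u₄ + u₅)) +
      (a + + 2 * (u₃ + u₄)) - (a + + 2 * (u₂ + u₃)) + (a + + 2 * (u₁ + u₂)) - (a + + 2 * u₁)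
    alternating = ℤ-Ring.solve-∀
    vanish : ∀ {y₁ y₂ y₃ y₄ y₅ y₆ y₇ y₈} → y₁ ≡ + 0 → y₂ ≡ + 0 → y₃ ≡ + 0 → y₄ ≡ + 0 →
      y₅ ≡ + 0 → y₆ ≡ + 0 → y₇ ≡ + 0 → y₈ ≡ + 0 →
      y₈ - y₇ + y₆ - y₅ + y₄ - y₃ + y₂ - y₁ ≡ + 0
    vanish refl refl refl refl refl refl refl refl = refl
    all-zero : ∀ {a u₁ u₂ u₃ u₄ u₅ v w} → a ≡ + 0 → u₁ ≡ + 0 → u₂ ≡ + 0 → u₃ ≡ + 0 → u₄ ≡ + 0 →
      u₅ ≡ + 0 → v ≡ + 0 → w ≡ + 0 → a * a + N u₁ u₂ u₃ u₄ u₅ v w ≡ + 0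
    all-zero refl refl refl refl refl refl refl refl = refl
    halve : ∀ {i} → + 2 * i ≡ + 0 → i ≡ + 0
    halve {i} = ℤ.*-cancelˡ-≡ (+ 2) i (+ 0)
    cancel : ∀ {i j} → i ≡ + 0 → i + j ≡ + 0 → j ≡ + 0
    cancel {j = j} refl eq = trans (sym (ℤ.+-identityˡ j)) eq
    a≡0 = halve (trans (alternating a u₁ u₂ u₃ u₄ u₅ v w)
      (vanish (y≡0 0F) (y≡0 1F) (y≡0 2F) (y≡0 3F) (y≡0 4F) (y≡0 5F) (y≡0 6F) (y≡0 7F)))
    next : ∀ {i} → a + + 2 * i ≡ + 0 → i ≡ + 0
    next eq = halve (cancel a≡0 eq)
    u₁≡0 = next (y≡0 0F)
    u₂≡0 = cancel u₁≡0 (next (y≡0 1F))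
    u₃≡0 = cancel u₂≡0 (next (y≡0 2F))
    u₄≡0 = cancel u₃≡0 (next (y≡0 3F))
    u₅≡0 = cancel u₄≡0 (next (y≡0 4F))
    v≡0  = cancel u₅≡0 (next (y≡0 5F))
    w≡0  = next (y≡0 7F)

  -- Eight times the form is a nonzero sum of squares, so the form is positive, and being integral
  -- it is at least 1. This is the fact that nonzero vectors of E₈ have squared norm at least 2.
  E₈-positive : ∀ a u₁ u₂ u₃ u₄ u₅ v w → + 1 ≤ a * a + N u₁ u₂ u₃ u₄ u₅ v w →
    + 1 ≤ a * a + a * A u₁ u₂ u₃ u₄ u₅ + N u₁ u₂ u₃ u₄ u₅ v w + M u₁ u₂ u₃ u₄ u₅ v w
  E₈-positive a u₁ u₂ u₃ u₄ u₅ v w 1≤ with zero? (coords a u₁ u₂ u₃ u₄ u₅ v w)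
  ... | inj₁ y≡0 = contradiction
    (subst (+ 1 ≤_) (coords-injective a u₁ u₂ u₃ u₄ u₅ v w y≡0) 1≤) λ { (+≤+ ()) }
  ... | inj₂ 1≤y = ℤ.i<j⇒suc[i]≤j (ℤ.*-cancelˡ-<-nonNeg {i = + 0} (+ 8)
    (ℤ.suc[i]≤j⇒i<j (subst (+ 1 ≤_) (sumSq-coords a u₁ u₂ u₃ u₄ u₅ v w) 1≤y)))

  -- In the doubled coordinates at α = 1, F₁ is 30 times the sum of the squares plus 75 a (v - w),
  -- and v - w = (v + w) - 2w tilts only the last two coordinates. For a = 1 all of them are odd, so
  -- the first six contribute at least 30 each. With z = v + w the last two contribute 30 + 120z² -
  -- 45z and 30 + 120w² - 30w, still at least 30 on the integers.
  F₁-bound-1 : ∀ u₁ u₂ u₃ u₄ u₅ v w →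
    + 240 ≤ F₁ (+ 240) (+ 75) (+ 1 * + 1) (+ 1 * A u₁ u₂ u₃ u₄ u₅) (+ 1 * (v - w))
      (N u₁ u₂ u₃ u₄ u₅ v w) (M u₁ u₂ u₃ u₄ u₅ v w)
  F₁-bound-1 u₁ u₂ u₃ u₄ u₅ v w = ≤-gap
    (0≤+ (0≤+ (0≤+ (0≤+ (0≤+ (0≤+ (0≤+ (0≤+ (0≤+ (0≤scale 120 (0≤n[n+1] u₁))
        (0≤scale 120 (0≤n[n+1] (u₁ + u₂))))
        (0≤scale 120 (0≤n[n+1] (u₂ + u₃))))
        (0≤scale 120 (0≤n[n+1] (u₃ + u₄))))
        (0≤scale 120 (0≤n[n+1] (u₄ + u₅))))
        (0≤scale 120 (0≤n[n+1] (u₅ + v))))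
        (0≤scale 75 (0≤sq (v + w))))
        (0≤scale 45 (0≤n[n+1] (v + w - + 1))))
        (0≤scale 90 (0≤sq w)))
        (0≤scale 30 (0≤n[n+1] (w - + 1))))
    (regroup u₁ u₂ u₃ u₄ u₅ v w)
    where
    regroup : ∀ u₁ u₂ u₃ u₄ u₅ v w →
        + 240 * (+ 1 * + 1) + + 240 * (+ 1 * (u₁ + u₂ + u₃ + u₄ + u₅)) + + 75 * (+ 1 * (v - w)) +
        + 240 * (u₁ * u₁ + u₂ * u₂ + u₃ * u₃ + u₄ * u₄ + u₅ * u₅ + v * v + w * w) +
        + 240 * (u₁ * u₂ + u₂ * u₃ + u₃ * u₄ + u₄ * u₅ + u₅ * v + v * w) ≡
      + 240 + (
        + 120 * (u₁ * (u₁ + + 1)) +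
        + 120 * ((u₁ + u₂) * ((u₁ + u₂) + + 1)) +
        + 120 * ((u₂ + u₃) * ((u₂ + u₃) + + 1)) +
        + 120 * ((u₃ + u₄) * ((u₃ + u₄) + + 1)) +
        + 120 * ((u₄ + u₅) * ((u₄ + u₅) + + 1)) +
        + 120 * ((u₅ + v) * ((u₅ + v) + + 1)) +
        + 75 * ((v + w) * (v + w)) +
        + 45 * ((v + w - + 1) * ((v + w - + 1) + + 1)) +
        + 90 * (w * w) +
        + 30 * ((w - + 1) * ((w - + 1) + + 1)))
    regroup = ℤ-Ring.solve-∀

  -- For a = 2 the first six coordinates may vanish. With z = v + w the last two contribute 120 +
  -- 120z² - 90z and 120 + 120w² - 60w, so the 240 comes from these two alone.
  F₁-bound-2 : ∀ u₁ u₂ u₃ u₄ u₅ v w →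
    + 240 ≤ F₁ (+ 240) (+ 75) (+ 2 * + 2) (+ 2 * A u₁ u₂ u₃ u₄ u₅) (+ 2 * (v - w))
      (N u₁ u₂ u₃ u₄ u₅ v w) (M u₁ u₂ u₃ u₄ u₅ v w)
  F₁-bound-2 u₁ u₂ u₃ u₄ u₅ v w = ≤-gap
    (0≤+ (0≤+ (0≤+ (0≤+ (0≤+ (0≤+ (0≤+ (0≤+ (0≤+ (0≤scale 120 (0≤sq (+ 1 + u₁)))
        (0≤scale 120 (0≤sq (+ 1 + u₁ + u₂))))
        (0≤scale 120 (0≤sq (+ 1 + u₂ + u₃))))
        (0≤scale 120 (0≤sq (+ 1 + u₃ + u₄))))
        (0≤scale 120 (0≤sq (+ 1 + u₄ + u₅))))
        (0≤scale 120 (0≤sq (+ 1 + u₅ + v))))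
        (0≤scale 90 (0≤n[n+1] (v + w - + 1))))
        (0≤scale 30 (0≤sq (v + w))))
        (0≤scale 60 (0≤n[n+1] (w - + 1))))
        (0≤scale 60 (0≤sq w)))
    (regroup u₁ u₂ u₃ u₄ u₅ v w)
    where
    regroup : ∀ u₁ u₂ u₃ u₄ u₅ v w →
        + 240 * (+ 2 * + 2) + + 240 * (+ 2 * (u₁ + u₂ + u₃ + u₄ + u₅)) + + 75 * (+ 2 * (v - w)) +
        + 240 * (u₁ * u₁ + u₂ * u₂ + u₃ * u₃ + u₄ * u₄ + u₅ * u₅ + v * v + w * w) +
        + 240 * (u₁ * u₂ + u₂ * u₃ + u₃ * u₄ + u₄ * u₅ + u₅ * v + v * w) ≡
      + 240 + (
        + 120 * ((+ 1 + u₁) * (+ 1 + u₁)) +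
        + 120 * ((+ 1 + u₁ + u₂) * (+ 1 + u₁ + u₂)) +
        + 120 * ((+ 1 + u₂ + u₃) * (+ 1 + u₂ + u₃)) +
        + 120 * ((+ 1 + u₃ + u₄) * (+ 1 + u₃ + u₄)) +
        + 120 * ((+ 1 + u₄ + u₅) * (+ 1 + u₄ + u₅)) +
        + 120 * ((+ 1 + u₅ + v) * (+ 1 + u₅ + v)) +
        + 90 * ((v + w - + 1) * ((v + w - + 1) + + 1)) +
        + 30 * ((v + w) * (v + w)) +
        + 60 * ((w - + 1) * ((w - + 1) + + 1)) +
        + 60 * (w * w))
    regroup = ℤ-Ring.solve-∀

  -- The slope 250 adds 20 A to the form with slope 240. As A = u₁ + (u₂ + u₃) + (u₄ + u₅), this
  -- falls on three coordinates, each of which can lose 20. The whole 60 is lost at u = (-1, 0, -1,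
  -- 0, -1), v = w = 0. The hypothesis excludes v = w, and the last two coordinates then supply the
  -- missing 60: through w if w ≥ 1, and through v + w ≤ -1 otherwise.
  F₁-bound-2′ : ∀ u₁ u₂ u₃ u₄ u₅ v w → v - w ≤ - + 1 →
    + 240 ≤ F₁ (+ 250) (+ 75) (+ 2 * + 2) (+ 2 * A u₁ u₂ u₃ u₄ u₅) (+ 2 * (v - w))
      (N u₁ u₂ u₃ u₄ u₅ v w) (M u₁ u₂ u₃ u₄ u₅ v w)
  F₁-bound-2′ u₁ u₂ u₃ u₄ u₅ v w v-w≤-1 with + 1 ℤ.≤? w
  ... | yes 1≤w = ≤-gap
    (0≤+ (0≤+ (0≤+ (0≤+ (0≤+ (0≤+ (0≤+ (0≤+ (0≤+ (0≤+ (0≤+ (0≤scale 120 (0≤sq (+ 1 + u₁ + u₂)))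
        (0≤scale 120 (0≤sq (+ 1 + u₃ + u₄))))
        (0≤scale 120 (0≤sq (+ 1 + u₅ + v))))
        (0≤scale 100 (0≤sq (+ 1 + u₁))))
        (0≤scale 20 (0≤n[n+1] (+ 1 + u₁))))
        (0≤scale 100 (0≤sq (+ 1 + u₂ + u₃))))
        (0≤scale 20 (0≤n[n+1] (+ 1 + u₂ + u₃))))
        (0≤scale 100 (0≤sq (+ 1 + u₄ + u₅))))
        (0≤scale 20 (0≤n[n+1] (+ 1 + u₄ + u₅))))
        (0≤scale 90 (0≤n[n+1] (v + w - + 1))))
        (0≤scale 30 (0≤sq (v + w))))
        (0≤scale 60 (0≤* 0≤j (0≤+ (0≤scale 2 0≤j) (0≤-const 3)))))
    (regroup u₁ u₂ u₃ u₄ u₅ v w)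
    where
    0≤j : + 0 ≤ w - + 1
    0≤j = ℤ.i≤j⇒0≤j-i 1≤w
    regroup : ∀ u₁ u₂ u₃ u₄ u₅ v w →
        + 240 * (+ 2 * + 2) + + 250 * (+ 2 * (u₁ + u₂ + u₃ + u₄ + u₅)) + + 75 * (+ 2 * (v - w)) +
        + 240 * (u₁ * u₁ + u₂ * u₂ + u₃ * u₃ + u₄ * u₄ + u₅ * u₅ + v * v + w * w) +
        + 240 * (u₁ * u₂ + u₂ * u₃ + u₃ * u₄ + u₄ * u₅ + u₅ * v + v * w) ≡
      + 240 + (
        + 120 * ((+ 1 + u₁ + u₂) * (+ 1 + u₁ + u₂)) +
        + 120 * ((+ 1 + u₃ + u₄) * (+ 1 + u₃ + u₄)) +
        + 120 * ((+ 1 + u₅ + v) * (+ 1 + u₅ + v)) +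
        + 100 * ((+ 1 + u₁) * (+ 1 + u₁)) +
        + 20 * ((+ 1 + u₁) * ((+ 1 + u₁) + + 1)) +
        + 100 * ((+ 1 + u₂ + u₃) * (+ 1 + u₂ + u₃)) +
        + 20 * ((+ 1 + u₂ + u₃) * ((+ 1 + u₂ + u₃) + + 1)) +
        + 100 * ((+ 1 + u₄ + u₅) * (+ 1 + u₄ + u₅)) +
        + 20 * ((+ 1 + u₄ + u₅) * ((+ 1 + u₄ + u₅) + + 1)) +
        + 90 * ((v + w - + 1) * ((v + w - + 1) + + 1)) +
        + 30 * ((v + w) * (v + w)) +
        + 60 * ((w - + 1) * (+ 2 * (w - + 1) + + 3)))
    regroup = ℤ-Ring.solve-∀
  ... | no 1≰w = ≤-gap
    (0≤+ (0≤+ (0≤+ (0≤+ (0≤+ (0≤+ (0≤+ (0≤+ (0≤+ (0≤+ (0≤+ (0≤scale 120 (0≤sq (+ 1 + u₁ + u₂)))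
        (0≤scale 120 (0≤sq (+ 1 + u₃ + u₄))))
        (0≤scale 120 (0≤sq (+ 1 + u₅ + v))))
        (0≤scale 100 (0≤sq (+ 1 + u₁))))
        (0≤scale 20 (0≤n[n+1] (+ 1 + u₁))))
        (0≤scale 100 (0≤sq (+ 1 + u₂ + u₃))))
        (0≤scale 20 (0≤n[n+1] (+ 1 + u₂ + u₃))))
        (0≤scale 100 (0≤sq (+ 1 + u₄ + u₅))))
        (0≤scale 20 (0≤n[n+1] (+ 1 + u₄ + u₅))))
        (0≤scale 60 (0≤n[n+1] (w - + 1))))
        (0≤scale 60 (0≤sq w)))
        (0≤scale 30 (0≤+ (0≤* 0≤y (0≤+ (0≤scale 4 0≤y) (0≤-const 11))) (0≤-const 5))))
    (regroup u₁ u₂ u₃ u₄ u₅ v w)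
    where
    0≤y : + 0 ≤ (- + 1 - v - w)
    0≤y = subst (+ 0 ≤_) (rearrange v w) (0≤+ (ℤ.i≤j⇒0≤j-i v-w≤-1)
      (0≤scale 2 (ℤ.i≤j⇒0≤j-i (ℤ.i<j⇒i≤pred[j] (ℤ.≰⇒> 1≰w)))))
      where
      rearrange : ∀ v w → - + 1 - (v - w) + + 2 * (+ 0 - w) ≡ - + 1 - v - w
      rearrange = ℤ-Ring.solve-∀
    regroup : ∀ u₁ u₂ u₃ u₄ u₅ v w →
        + 240 * (+ 2 * + 2) + + 250 * (+ 2 * (u₁ + u₂ + u₃ + u₄ + u₅)) + + 75 * (+ 2 * (v - w)) +
        + 240 * (u₁ * u₁ + u₂ * u₂ + u₃ * u₃ + u₄ * u₄ + u₅ * u₅ + v * v + w * w) +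
        + 240 * (u₁ * u₂ + u₂ * u₃ + u₃ * u₄ + u₄ * u₅ + u₅ * v + v * w) ≡
      + 240 + (
        + 120 * ((+ 1 + u₁ + u₂) * (+ 1 + u₁ + u₂)) +
        + 120 * ((+ 1 + u₃ + u₄) * (+ 1 + u₃ + u₄)) +
        + 120 * ((+ 1 + u₅ + v) * (+ 1 + u₅ + v)) +
        + 100 * ((+ 1 + u₁) * (+ 1 + u₁)) +
        + 20 * ((+ 1 + u₁) * ((+ 1 + u₁) + + 1)) +
        + 100 * ((+ 1 + u₂ + u₃) * (+ 1 + u₂ + u₃)) +
        + 20 * ((+ 1 + u₂ + u₃) * ((+ 1 + u₂ + u₃) + + 1)) +
        + 100 * ((+ 1 + u₄ + u₅) * (+ 1 + u₄ + u₅)) +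
        + 20 * ((+ 1 + u₄ + u₅) * ((+ 1 + u₄ + u₅) + + 1)) +
        + 60 * ((w - + 1) * ((w - + 1) + + 1)) +
        + 60 * (w * w) +
        + 30 * ((- + 1 - v - w) * (+ 4 * (- + 1 - v - w) + + 11) + + 5))
    regroup = ℤ-Ring.solve-∀

  -- Minimising over real arguments is enough here and gives F₁ ≥ (15 · 115 / 32) a². At |a| = 2
  -- this is less than 216, which is why smaller values of a are treated by integrality.
  F₁-bound-3 : ∀ a u₁ u₂ u₃ u₄ u₅ v w → + 9 ≤ a * a →
    + 240 ≤ F₁ (+ 240) (+ 75) (a * a) (a * A u₁ u₂ u₃ u₄ u₅) (a * (v - w))
      (N u₁ u₂ u₃ u₄ u₅ v w) (M u₁ u₂ u₃ u₄ u₅ v w)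
  F₁-bound-3 a u₁ u₂ u₃ u₄ u₅ v w 9≤a² = subst (+ 240 ≤_)
    (rescale (a * a) (a * A u₁ u₂ u₃ u₄ u₅) (a * (v - w))
      (N u₁ u₂ u₃ u₄ u₅ v w) (M u₁ u₂ u₃ u₄ u₅ v w))
    -- 15 is the common factor of the coefficients, 240 = 15 · 16, and 32 clears the denominators of
    -- the completed squares. It remains to see that 32 · 16 = 512 is at most 115 · 9 = 1035.
    (ℤ.*-monoˡ-≤-nonNeg (+ 15) (*-cancel-≤ 31 {+ 16} (ℤ.≤-trans
      (ℤ.≤-trans (+≤+ (ℕ.m≤m+n 512 523)) (ℤ.*-monoˡ-≤-nonNeg (+ 115) 9≤a²))
      (≤-gap
        (0≤+ (0≤+ (0≤+ (0≤+ (0≤+ (0≤+ (0≤+ (0≤scale 64 (0≤sq (a + + 2 * u₁)))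
        (0≤scale 64 (0≤sq (a + + 2 * (u₁ + u₂)))))
        (0≤scale 64 (0≤sq (a + + 2 * (u₂ + u₃)))))
        (0≤scale 64 (0≤sq (a + + 2 * (u₃ + u₄)))))
        (0≤scale 64 (0≤sq (a + + 2 * (u₄ + u₅)))))
        (0≤scale 64 (0≤sq (a + + 2 * (u₅ + v)))))
        (0≤scale 1 (0≤sq (+ 8 * (- a + + 2 * (v + w)) + + 5 * a))))
        (0≤scale 4 (0≤sq (+ 4 * (a + + 2 * w) - + 5 * a))))
        (regroup a u₁ u₂ u₃ u₄ u₅ v w)))))
    where
    rescale : ∀ q x y n m →
      + 15 * (+ 16 * q + + 16 * x + + 5 * y + + 16 * n + + 16 * m) ≡
      + 240 * q + + 240 * x + + 75 * y + + 240 * n + + 240 * m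
    rescale = ℤ-Ring.solve-∀
    regroup : ∀ a u₁ u₂ u₃ u₄ u₅ v w →
      + 32 * (+ 16 * (a * a) + + 16 * (a * (u₁ + u₂ + u₃ + u₄ + u₅)) + + 5 * (a * (v - w)) +
        + 16 * (u₁ * u₁ + u₂ * u₂ + u₃ * u₃ + u₄ * u₄ + u₅ * u₅ + v * v + w * w) +
        + 16 * (u₁ * u₂ + u₂ * u₃ + u₃ * u₄ + u₄ * u₅ + u₅ * v + v * w)) ≡
      + 115 * (a * a) + (
        + 64 * ((a + + 2 * u₁) * (a + + 2 * u₁)) +
        + 64 * ((a + + 2 * (u₁ + u₂)) * (a + + 2 * (u₁ + u₂))) +
        + 64 * ((a + + 2 * (u₂ + u₃)) * (a + + 2 * (u₂ + u₃))) +
        + 64 * ((a + + 2 * (u₃ + u₄)) * (a + + 2 * (u₃ + u₄))) +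
        + 64 * ((a + + 2 * (u₄ + u₅)) * (a + + 2 * (u₄ + u₅))) +
        + 64 * ((a + + 2 * (u₅ + v)) * (a + + 2 * (u₅ + v))) +
        + 1 * ((+ 8 * (- a + + 2 * (v + w)) + + 5 * a) * (+ 8 * (- a + + 2 * (v + w)) + + 5 * a)) +
        + 4 * ((+ 4 * (a + + 2 * w) - + 5 * a) * (+ 4 * (a + + 2 * w) - + 5 * a)))
    regroup = ℤ-Ring.solve-∀

  -- Again over real arguments. In the scale of this certificate the slope 240 would leave 345 a²,
  -- and each of the three coordinates that carry the extra multiple of `A` costs 40 a², hence 225
  -- a².
  F₁-bound-3′ : ∀ a u₁ u₂ u₃ u₄ u₅ v w → + 9 ≤ a * a →
    + 240 ≤ F₁ (+ 250) (+ 75) (a * a) (a * A u₁ u₂ u₃ u₄ u₅) (a * (v - w))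
      (N u₁ u₂ u₃ u₄ u₅ v w) (M u₁ u₂ u₃ u₄ u₅ v w)
  F₁-bound-3′ a u₁ u₂ u₃ u₄ u₅ v w 9≤a² = subst (+ 240 ≤_)
    (rescale (a * a) (a * A u₁ u₂ u₃ u₄ u₅) (a * (v - w))
      (N u₁ u₂ u₃ u₄ u₅ v w) (M u₁ u₂ u₃ u₄ u₅ v w))
    (ℤ.*-monoˡ-≤-nonNeg (+ 5) (*-cancel-≤ 31 {+ 48} (ℤ.≤-trans
      (ℤ.≤-trans (+≤+ (ℕ.m≤m+n 1536 489)) (ℤ.*-monoˡ-≤-nonNeg (+ 225) 9≤a²))
      (≤-gap
        (0≤+ (0≤+ (0≤+ (0≤+ (0≤+ (0≤+ (0≤+ (0≤+ (0≤+ (0≤+ (0≤scale 192 (0≤sq (a + + 2 * (u₁ + u₂))))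
        (0≤scale 192 (0≤sq (a + + 2 * (u₃ + u₄)))))
        (0≤scale 192 (0≤sq (a + + 2 * (u₅ + v)))))
        (0≤scale 160 (0≤sq (a + + 2 * u₁))))
        (0≤scale 8 (0≤sq (+ 2 * (a + + 2 * u₁) + a))))
        (0≤scale 160 (0≤sq (a + + 2 * (u₂ + u₃)))))
        (0≤scale 8 (0≤sq (+ 2 * (a + + 2 * (u₂ + u₃)) + a))))
        (0≤scale 160 (0≤sq (a + + 2 * (u₄ + u₅)))))
        (0≤scale 8 (0≤sq (+ 2 * (a + + 2 * (u₄ + u₅)) + a))))
        (0≤scale 3 (0≤sq (+ 8 * (- a + + 2 * (v + w)) + + 5 * a))))
        (0≤scale 12 (0≤sq (+ 4 * (a + + 2 * w) - + 5 * a))))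
        (regroup a u₁ u₂ u₃ u₄ u₅ v w)))))
    where
    rescale : ∀ q x y n m →
      + 5 * (+ 48 * q + + 50 * x + + 15 * y + + 48 * n + + 48 * m) ≡
      + 240 * q + + 250 * x + + 75 * y + + 240 * n + + 240 * m
    rescale = ℤ-Ring.solve-∀
    regroup : ∀ a u₁ u₂ u₃ u₄ u₅ v w →
      + 32 * (+ 48 * (a * a) + + 50 * (a * (u₁ + u₂ + u₃ + u₄ + u₅)) + + 15 * (a * (v - w)) +
        + 48 * (u₁ * u₁ + u₂ * u₂ + u₃ * u₃ + u₄ * u₄ + u₅ * u₅ + v * v + w * w) +
        + 48 * (u₁ * u₂ + u₂ * u₃ + u₃ * u₄ + u₄ * u₅ + u₅ * v + v * w)) ≡
      + 225 * (a * a) + (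
        + 192 * ((a + + 2 * (u₁ + u₂)) * (a + + 2 * (u₁ + u₂))) +
        + 192 * ((a + + 2 * (u₃ + u₄)) * (a + + 2 * (u₃ + u₄))) +
        + 192 * ((a + + 2 * (u₅ + v)) * (a + + 2 * (u₅ + v))) +
        + 160 * ((a + + 2 * u₁) * (a + + 2 * u₁)) +
        + 8 * ((+ 2 * (a + + 2 * u₁) + a) * (+ 2 * (a + + 2 * u₁) + a)) +
        + 160 * ((a + + 2 * (u₂ + u₃)) * (a + + 2 * (u₂ + u₃))) +
        + 8 * ((+ 2 * (a + + 2 * (u₂ + u₃)) + a) * (+ 2 * (a + + 2 * (u₂ + u₃)) + a)) +
        + 160 * ((a + + 2 * (u₄ + u₅)) * (a + + 2 * (u₄ + u₅))) +
        + 8 * ((+ 2 * (a + + 2 * (u₄ + u₅)) + a) * (+ 2 * (a + + 2 * (u₄ + u₅)) + a)) +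
        + 3 * ((+ 8 * (- a + + 2 * (v + w)) + + 5 * a) * (+ 8 * (- a + + 2 * (v + w)) + + 5 * a)) +
        + 12 * ((+ 4 * (a + + 2 * w) - + 5 * a) * (+ 4 * (a + + 2 * w) - + 5 * a)))
    regroup = ℤ-Ring.solve-∀

  -- These slopes are the exact values 120 s = 240 and 120 d = 0 at p = 1, so F₁ is 120 times the
  -- squared norm in E₈.
  F₁-bound-E₈ : ∀ a u₁ u₂ u₃ u₄ u₅ v w → + 1 ≤ a * a + N u₁ u₂ u₃ u₄ u₅ v w →
    + 240 ≤ F₁ (+ 240) (+ 0) (a * a) (a * A u₁ u₂ u₃ u₄ u₅) (a * (v - w))
      (N u₁ u₂ u₃ u₄ u₅ v w) (M u₁ u₂ u₃ u₄ u₅ v w)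
  F₁-bound-E₈ a u₁ u₂ u₃ u₄ u₅ v w 1≤ = subst (+ 240 ≤_)
    (distribute (a * a) (a * A u₁ u₂ u₃ u₄ u₅) (a * (v - w))
      (N u₁ u₂ u₃ u₄ u₅ v w) (M u₁ u₂ u₃ u₄ u₅ v w))
    (ℤ.*-monoˡ-≤-nonNeg (+ 240) (E₈-positive a u₁ u₂ u₃ u₄ u₅ v w 1≤))
    where
    distribute : ∀ q x y n m → + 240 * (q + x + n + m) ≡
      + 240 * q + + 240 * x + + 0 * y + + 240 * n + + 240 * m
    distribute = ℤ-Ring.solve-∀

  -- Lower bounds for `F₀`.

  -- For a = 1 the term 240 N is split as 60 N + 180 N. The first part gives the excess over 240
  -- once N ≥ 1; the second absorbs the linear terms, because no slope at p = 0 exceeds 180.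
  quad₁-S : ∀ {t σ₁ σ₀} → SlopeS t σ₁ σ₀ → ∀ n → + 0 ≤ + 180 * (n * n) + σ₀ * n
  quad₁-S (chord _)    = quad-nonNeg 60 120
  quad₁-S (tangent₁ _) = quad-nonNeg 0 180
  quad₁-S (tangent₂ _) = quad-nonNeg 10 170

  quad₁-D : ∀ {t δ₁ δ₀} → SlopeD t δ₁ δ₀ → ∀ n → + 0 ≤ + 180 * (n * n) + δ₀ * n
  quad₁-D (chord _)   = quad-nonNeg 60 120
  quad₁-D (tangent _) = quad-nonNeg 9 171

  -- For a = 2 the slopes are doubled. They place the vertex -σ₀/240 between -3/4 and -1/2, so n =
  -- -1 gives the minimum over the integers.
  quad₂-S : ∀ {t σ₁ σ₀} → SlopeS t σ₁ σ₀ →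
    ∀ n → + 240 - + 2 * σ₀ ≤ + 240 * (n * n) + (+ 2 * σ₀) * n
  quad₂-S (chord _)    = quad-min 120 0
  quad₂-S (tangent₁ _) = quad-min 60 60
  quad₂-S (tangent₂ _) = quad-min 70 50

  quad₂-D : ∀ {t δ₁ δ₀} → SlopeD t δ₁ δ₀ →
    ∀ n → + 240 - + 2 * δ₀ ≤ + 240 * (n * n) + (+ 2 * δ₀) * n
  quad₂-D (chord _)   = quad-min 120 0
  quad₂-D (tangent _) = quad-min 69 51

  F₀-bound-0 : ∀ σ δ x y n m → + 2 ≤ n → + 241 ≤ F₀ σ δ (+ 0) (+ 0 * x) (+ 0 * y) n m
  F₀-bound-0 σ δ x y n m 2≤n = ≤-gap
    (0≤+ (0≤scale 240 (ℤ.i≤j⇒0≤j-i 2≤n)) (0≤-const 239)) (regroup σ δ x y n)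
    where
    regroup : ∀ σ δ x y n → + 240 * + 0 + σ * (+ 0 * x) + δ * (+ 0 * y) + + 240 * n ≡
      + 241 + (+ 240 * (n - + 2) + + 239)
    regroup = ℤ-Ring.solve-∀

  F₀-bound-1 : ∀ {s t σ₁ σ₀ δ₁ δ₀} → SlopeS s σ₁ σ₀ → SlopeD t δ₁ δ₀ →
    ∀ u₁ u₂ u₃ u₄ u₅ v w → + 1 ≤ N u₁ u₂ u₃ u₄ u₅ v w →
    + 241 ≤ F₀ σ₀ δ₀ (+ 1) (+ 1 * A u₁ u₂ u₃ u₄ u₅) (+ 1 * (v - w))
      (N u₁ u₂ u₃ u₄ u₅ v w) (M u₁ u₂ u₃ u₄ u₅ v w)
  F₀-bound-1 {σ₀ = σ} {δ₀ = δ} ss sd u₁ u₂ u₃ u₄ u₅ v w 1≤N = ≤-gap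
    (0≤+ (0≤+ (0≤scale 60 (ℤ.i≤j⇒0≤j-i 1≤N)) (0≤-const 59))
      (separate (+ 180) σ δ (quad₁-S ss) (quad₁-D sd) u₁ u₂ u₃ u₄ u₅ v w))
    (regroup σ δ (A u₁ u₂ u₃ u₄ u₅) (v - w) (N u₁ u₂ u₃ u₄ u₅ v w))
    where
    regroup : ∀ σ δ x y n → + 240 * + 1 + σ * (+ 1 * x) + δ * (+ 1 * y) + + 240 * n ≡
      + 241 + (+ 60 * (n - + 1) + + 59 + (+ 180 * n + σ * x + δ * y))
    regroup = ℤ-Ring.solve-∀

  F₀-bound-2 : ∀ {s t σ₁ σ₀ δ₁ δ₀} → SlopeS s σ₁ σ₀ → SlopeD t δ₁ δ₀ →
    + 241 ≤ + 960 + (+ 5 * (+ 240 - + 2 * σ₀) + + 2 * (+ 240 - + 2 * δ₀)) →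
    ∀ u₁ u₂ u₃ u₄ u₅ v w →
    + 241 ≤ F₀ σ₀ δ₀ (+ 4) (+ 2 * A u₁ u₂ u₃ u₄ u₅) (+ 2 * (v - w))
      (N u₁ u₂ u₃ u₄ u₅ v w) (M u₁ u₂ u₃ u₄ u₅ v w)
  F₀-bound-2 {σ₀ = σ} {δ₀ = δ} ss sd 241≤ u₁ u₂ u₃ u₄ u₅ v w = ℤ.≤-trans 241≤
    (ℤ.≤-trans
      (ℤ.+-monoʳ-≤ (+ 960) (separate (+ 240) (+ 2 * σ) (+ 2 * δ) (quad₂-S ss) (quad₂-D sd)
        u₁ u₂ u₃ u₄ u₅ v w))
      (ℤ.≤-reflexive
        (regroup σ δ (A u₁ u₂ u₃ u₄ u₅) (v - w) (N u₁ u₂ u₃ u₄ u₅ v w))))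
    where
    regroup : ∀ σ δ x y n →
      + 960 + (+ 240 * n + + 2 * σ * x + + 2 * δ * y) ≡
      + 240 * + 4 + σ * (+ 2 * x) + δ * (+ 2 * y) + + 240 * n
    regroup = ℤ-Ring.solve-∀

  -- 25707 = ⌈960 · 241 / 9⌉.
  F₀-bound-3 : ∀ σ δ → + 25707 ≤ + 480 * + 480 - + 5 * (σ * σ) - + 2 * (δ * δ) →
    ∀ a u₁ u₂ u₃ u₄ u₅ v w → + 9 ≤ a * a →
    + 241 ≤ F₀ σ δ (a * a) (a * A u₁ u₂ u₃ u₄ u₅) (a * (v - w))
      (N u₁ u₂ u₃ u₄ u₅ v w) (M u₁ u₂ u₃ u₄ u₅ v w)
  F₀-bound-3 σ δ 25707≤ a u₁ u₂ u₃ u₄ u₅ v w 9≤a² = *-cancel-≤ 959 (begin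
    + 960 * + 241                                       ≤⟨ +≤+ (ℕ.m≤m+n 231360 3) ⟩
    + 25707 * + 9                                       ≤⟨ ℤ.*-monoˡ-≤-nonNeg (+ 25707) 9≤a² ⟩
    + 25707 * (a * a)
      ≤⟨ ℤ.*-monoʳ-≤-nonNeg (a * a) {{nonNegative (0≤sq a)}} 25707≤ ⟩
    (+ 480 * + 480 - + 5 * (σ * σ) - + 2 * (δ * δ)) * (a * a) ≡⟨ collect (+ 480) σ δ a ⟩
    + 480 * + 480 * (a * a) + (+ 5 * - (σ * a * (σ * a)) + + 2 * - (δ * a * (δ * a)))
      ≤⟨ ℤ.+-monoʳ-≤ (+ 480 * + 480 * (a * a))
           (separate (+ 480 * + 480) (+ 2 * + 480 * (σ * a)) (+ 2 * + 480 * (δ * a))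
             (quad-complete (+ 480) (σ * a)) (quad-complete (+ 480) (δ * a))
             u₁ u₂ u₃ u₄ u₅ v w) ⟩
    + 480 * + 480 * (a * a) + (+ 480 * + 480 * N u₁ u₂ u₃ u₄ u₅ v w +
      + 2 * + 480 * (σ * a) * A u₁ u₂ u₃ u₄ u₅ + + 2 * + 480 * (δ * a) * (v - w))
      ≡⟨ regroup (+ 240) σ δ a (A u₁ u₂ u₃ u₄ u₅) (v - w) (N u₁ u₂ u₃ u₄ u₅ v w) ⟩
    + 960 * (+ 240 * (a * a) + σ * (a * A u₁ u₂ u₃ u₄ u₅) + δ * (a * (v - w)) +
      + 240 * N u₁ u₂ u₃ u₄ u₅ v w) ∎)
    where
    open ℤ.≤-Reasoning
    collect : ∀ h σ δ a → (h * h - + 5 * (σ * σ) - + 2 * (δ * δ)) * (a * a) ≡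
      h * h * (a * a) + (+ 5 * - (σ * a * (σ * a)) + + 2 * - (δ * a * (δ * a)))
    collect = ℤ-Ring.solve-∀
    regroup : ∀ q σ δ a x y n →
      (+ 2 * q) * (+ 2 * q) * (a * a) + ((+ 2 * q) * (+ 2 * q) * n +
        + 2 * (+ 2 * q) * (σ * a) * x + + 2 * (+ 2 * q) * (δ * a) * y) ≡
      (+ 4 * q) * (q * (a * a) + σ * (a * x) + δ * (a * y) + q * n)
    regroup = ℤ-Ring.solve-∀

  -- Choice of the lines according to a and the signs of A and B.

  Certified : (a u₁ u₂ u₃ u₄ u₅ v w : ℤ) → Set
  Certified a u₁ u₂ u₃ u₄ u₅ v w =
    Certificate (a * a) (a * A u₁ u₂ u₃ u₄ u₅) (a * (v - w))
      (N u₁ u₂ u₃ u₄ u₅ v w) (M u₁ u₂ u₃ u₄ u₅ v w)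

  certified-0 : ∀ u₁ u₂ u₃ u₄ u₅ v w → + 2 ≤ N u₁ u₂ u₃ u₄ u₅ v w →
    Certified (+ 0) u₁ u₂ u₃ u₄ u₅ v w
  certified-0 u₁ u₂ u₃ u₄ u₅ v w 2≤N = certificate
    (chord (ℤ.≤-reflexive (sym (ℤ.*-zeroˡ (A u₁ u₂ u₃ u₄ u₅)))))
    (chord (ℤ.≤-reflexive (sym (ℤ.*-zeroˡ (v - w)))))
    (F₁-bound-E₈ (+ 0) u₁ u₂ u₃ u₄ u₅ v w
      (ℤ.≤-trans (ℤ.≤-trans (+≤+ (ℕ.s≤s ℕ.z≤n)) 2≤N)
        (ℤ.≤-reflexive (sym (ℤ.+-identityˡ (N u₁ u₂ u₃ u₄ u₅ v w))))))
    (F₀-bound-0 (+ 120) (+ 120) (A u₁ u₂ u₃ u₄ u₅) (v - w)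
      (N u₁ u₂ u₃ u₄ u₅ v w) (M u₁ u₂ u₃ u₄ u₅ v w) 2≤N)

  1≤a²+N : ∀ n u₁ u₂ u₃ u₄ u₅ v w → + 1 ≤ + suc n * + suc n + N u₁ u₂ u₃ u₄ u₅ v w
  1≤a²+N n u₁ u₂ u₃ u₄ u₅ v w =
    ℤ.+-mono-≤ (1≤sq (+ suc n) λ ()) (N-nonNeg u₁ u₂ u₃ u₄ u₅ v w)

  certified-1 : ∀ u₁ u₂ u₃ u₄ u₅ v w → + 1 ≤ N u₁ u₂ u₃ u₄ u₅ v w →
    Certified (+ 1) u₁ u₂ u₃ u₄ u₅ v w
  certified-1 u₁ u₂ u₃ u₄ u₅ v w 1≤N = choose
    (ℤ.≤-total (+ 0) (+ 1 * A u₁ u₂ u₃ u₄ u₅)) (ℤ.≤-total (+ 0) (+ 1 * (v - w)))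
    where
    combine : ∀ {σ₀ δ₁ δ₀} → SlopeS (+ 1 * A u₁ u₂ u₃ u₄ u₅) (+ 240) σ₀ →
      SlopeD (+ 1 * (v - w)) δ₁ δ₀ →
      + 240 ≤ F₁ (+ 240) δ₁ (+ 1) (+ 1 * A u₁ u₂ u₃ u₄ u₅) (+ 1 * (v - w))
        (N u₁ u₂ u₃ u₄ u₅ v w) (M u₁ u₂ u₃ u₄ u₅ v w) →
      Certified (+ 1) u₁ u₂ u₃ u₄ u₅ v w
    combine ss sd f₁ = certificate ss sd f₁ (F₀-bound-1 ss sd u₁ u₂ u₃ u₄ u₅ v w 1≤N)
    e₈ = F₁-bound-E₈ (+ 1) u₁ u₂ u₃ u₄ u₅ v w (1≤a²+N 0 u₁ u₂ u₃ u₄ u₅ v w)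
    f₁ = F₁-bound-1 u₁ u₂ u₃ u₄ u₅ v w
    choose : + 0 ≤ + 1 * A u₁ u₂ u₃ u₄ u₅ ⊎ + 1 * A u₁ u₂ u₃ u₄ u₅ ≤ + 0 →
      + 0 ≤ + 1 * (v - w) ⊎ + 1 * (v - w) ≤ + 0 → Certified (+ 1) u₁ u₂ u₃ u₄ u₅ v w
    choose (inj₁ 0≤A) (inj₁ 0≤B) = combine (chord 0≤A) (chord 0≤B) e₈
    choose (inj₁ 0≤A) (inj₂ B≤0) = combine (chord 0≤A) (tangent B≤0) f₁
    choose (inj₂ A≤0) (inj₁ 0≤B) = combine (tangent₁ A≤0) (chord 0≤B) e₈
    choose (inj₂ A≤0) (inj₂ B≤0) = combine (tangent₁ A≤0) (tangent B≤0) f₁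

  -- `tangent₁` together with `tangent` would fail here: at uᵢ = v = -1, w = 1 it gives F₀ = 156.
  -- The smaller slope 170 of `tangent₂` at p = 0 raises this value to 256.
  certified-2 : ∀ u₁ u₂ u₃ u₄ u₅ v w → Certified (+ 2) u₁ u₂ u₃ u₄ u₅ v w
  certified-2 u₁ u₂ u₃ u₄ u₅ v w = choose
    -- For v - w a strict alternative is required, because the bound with slope 250 needs v - w ≤
    -- -1.
    (ℤ.≤-total (+ 0) (+ 2 * A u₁ u₂ u₃ u₄ u₅)) (+ 0 ℤ.≤? + 2 * (v - w))
    where
    combine : ∀ {σ₁ σ₀ δ₁ δ₀} (ss : SlopeS (+ 2 * A u₁ u₂ u₃ u₄ u₅) σ₁ σ₀)
      (sd : SlopeD (+ 2 * (v - w)) δ₁ δ₀) →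
      + 241 ≤ + 960 + (+ 5 * (+ 240 - + 2 * σ₀) + + 2 * (+ 240 - + 2 * δ₀)) →
      + 240 ≤ F₁ σ₁ δ₁ (+ 4) (+ 2 * A u₁ u₂ u₃ u₄ u₅) (+ 2 * (v - w))
        (N u₁ u₂ u₃ u₄ u₅ v w) (M u₁ u₂ u₃ u₄ u₅ v w) →
      Certified (+ 2) u₁ u₂ u₃ u₄ u₅ v w
    combine ss sd f₀ f₁ = certificate ss sd f₁ (F₀-bound-2 ss sd f₀ u₁ u₂ u₃ u₄ u₅ v w)
    e₈ = F₁-bound-E₈ (+ 2) u₁ u₂ u₃ u₄ u₅ v w (1≤a²+N 1 u₁ u₂ u₃ u₄ u₅ v w)
    negative : ¬ + 0 ≤ + 2 * (v - w) → v - w ≤ - + 1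
    negative B≱0 = ℤ.i<j⇒i≤pred[j] (ℤ.*-cancelˡ-<-nonNeg {j = + 0} (+ 2) (ℤ.≰⇒> B≱0))
    choose : + 0 ≤ + 2 * A u₁ u₂ u₃ u₄ u₅ ⊎ + 2 * A u₁ u₂ u₃ u₄ u₅ ≤ + 0 →
      Dec (+ 0 ≤ + 2 * (v - w)) → Certified (+ 2) u₁ u₂ u₃ u₄ u₅ v w
    choose (inj₁ 0≤A) (yes 0≤B) =
      combine (chord 0≤A) (chord 0≤B) (+≤+ (ℕ.m≤m+n 241 719)) e₈
    choose (inj₁ 0≤A) (no B≱0) =
      combine (chord 0≤A) (tangent (ℤ.<⇒≤ (ℤ.≰⇒> B≱0))) (+≤+ (ℕ.m≤m+n 241 515))
        (F₁-bound-2 u₁ u₂ u₃ u₄ u₅ v w)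
    choose (inj₂ A≤0) (yes 0≤B) =
      combine (tangent₁ A≤0) (chord 0≤B) (+≤+ (ℕ.m≤m+n 241 119)) e₈
    choose (inj₂ A≤0) (no B≱0) =
      combine (tangent₂ A≤0) (tangent (ℤ.<⇒≤ (ℤ.≰⇒> B≱0))) (+≤+ (ℕ.m≤m+n 241 15))
        (F₁-bound-2′ u₁ u₂ u₃ u₄ u₅ v w (negative B≱0))

  -- With both products negative, `tangent₁` would give 480² - 5 · 180² - 2 · 171² = 9918, short of
  -- 25707; the slope 170 of `tangent₂` gives 27418.
  certified-3+ : ∀ n u₁ u₂ u₃ u₄ u₅ v w → Certified (+ (3 ℕ.+ n)) u₁ u₂ u₃ u₄ u₅ v w
  certified-3+ n u₁ u₂ u₃ u₄ u₅ v w = choose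
    (ℤ.≤-total (+ 0) (a * A u₁ u₂ u₃ u₄ u₅)) (ℤ.≤-total (+ 0) (a * (v - w)))
    where
    a = + (3 ℕ.+ n)
    9≤a² : + 9 ≤ a * a
    9≤a² = ≤-gap (0≤* (0≤-const n) (0≤-const (n ℕ.+ 6))) (expand (+ n))
      where
      expand : ∀ n → (+ 3 + n) * (+ 3 + n) ≡ + 9 + n * (n + + 6)
      expand = ℤ-Ring.solve-∀
    combine : ∀ {σ₁ σ₀ δ₁ δ₀} (ss : SlopeS (a * A u₁ u₂ u₃ u₄ u₅) σ₁ σ₀)
      (sd : SlopeD (a * (v - w)) δ₁ δ₀) →
      + 25707 ≤ + 480 * + 480 - + 5 * (σ₀ * σ₀) - + 2 * (δ₀ * δ₀) →
      + 240 ≤ F₁ σ₁ δ₁ (a * a) (a * A u₁ u₂ u₃ u₄ u₅) (a * (v - w))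
        (N u₁ u₂ u₃ u₄ u₅ v w) (M u₁ u₂ u₃ u₄ u₅ v w) →
      Certified a u₁ u₂ u₃ u₄ u₅ v w
    combine {σ₀ = σ₀} {δ₀ = δ₀} ss sd f₀ f₁ =
      certificate ss sd f₁ (F₀-bound-3 σ₀ δ₀ f₀ a u₁ u₂ u₃ u₄ u₅ v w 9≤a²)
    e₈ = F₁-bound-E₈ a u₁ u₂ u₃ u₄ u₅ v w (1≤a²+N (2 ℕ.+ n) u₁ u₂ u₃ u₄ u₅ v w)
    choose : + 0 ≤ a * A u₁ u₂ u₃ u₄ u₅ ⊎ a * A u₁ u₂ u₃ u₄ u₅ ≤ + 0 →
      + 0 ≤ a * (v - w) ⊎ a * (v - w) ≤ + 0 → Certified a u₁ u₂ u₃ u₄ u₅ v w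
    choose (inj₁ 0≤A) (inj₁ 0≤B) =
      combine (chord 0≤A) (chord 0≤B) (+≤+ (ℕ.m≤m+n 25707 103893)) e₈
    choose (inj₁ 0≤A) (inj₂ B≤0) =
      combine (chord 0≤A) (tangent B≤0) (+≤+ (ℕ.m≤m+n 25707 74211))
        (F₁-bound-3 a u₁ u₂ u₃ u₄ u₅ v w 9≤a²)
    choose (inj₂ A≤0) (inj₁ 0≤B) =
      combine (tangent₁ A≤0) (chord 0≤B) (+≤+ (ℕ.m≤m+n 25707 13893)) e₈
    choose (inj₂ A≤0) (inj₂ B≤0) =
      combine (tangent₂ A≤0) (tangent B≤0) (+≤+ (ℕ.m≤m+n 25707 1711))
        (F₁-bound-3′ a u₁ u₂ u₃ u₄ u₅ v w 9≤a²)

  certified-+ : ∀ n u₁ u₂ u₃ u₄ u₅ v w →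
    + 2 ≤ + n * + n + N u₁ u₂ u₃ u₄ u₅ v w → Certified (+ n) u₁ u₂ u₃ u₄ u₅ v w
  certified-+ 0 u₁ u₂ u₃ u₄ u₅ v w 2≤ = certified-0 u₁ u₂ u₃ u₄ u₅ v w
    (subst (+ 2 ≤_) (ℤ.+-identityˡ (N u₁ u₂ u₃ u₄ u₅ v w)) 2≤)
  certified-+ 1 u₁ u₂ u₃ u₄ u₅ v w 2≤ = certified-1 u₁ u₂ u₃ u₄ u₅ v w
    (subst (+ 1 ≤_) (trans (sym (ℤ.+-assoc (- + 1) (+ 1) n)) (ℤ.+-identityˡ n))
      (ℤ.+-monoʳ-≤ (- + 1) 2≤))
    where n = N u₁ u₂ u₃ u₄ u₅ v w
  certified-+ 2 u₁ u₂ u₃ u₄ u₅ v w _  = certified-2 u₁ u₂ u₃ u₄ u₅ v w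
  certified-+ (suc (suc (suc n))) u₁ u₂ u₃ u₄ u₅ v w _ = certified-3+ n u₁ u₂ u₃ u₄ u₅ v w

  certified : ∀ a u₁ u₂ u₃ u₄ u₅ v w →
    + 2 ≤ a * a + N u₁ u₂ u₃ u₄ u₅ v w → Certified a u₁ u₂ u₃ u₄ u₅ v w
  certified (+ n) = certified-+ n
  -- Passing to -x makes the leading coefficient positive, and the indices of the certificate are
  -- even in x.
  certified a@(-[1+ n ]) u₁ u₂ u₃ u₄ u₅ v w 2≤ =
    subst₂ (λ x y → Certificate (a * a) x y (N u₁ u₂ u₃ u₄ u₅ v w) (M u₁ u₂ u₃ u₄ u₅ v w))
      (A-even a u₁ u₂ u₃ u₄ u₅) (B-even a v w)
      (subst₂ (λ x y → Certificate (a * a)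
          (- a * A (- u₁) (- u₂) (- u₃) (- u₄) (- u₅)) (- a * (- v - - w)) x y)
        (N-even u₁ u₂ u₃ u₄ u₅ v w) (M-even u₁ u₂ u₃ u₄ u₅ v w)
        (certified-+ (suc n) (- u₁) (- u₂) (- u₃) (- u₄) (- u₅) (- v) (- w)
          (subst (λ x → + 2 ≤ a * a + x) (sym (N-even u₁ u₂ u₃ u₄ u₅ v w)) 2≤)))
    where
    A-even : ∀ a u₁ u₂ u₃ u₄ u₅ →
      - a * (- u₁ + - u₂ + - u₃ + - u₄ + - u₅) ≡ a * (u₁ + u₂ + u₃ + u₄ + u₅)
    A-even = ℤ-Ring.solve-∀
    B-even : ∀ a v w → - a * (- v - - w) ≡ a * (v - w)
    B-even = ℤ-Ring.solve-∀
    N-even : ∀ u₁ u₂ u₃ u₄ u₅ v w →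
      - u₁ * - u₁ + - u₂ * - u₂ + - u₃ * - u₃ + - u₄ * - u₄ + - u₅ * - u₅ +
        - v * - v + - w * - w ≡
      u₁ * u₁ + u₂ * u₂ + u₃ * u₃ + u₄ * u₄ + u₅ * u₅ + v * v + w * w
    N-even = ℤ-Ring.solve-∀
    M-even : ∀ u₁ u₂ u₃ u₄ u₅ v w →
      - u₁ * - u₂ + - u₂ * - u₃ + - u₃ * - u₄ + - u₄ * - u₅ + - u₅ * - v + - v * - w ≡
      u₁ * u₂ + u₂ * u₃ + u₃ * u₄ + u₄ * u₅ + u₅ * v + v * w
    M-even = ℤ-Ring.solve-∀

-- Null and nonnegative reals.

open IntegerForm
open import Defs
open import Algebra.Definitions.RawMonoid +-rawMonoid using (sum)
open import Data.Vec.Functional.Relation.Binary.Equality.Setoid ℝ-setoid using (_≋_)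
open +-*-Solver using (Polynomial; solve; con; _:=_; _:+_; _:-_; _:*_; :-_)

-- x ≈ y and x ≤ y unfold to functions and so do not determine x and y; these
-- records do.
record Null (x : ℝ) : Set where
  constructor null
  field
    limit : ∀ ε → 0ℚ ℚ.< ε → ∃[ N ] ∀ n → N ℕ.≤ n → ℚ.∣ seq x n ∣ ℚ.< ε

open Null

record NonNeg (x : ℝ) : Set where
  constructor nonNeg
  field
    lower : ∀ ε → 0ℚ ℚ.< ε → ∃[ N ] ∀ n → N ℕ.≤ n → 0ℚ ℚ.≤ seq x n ℚ.+ ε

open NonNeg

0<ε/2 : ∀ {ε} → 0ℚ ℚ.< ε → 0ℚ ℚ.< ε ℚ.* ½
0<ε/2 0<ε = pos* 0<ε 0<½

≈⇒null : ∀ {x y} → x ≈ y → Null (x - y)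
≈⇒null x≈y = null x≈y

null⇒≈ : ∀ {x y} → Null (x - y) → x ≈ y
null⇒≈ = limit

null-resp : ∀ {x y} → (∀ n → seq x n ≡ seq y n) → Null x → Null y
null-resp eq x-null = null λ ε 0<ε → let N , h = limit x-null ε 0<ε in
  N , λ n N≤n → subst (λ q → ℚ.∣ q ∣ ℚ.< ε) (eq n) (h n N≤n)

null-0 : ∀ {x} → (∀ n → seq x n ≡ 0ℚ) → Null x
null-0 eq = null λ ε 0<ε → 0 , λ n _ → subst (λ q → ℚ.∣ q ∣ ℚ.< ε) (sym (eq n)) 0<ε

null-+ : ∀ {x y} → Null x → Null y → Null (x + y)
null-+ {x} {y} x-null y-null = null λ ε 0<ε →
  let M , h = limit x-null (ε ℚ.* ½) (0<ε/2 0<ε)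
      N , k = limit y-null (ε ℚ.* ½) (0<ε/2 0<ε)
  in M ℕ.⊔ N , λ n le → subst (_ ℚ.<_) (half+half ε) (∣∣-split {seq x n} {seq y n} refl
       (h n (ℕ.≤-trans (ℕ.m≤m⊔n M N) le)) (k n (ℕ.≤-trans (ℕ.m≤n⊔m M N) le)))

null-neg : ∀ {x} → Null x → Null (- x)
null-neg {x} x-null = null λ ε 0<ε → let N , h = limit x-null ε 0<ε in
  N , λ n N≤n → subst (ℚ._< ε) (sym (ℚ.∣-p∣≡∣p∣ (seq x n))) (h n N≤n)

null-* : ∀ y {x} → Null x → Null (y * x)
null-* y {x} x-null = null λ ε 0<ε →
  let N , B , 0<B , bd = bounded y
      δ , 0<δ , Bδ     = tolerance 0<B 0<ε
      M , h            = limit x-null δ 0<δ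
  in M ℕ.⊔ N , λ n le → ℚ.<-trans
       (∣*∣≤ (seq y n) (seq x n) (bd n (ℕ.≤-trans (ℕ.m≤n⊔m M N) le)) 0<B
         (h n (ℕ.≤-trans (ℕ.m≤m⊔n M N) le)))
       (subst₂ ℚ._<_ (sym Bδ) (half+half ε)
         (subst (ℚ._< ε ℚ.* ½ ℚ.+ ε ℚ.* ½) (ℚ.+-identityʳ (ε ℚ.* ½))
           (ℚ.+-monoʳ-< (ε ℚ.* ½) (0<ε/2 0<ε))))

nonNeg-resp : ∀ {x y} → (∀ n → seq x n ≡ seq y n) → NonNeg x → NonNeg y
nonNeg-resp eq 0≤x = nonNeg λ ε 0<ε → let N , h = lower 0≤x ε 0<ε in
  N , λ n N≤n → subst (λ q → 0ℚ ℚ.≤ q ℚ.+ ε) (eq n) (h n N≤n)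

nonNeg-pointwise : ∀ {x} → (∀ n → 0ℚ ℚ.≤ seq x n) → NonNeg x
nonNeg-pointwise 0≤x = nonNeg λ ε 0<ε → 0 , λ n _ → ℚ.+-mono-≤ (0≤x n) (ℚ.<⇒≤ 0<ε)

null⇒nonNeg : ∀ {x} → Null x → NonNeg x
null⇒nonNeg {x} x-null = nonNeg λ ε 0<ε → let N , h = limit x-null ε 0<ε in
  N , λ n N≤n → subst (ℚ._≤ seq x n ℚ.+ ε) (ℚ.+-inverseʳ (seq x n))
    (ℚ.+-monoʳ-≤ (seq x n) (ℚ.≤-trans (p≤∣p∣ (ℚ.- seq x n))
      (ℚ.≤-trans (ℚ.≤-reflexive (ℚ.∣-p∣≡∣p∣ (seq x n))) (ℚ.<⇒≤ (h n N≤n)))))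

≤⇒nonNeg : ∀ {x y} → x ≤ y → NonNeg (y - x)
≤⇒nonNeg {x} {y} x≤y = nonNeg λ ε 0<ε → let N , h = x≤y ε 0<ε in
  N , λ n N≤n → subst₂ ℚ._≤_ (ℚ.+-inverseʳ (seq x n)) (shift (seq y n) ε (seq x n))
    (ℚ.+-monoˡ-≤ (ℚ.- seq x n) (h n N≤n))
  where
  shift : ∀ y e x → y ℚ.+ e ℚ.- x ≡ y ℚ.- x ℚ.+ e
  shift = solve 3 (λ y e x → y :+ e :- x := y :- x :+ e) refl

nonNeg⇒≤ : ∀ {x y} → NonNeg (y - x) → x ≤ y
nonNeg⇒≤ {x} {y} 0≤y-x ε 0<ε = let N , h = lower 0≤y-x ε 0<ε in
  N , λ n N≤n → subst₂ ℚ._≤_ (ℚ.+-identityˡ (seq x n)) (shift (seq y n) ε (seq x n))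
    (ℚ.+-monoˡ-≤ (seq x n) (h n N≤n))
  where
  shift : ∀ y e x → y ℚ.- x ℚ.+ e ℚ.+ x ≡ y ℚ.+ e
  shift = solve 3 (λ y e x → y :- x :+ e :+ x := y :+ e) refl

nonNeg-+ : ∀ {x y} → NonNeg x → NonNeg y → NonNeg (x + y)
nonNeg-+ {x} {y} 0≤x 0≤y = nonNeg λ ε 0<ε →
  let M , h = lower 0≤x (ε ℚ.* ½) (0<ε/2 0<ε)
      N , k = lower 0≤y (ε ℚ.* ½) (0<ε/2 0<ε)
  in M ℕ.⊔ N , λ n le → subst (0ℚ ℚ.≤_)
       (trans (regroup (seq x n) (seq y n) (ε ℚ.* ½))
         (cong (seq x n ℚ.+ seq y n ℚ.+_) (half+half ε)))
       (ℚ.+-mono-≤ (h n (ℕ.≤-trans (ℕ.m≤m⊔n M N) le)) (k n (ℕ.≤-trans (ℕ.m≤n⊔m M N) le)))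
  where
  regroup : ∀ x y e → x ℚ.+ e ℚ.+ (y ℚ.+ e) ≡ x ℚ.+ y ℚ.+ (e ℚ.+ e)
  regroup = solve 3 (λ x y e → x :+ e :+ (y :+ e) := x :+ y :+ (e :+ e)) refl

0≤pq : ∀ {p q} → 0ℚ ℚ.≤ p → 0ℚ ℚ.≤ q → 0ℚ ℚ.≤ p ℚ.* q
0≤pq {p} {q} 0≤p 0≤q = ℚ.nonNegative⁻¹ _
  {{ℚ.nonNeg*nonNeg⇒nonNeg p {{ℚ.nonNegative 0≤p}} q {{ℚ.nonNegative 0≤q}}}}

-- x y + ε is (x + δ) (y + η) up to δ y + (x + δ) η ≤ ε.
nonNeg-* : ∀ {x y} → NonNeg x → NonNeg y → NonNeg (x * y)
nonNeg-* {x} {y} 0≤x 0≤y = nonNeg λ ε 0<ε →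
  let K , B , 0<B , bx = bounded x
      L , C , 0<C , by = bounded y
      δ , 0<δ , Cδ     = tolerance 0<C 0<ε
      η , 0<η , Aη     = tolerance (ℚ.+-mono-< 0<B 0<δ) 0<ε
      M , h            = lower 0≤x δ 0<δ
      N , k            = lower 0≤y η 0<η
      index            = (K ℕ.⊔ L) ℕ.⊔ (M ℕ.⊔ N)
  in index , λ n le →
    let x≤B = ℚ.≤-trans (p≤∣p∣ (seq x n)) (ℚ.<⇒≤ (bx n
                (ℕ.≤-trans (ℕ.≤-trans (ℕ.m≤m⊔n K L) (ℕ.m≤m⊔n _ _)) le)))
        y≤C = ℚ.≤-trans (p≤∣p∣ (seq y n)) (ℚ.<⇒≤ (by n
                (ℕ.≤-trans (ℕ.≤-trans (ℕ.m≤n⊔m K L) (ℕ.m≤m⊔n _ _)) le)))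
        0≤x+δ = h n (ℕ.≤-trans (ℕ.≤-trans (ℕ.m≤m⊔n M N) (ℕ.m≤n⊔m (K ℕ.⊔ L) _)) le)
        0≤y+η = k n (ℕ.≤-trans (ℕ.≤-trans (ℕ.m≤n⊔m M N) (ℕ.m≤n⊔m (K ℕ.⊔ L) _)) le)
    in begin
      0ℚ
        ≤⟨ ℚ.+-mono-≤ (0≤pq 0≤x+δ 0≤y+η) (ℚ.+-mono-≤
             (0≤pq (0≤q-p y≤C) (ℚ.<⇒≤ 0<δ))
             (0≤pq (0≤q-p (ℚ.+-monoˡ-≤ δ x≤B)) (ℚ.<⇒≤ 0<η))) ⟩
      (seq x n ℚ.+ δ) ℚ.* (seq y n ℚ.+ η) ℚ.+
        ((C ℚ.- seq y n) ℚ.* δ ℚ.+ ((B ℚ.+ δ) ℚ.- (seq x n ℚ.+ δ)) ℚ.* η)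
        ≡⟨ regroup (seq x n) (seq y n) δ η C (B ℚ.+ δ) ⟩
      seq x n ℚ.* seq y n ℚ.+ (C ℚ.* δ ℚ.+ (B ℚ.+ δ) ℚ.* η)
        ≡⟨ cong (seq x n ℚ.* seq y n ℚ.+_) (trans (cong₂ ℚ._+_ Cδ Aη) (half+half ε)) ⟩
      seq x n ℚ.* seq y n ℚ.+ ε ∎
  where
  open ℚ.≤-Reasoning
  0≤q-p : ∀ {p q} → p ℚ.≤ q → 0ℚ ℚ.≤ q ℚ.- p
  0≤q-p {p} {q} p≤q = subst (ℚ._≤ q ℚ.- p) (ℚ.+-inverseʳ p) (ℚ.+-monoˡ-≤ (ℚ.- p) p≤q)
  regroup : ∀ x y d e c a →
    (x ℚ.+ d) ℚ.* (y ℚ.+ e) ℚ.+ ((c ℚ.- y) ℚ.* d ℚ.+ (a ℚ.- (x ℚ.+ d)) ℚ.* e) ≡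
    x ℚ.* y ℚ.+ (c ℚ.* d ℚ.+ a ℚ.* e)
  regroup = solve 6 (λ x y d e c a →
    (x :+ d) :* (y :+ e) :+ ((c :- y) :* d :+ (a :- (x :+ d)) :* e) :=
    x :* y :+ (c :* d :+ a :* e)) refl

nonNeg-sq : ∀ x → NonNeg (x * x)
nonNeg-sq x = nonNeg-pointwise λ n → 0≤p² (seq x n)
  where
  0≤p² : ∀ p → 0ℚ ℚ.≤ p ℚ.* p
  0≤p² p with ℚ.≤-total 0ℚ p
  ... | inj₁ 0≤p = 0≤pq 0≤p 0≤p
  ... | inj₂ p≤0 = subst (0ℚ ℚ.≤_) (neg² p) (0≤pq (ℚ.neg-antimono-≤ p≤0) (ℚ.neg-antimono-≤ p≤0))
    where
    neg² : ∀ p → ℚ.- p ℚ.* ℚ.- p ≡ p ℚ.* p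
    neg² = solve 1 (λ p → :- p :* :- p := p :* p) refl

nonNeg-const : ∀ {q} → 0ℚ ℚ.≤ q → NonNeg (fromℚ q)
nonNeg-const 0≤q = nonNeg-pointwise λ _ → 0≤q

nonNeg-antisym : ∀ {x} → NonNeg x → NonNeg (- x) → Null x
nonNeg-antisym {x} 0≤x 0≤-x = null λ ε 0<ε →
  let M , h = lower 0≤x (ε ℚ.* ½) (0<ε/2 0<ε)
      N , k = lower 0≤-x (ε ℚ.* ½) (0<ε/2 0<ε)
  in M ℕ.⊔ N , λ n le → ∣∣<
       (below ε 0<ε (seq x n) (k n (ℕ.≤-trans (ℕ.m≤n⊔m M N) le)))
       (below ε 0<ε (ℚ.- seq x n) (subst (λ q → 0ℚ ℚ.≤ q ℚ.+ ε ℚ.* ½)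
         (neg-neg (seq x n)) (h n (ℕ.≤-trans (ℕ.m≤m⊔n M N) le))))
  where
  neg-neg : ∀ p → p ≡ ℚ.- (ℚ.- p)
  neg-neg = solve 1 (λ p → p := :- (:- p)) refl
  below : ∀ ε → 0ℚ ℚ.< ε → ∀ p → 0ℚ ℚ.≤ ℚ.- p ℚ.+ ε ℚ.* ½ → p ℚ.< ε
  below ε 0<ε p 0≤ = begin-strict
    p                                      ≡⟨ ℚ.+-identityˡ p ⟨
    0ℚ ℚ.+ p                               <⟨ ℚ.+-monoˡ-< p (ℚ.+-mono-≤-< 0≤ (0<ε/2 0<ε)) ⟩
    ℚ.- p ℚ.+ ε ℚ.* ½ ℚ.+ ε ℚ.* ½ ℚ.+ p    ≡⟨ regroup p (ε ℚ.* ½) ⟩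
    ε ℚ.* ½ ℚ.+ ε ℚ.* ½                    ≡⟨ half+half ε ⟩
    ε                                      ∎
    where
    open ℚ.≤-Reasoning
    regroup : ∀ p e → ℚ.- p ℚ.+ e ℚ.+ e ℚ.+ p ≡ e ℚ.+ e
    regroup = solve 2 (λ p e → :- p :+ e :+ e :+ p := e :+ e) refl

¬nonNeg-negative : ∀ {q} → 0ℚ ℚ.< q → ¬ NonNeg (fromℚ (ℚ.- q))
¬nonNeg-negative {q} 0<q 0≤-q = let N , h = lower 0≤-q (q ℚ.* ½) (0<ε/2 0<q) in
  ℚ.<-irrefl refl (ℚ.<-≤-trans (0<ε/2 0<q) (subst₂ ℚ._≤_ (ℚ.+-identityˡ (q ℚ.* ½)) (cancel q)
    (ℚ.+-monoˡ-≤ (q ℚ.* ½) (h N ℕ.≤-refl))))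
  where
  cancel : ∀ q → ℚ.- q ℚ.+ q ℚ.* ½ ℚ.+ q ℚ.* ½ ≡ 0ℚ
  cancel = solve 1 (λ q → :- q :+ q :* con ½ :+ q :* con ½ := con 0ℚ) refl

-- Reciprocals of reals that are at least 1.

⊔1-mono : ∀ {p q e} → 0ℚ ℚ.≤ e → p ℚ.≤ q ℚ.+ e → p ℚ.⊔ 1ℚ ℚ.≤ (q ℚ.⊔ 1ℚ) ℚ.+ e
⊔1-mono {p} {q} {e} 0≤e p≤q+e = ℚ.⊔-lub
  (ℚ.≤-trans p≤q+e (ℚ.+-monoˡ-≤ e (ℚ.p≤p⊔q q 1ℚ)))
  (ℚ.+-mono-≤ (ℚ.p≤q⊔p q 1ℚ) 0≤e)

0<⊔1 : ∀ q → 0ℚ ℚ.< q ℚ.⊔ 1ℚ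
0<⊔1 q = ℚ.<-≤-trans (ℚ.positive⁻¹ 1ℚ) (ℚ.p≤q⊔p q 1ℚ)

-- Clamping at 1 makes the reciprocal total and bounded by 1. The reals inverted below are powers of
-- α and `weight α ᾱ 8`, all at least 1, where the clamp changes nothing in the limit.
recip₁ : ℚ → ℚ
recip₁ q = ℚ.1/ (q ℚ.⊔ 1ℚ)
  where instance _ = ℚ.pos⇒nonZero (q ℚ.⊔ 1ℚ) {{ℚ.positive (0<⊔1 q)}}

recip₁-inverse : ∀ q → (q ℚ.⊔ 1ℚ) ℚ.* recip₁ q ≡ 1ℚ
recip₁-inverse q = ℚ.*-inverseʳ (q ℚ.⊔ 1ℚ)
  where instance _ = ℚ.pos⇒nonZero (q ℚ.⊔ 1ℚ) {{ℚ.positive (0<⊔1 q)}}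

0≤recip₁ : ∀ q → 0ℚ ℚ.≤ recip₁ q
0≤recip₁ q = ℚ.<⇒≤ (ℚ.positive⁻¹ _ {{ℚ.1/pos⇒pos (q ℚ.⊔ 1ℚ)}})
  where instance _ = ℚ.positive (0<⊔1 q)

recip₁≤1 : ∀ q → recip₁ q ℚ.≤ 1ℚ
recip₁≤1 q = subst₂ ℚ._≤_ (ℚ.*-identityˡ (recip₁ q)) (recip₁-inverse q)
  (ℚ.*-monoʳ-≤-nonNeg (recip₁ q) {{ℚ.nonNegative (0≤recip₁ q)}} (ℚ.p≤q⊔p q 1ℚ))

∣recip₁*∣< : ∀ q {p e} → ℚ.∣ p ∣ ℚ.< e → ℚ.∣ recip₁ q ℚ.* p ∣ ℚ.< e
∣recip₁*∣< q {p} {e} p<e = begin-strict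
  ℚ.∣ recip₁ q ℚ.* p ∣          ≡⟨ ℚ.∣p*q∣≡∣p∣*∣q∣ (recip₁ q) p ⟩
  ℚ.∣ recip₁ q ∣ ℚ.* ℚ.∣ p ∣    ≡⟨ cong (ℚ._* ℚ.∣ p ∣) (ℚ.0≤p⇒∣p∣≡p (0≤recip₁ q)) ⟩
  recip₁ q ℚ.* ℚ.∣ p ∣          ≤⟨ ℚ.*-monoʳ-≤-nonNeg ℚ.∣ p ∣ {{ℚ.∣-∣-nonNeg p}} (recip₁≤1 q) ⟩
  1ℚ ℚ.* ℚ.∣ p ∣                ≡⟨ ℚ.*-identityˡ ℚ.∣ p ∣ ⟩
  ℚ.∣ p ∣                       <⟨ p<e ⟩
  e                             ∎
  where open ℚ.≤-Reasoning

-- 1/u - 1/v = (1/u) (1/v) (v - u) with u, v ≥ 1.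
recip : ℝ → ℝ
recip y = mkℝ (λ n → recip₁ (seq y n)) λ ε 0<ε → let N , h = cauchy y ε 0<ε in
  N , λ m n N≤m N≤n → subst (λ p → ℚ.∣ p ∣ ℚ.< ε) (difference (seq y m) (seq y n))
    (∣recip₁*∣< (seq y m) (∣recip₁*∣< (seq y n)
      (∣∣< (gap ε (seq y n) (seq y m) (h n m N≤n N≤m))
        (subst (ℚ._< ε) (sym (neg-minus (seq y n ℚ.⊔ 1ℚ) (seq y m ℚ.⊔ 1ℚ)))
          (gap ε (seq y m) (seq y n) (h m n N≤m N≤n))))))
  where
  gap : ∀ ε p q → ℚ.∣ p ℚ.- q ∣ ℚ.< ε → (p ℚ.⊔ 1ℚ) ℚ.- (q ℚ.⊔ 1ℚ) ℚ.< ε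
  gap ε p q p-q<ε = ℚ.≤-<-trans
    (subst ((p ℚ.⊔ 1ℚ) ℚ.- (q ℚ.⊔ 1ℚ) ℚ.≤_) (cancel (q ℚ.⊔ 1ℚ) ℚ.∣ p ℚ.- q ∣)
      (ℚ.+-monoˡ-≤ (ℚ.- (q ℚ.⊔ 1ℚ)) (⊔1-mono {q = q} (ℚ.0≤∣p∣ (p ℚ.- q))
        (subst (ℚ._≤ q ℚ.+ ℚ.∣ p ℚ.- q ∣) (restore p q)
          (ℚ.+-monoʳ-≤ q (p≤∣p∣ (p ℚ.- q))))))) p-q<ε
    where
    cancel : ∀ q e → q ℚ.+ e ℚ.- q ≡ e
    cancel = solve 2 (λ q e → q :+ e :- q := e) refl
    restore : ∀ p q → q ℚ.+ (p ℚ.- q) ≡ p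
    restore = solve 2 (λ p q → q :+ (p :- q) := p) refl
  difference : ∀ p q →
    recip₁ p ℚ.* (recip₁ q ℚ.* ((q ℚ.⊔ 1ℚ) ℚ.- (p ℚ.⊔ 1ℚ))) ≡ recip₁ p ℚ.- recip₁ q
  difference p q = begin
    r ℚ.* (s ℚ.* (v ℚ.- u))         ≡⟨ expand r s u v ⟩
    r ℚ.* (v ℚ.* s) ℚ.- s ℚ.* (u ℚ.* r)
      ≡⟨ cong₂ (λ x y → r ℚ.* x ℚ.- s ℚ.* y) (recip₁-inverse q) (recip₁-inverse p) ⟩
    r ℚ.* 1ℚ ℚ.- s ℚ.* 1ℚ           ≡⟨ cong₂ ℚ._-_ (ℚ.*-identityʳ r) (ℚ.*-identityʳ s) ⟩
    r ℚ.- s                         ∎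
    where
    open ≡-Reasoning
    r = recip₁ p
    s = recip₁ q
    u = p ℚ.⊔ 1ℚ
    v = q ℚ.⊔ 1ℚ
    expand : ∀ r s u v →
      r ℚ.* (s ℚ.* (v ℚ.- u)) ≡ r ℚ.* (v ℚ.* s) ℚ.- s ℚ.* (u ℚ.* r)
    expand = solve 4 (λ r s u v →
      r :* (s :* (v :- u)) := r :* (v :* s) :- s :* (u :* r)) refl

nonNeg-recip : ∀ y → NonNeg (recip y)
nonNeg-recip y = nonNeg-pointwise λ n → 0≤recip₁ (seq y n)

*-recip : ∀ y → NonNeg (y - 1ℝ) → Null (y * recip y - 1ℝ)
*-recip y 1≤y = null λ ε 0<ε → let N , h = lower 1≤y (ε ℚ.* ½) (0<ε/2 0<ε) in
  N , λ n N≤n → subst (λ p → ℚ.∣ p ∣ ℚ.< ε) (difference (seq y n))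
    (∣recip₁*∣< (seq y n) (∣∣<
      (ℚ.≤-<-trans (above (seq y n)) 0<ε)
      (ℚ.≤-<-trans (below (seq y n) (ℚ.<⇒≤ (0<ε/2 0<ε)) (h n N≤n)) (half< 0<ε))))
  where
  half< : ∀ {ε} → 0ℚ ℚ.< ε → ε ℚ.* ½ ℚ.< ε
  half< {ε} 0<ε = subst₂ ℚ._<_ (ℚ.+-identityʳ (ε ℚ.* ½)) (half+half ε)
    (ℚ.+-monoʳ-< (ε ℚ.* ½) (0<ε/2 0<ε))
  above : ∀ q → q ℚ.- (q ℚ.⊔ 1ℚ) ℚ.≤ 0ℚ
  above q = subst (q ℚ.- (q ℚ.⊔ 1ℚ) ℚ.≤_) (ℚ.+-inverseʳ (q ℚ.⊔ 1ℚ))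
    (ℚ.+-monoˡ-≤ (ℚ.- (q ℚ.⊔ 1ℚ)) (ℚ.p≤p⊔q q 1ℚ))
  below : ∀ q {e} → 0ℚ ℚ.≤ e → 0ℚ ℚ.≤ q ℚ.- 1ℚ ℚ.+ e → ℚ.- (q ℚ.- (q ℚ.⊔ 1ℚ)) ℚ.≤ e
  below q {e} 0≤e 0≤ = subst₂ ℚ._≤_ (sym (neg-minus q (q ℚ.⊔ 1ℚ))) (cancel q e)
    (ℚ.+-monoˡ-≤ (ℚ.- q) (ℚ.⊔-lub
      (subst (ℚ._≤ q ℚ.+ e) (ℚ.+-identityʳ q) (ℚ.+-monoʳ-≤ q 0≤e))
      (subst₂ ℚ._≤_ (ℚ.+-identityˡ 1ℚ) (restore q e) (ℚ.+-monoˡ-≤ 1ℚ 0≤))))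
    where
    cancel : ∀ q e → q ℚ.+ e ℚ.- q ≡ e
    cancel = solve 2 (λ q e → q :+ e :- q := e) refl
    restore : ∀ q e → q ℚ.- 1ℚ ℚ.+ e ℚ.+ 1ℚ ≡ q ℚ.+ e
    restore = solve 2 (λ q e → q :- con 1ℚ :+ e :+ con 1ℚ := q :+ e) refl
  difference : ∀ q → recip₁ q ℚ.* (q ℚ.- (q ℚ.⊔ 1ℚ)) ≡ q ℚ.* recip₁ q ℚ.- 1ℚ
  difference q = trans (expand (recip₁ q) q (q ℚ.⊔ 1ℚ))
    (cong (λ p → q ℚ.* recip₁ q ℚ.- p) (recip₁-inverse q))
    where
    expand : ∀ r q u → r ℚ.* (q ℚ.- u) ≡ q ℚ.* r ℚ.- u ℚ.* r
    expand = solve 3 (λ r q u → r :* (q :- u) := q :* r :- u :* r) refl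

-- With r the reciprocal of y, x = r (y x) - x (y r - 1), and y r - 1 is null.
null-cancel : ∀ y x → NonNeg (y - 1ℝ) → Null (y * x) → Null x
null-cancel y x 1≤y yx-null = null-resp
  (λ n → solve 3 (λ y x r → r :* (y :* x) :+ :- (x :* (y :* r :- con 1ℚ)) := x) refl
      (seq y n) (seq x n) (seq (recip y) n))
  (null-+ (null-* (recip y) yx-null) (null-neg (null-* x (*-recip y 1≤y))))

nonNeg-cancel : ∀ y x → NonNeg (y - 1ℝ) → NonNeg (y * x) → NonNeg x
nonNeg-cancel y x 1≤y 0≤yx = nonNeg-resp
  (λ n → solve 3 (λ y x r → r :* (y :* x) :+ :- (x :* (y :* r :- con 1ℚ)) := x) refl
      (seq y n) (seq x n) (seq (recip y) n))
  (nonNeg-+ (nonNeg-* (nonNeg-recip y) 0≤yx)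
    (null⇒nonNeg (null-neg (null-* x (*-recip y 1≤y)))))

√-mono : ∀ {x y} → x ≤ y → √ x ≤ √ y
√-mono {x} {y} x≤y ε 0<ε =
  let e = ε ℚ.* ½
      0<e = 0<ε/2 0<ε
      N , h = x≤y (e ℚ.* e) (pos* 0<e 0<e)
  in N ℕ.⊔ ↧ₙ e , λ n le → ℚ.<⇒≤ (ℚ.<-≤-trans
    (√approx-mono (seq x n ⁺) (seq y n ⁺) e n n (ℚ.<⇒≤ 0<e) (0≤⁺ (seq y n)) (0≤⁺ (seq x n))
      (⁺-mono (seq x n) (seq y n) (e ℚ.* e) (ℚ.<⇒≤ (pos* 0<e 0<e))
        (h n (ℕ.≤-trans (ℕ.m≤m⊔n N (↧ₙ e)) le))))
    (ℚ.+-monoʳ-≤ (seq (√ y) n) (ℚ.≤-trans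
      (ℚ.+-monoˡ-≤ e (archimedean e 0<e n (ℕ.≤-trans (ℕ.m≤n⊔m N (↧ₙ e)) le)))
      (ℚ.≤-reflexive (half+half ε)))))

-- The embedding of the integers.

ι : ℤ → ℚ
ι i = i ℚ./ 1

ι-+ : ∀ i j → ι (i ℤ.+ j) ≡ ι i ℚ.+ ι j
ι-+ i j = ℚ.toℚᵘ-injective (begin
  toℚᵘ (ι (i ℤ.+ j))            ≈⟨ toℚᵘ-/ (i ℤ.+ j) 0 ⟩
  mkℚᵘ (i ℤ.+ j) 0
    ≈⟨ *≡* (cong (ℤ._* + 1) (cong₂ ℤ._+_ (sym (ℤ.*-identityʳ i)) (sym (ℤ.*-identityʳ j)))) ⟩
  mkℚᵘ i 0 ℚᵘ.+ mkℚᵘ j 0        ≈⟨ ℚᵘ.+-cong (toℚᵘ-/ i 0) (toℚᵘ-/ j 0) ⟨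
  toℚᵘ (ι i) ℚᵘ.+ toℚᵘ (ι j)    ≈⟨ ℚ.toℚᵘ-homo-+ (ι i) (ι j) ⟨
  toℚᵘ (ι i ℚ.+ ι j)            ∎)
  where open ℚᵘ.≃-Reasoning

ι-* : ∀ i j → ι (i ℤ.* j) ≡ ι i ℚ.* ι j
ι-* i j = ℚ.toℚᵘ-injective (begin
  toℚᵘ (ι (i ℤ.* j))            ≈⟨ toℚᵘ-/ (i ℤ.* j) 0 ⟩
  mkℚᵘ i 0 ℚᵘ.* mkℚᵘ j 0        ≈⟨ ℚᵘ.*-cong (toℚᵘ-/ i 0) (toℚᵘ-/ j 0) ⟨
  toℚᵘ (ι i) ℚᵘ.* toℚᵘ (ι j)    ≈⟨ ℚ.toℚᵘ-homo-* (ι i) (ι j) ⟨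
  toℚᵘ (ι i ℚ.* ι j)            ∎)
  where open ℚᵘ.≃-Reasoning

ι-neg : ∀ i → ι (ℤ.- i) ≡ ℚ.- ι i
ι-neg i = ℚ.toℚᵘ-injective (begin
  toℚᵘ (ι (ℤ.- i))              ≈⟨ toℚᵘ-/ (ℤ.- i) 0 ⟩
  ℚᵘ.- mkℚᵘ i 0                 ≈⟨ ℚᵘ.-‿cong (toℚᵘ-/ i 0) ⟨
  ℚᵘ.- toℚᵘ (ι i)               ≈⟨ ℚ.toℚᵘ-homo‿- (ι i) ⟨
  toℚᵘ (ℚ.- ι i)                ∎)
  where open ℚᵘ.≃-Reasoning

ι-mono-≤ : ∀ {i j} → i ℤ.≤ j → ι i ℚ.≤ ι j
ι-mono-≤ {i} {j} i≤j = ℚ.toℚᵘ-cancel-≤ (begin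
  toℚᵘ (ι i)   ≃⟨ toℚᵘ-/ i 0 ⟩
  mkℚᵘ i 0     ≤⟨ *≤* (ℤ.*-monoʳ-≤-nonNeg (+ 1) i≤j) ⟩
  mkℚᵘ j 0     ≃⟨ toℚᵘ-/ j 0 ⟨
  toℚᵘ (ι j)   ∎)
  where open ℚᵘ.≤-Reasoning

ι-injective : ∀ {i j} → ι i ≡ ι j → i ≡ j
ι-injective {i} {j} eq with
  ℚᵘ.≃-trans (ℚᵘ.≃-sym (toℚᵘ-/ i 0)) (ℚᵘ.≃-trans (ℚᵘ.≃-reflexive (cong toℚᵘ eq)) (toℚᵘ-/ j 0))
... | *≡* i≡j = ℤ.*-cancelʳ-≡ i j (+ 1) i≡j

infix  4 _↦_
infixl 6 _⊕_ _⊖_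
infixl 7 _⊗_

-- A proof assembled with `_⊕_`, `_⊗_` and `_⊖_` mirrors the expression for i, so `ι` is moved
-- through a whole polynomial at once. As a record it determines both i and q.
record _↦_ (i : ℤ) (q : ℚ) : Set where
  constructor ↦-intro
  field
    ι≡ : ι i ≡ q

open _↦_

⟪_⟫ : ∀ i → i ↦ ι i
⟪ i ⟫ = ↦-intro refl

_⊕_ : ∀ {i j p q} → i ↦ p → j ↦ q → i ℤ.+ j ↦ p ℚ.+ q
_⊕_ {i} {j} (↦-intro refl) (↦-intro refl) = ↦-intro (ι-+ i j)

_⊗_ : ∀ {i j p q} → i ↦ p → j ↦ q → i ℤ.* j ↦ p ℚ.* q
_⊗_ {i} {j} (↦-intro refl) (↦-intro refl) = ↦-intro (ι-* i j)

_⊖_ : ∀ {i j p q} → i ↦ p → j ↦ q → i ℤ.- j ↦ p ℚ.- q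
_⊖_ {i} {j} (↦-intro refl) (↦-intro refl) = ↦-intro
  (trans (ι-+ i (ℤ.- j)) (cong (ι i ℚ.+_) (ι-neg j)))

nonNeg-ι : ∀ {i j} → i ℤ.≤ j → NonNeg (fromℤ j - fromℤ i)
nonNeg-ι {i} {j} i≤j = nonNeg-pointwise λ _ → subst (ℚ._≤ ι j ℚ.- ι i) (ℚ.+-inverseʳ (ι i))
  (ℚ.+-monoˡ-≤ (ℚ.- ι i) (ι-mono-≤ i≤j))

nonNeg-fromℤ : ∀ {i} → + 0 ℤ.≤ i → NonNeg (fromℤ i)
nonNeg-fromℤ 0≤i = nonNeg-const (ι-mono-≤ 0≤i)

nonNeg-eventually : ∀ {x} → (∃[ N ] ∀ n → N ℕ.≤ n → 0ℚ ℚ.≤ seq x n) → NonNeg x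
nonNeg-eventually (N , h) = nonNeg λ ε 0<ε → N , λ n N≤n → ℚ.+-mono-≤ (h n N≤n) (ℚ.<⇒≤ 0<ε)

2ℚ : ℚ
2ℚ = ι (+ 2)

-- Inequalities on the circle α² + ᾱ² = 2.

-- With ᾱ a variable that is nonnegative and lies on the circle with α, the estimates reduce to
-- polynomial identities modulo the circle relation, and no square root is expanded.
module Circle (α ᾱ : ℝ) (ε : ℚ) (0<ε : 0ℚ ℚ.< ε) (1+ε≤α : NonNeg (α - 1ℝ - fromℚ ε))
  (0≤ᾱ : NonNeg ᾱ) (circle-null : Null (α * α + ᾱ * ᾱ - 2ℝ)) where

  p s d : ℝ
  p = α * ᾱ
  s = α + ᾱ
  d = α - ᾱ

  1≤α : NonNeg (α - 1ℝ)
  1≤α = nonNeg-resp (λ n → solve 2 (λ a e → a :- con 1ℚ :- e :+ e := a :- con 1ℚ) refl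
      (seq α n) ε)
    (nonNeg-+ 1+ε≤α (nonNeg-const (ℚ.<⇒≤ 0<ε)))

  0≤α : NonNeg α
  0≤α = nonNeg-resp (λ n → solve 1 (λ a → a :- con 1ℚ :+ con 1ℚ := a) refl
      (seq α n))
    (nonNeg-+ 1≤α (nonNeg-const (ℚ.<⇒≤ (ℚ.positive⁻¹ 1ℚ))))

  α²≤2 : NonNeg (2ℝ - α * α)
  α²≤2 = nonNeg-resp
    (λ n → solve 2 (λ a b → b :* b :+ :- (a :* a :+ b :* b :- con 2ℚ) := con 2ℚ :- a :* a) refl
      (seq α n) (seq ᾱ n))
    (nonNeg-+ (nonNeg-sq ᾱ) (null⇒nonNeg (null-neg circle-null)))

  0≤p : NonNeg p
  0≤p = nonNeg-* {α} {ᾱ} 0≤α 0≤ᾱ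

  α²-1≥ε : NonNeg (α * α - 1ℝ - fromℚ ε)
  α²-1≥ε = nonNeg-resp
    (λ n → solve 2 (λ a e →
        (a :- con 1ℚ :- e) :* (a :+ con 1ℚ) :+ e :* a := a :* a :- con 1ℚ :- e) refl
      (seq α n) ε)
    (nonNeg-+ (nonNeg-* 1+ε≤α (nonNeg-+ 0≤α (nonNeg-const (ℚ.<⇒≤ (ℚ.positive⁻¹ 1ℚ)))))
      (nonNeg-* (nonNeg-const (ℚ.<⇒≤ 0<ε)) 0≤α))

  -- The quantitative form of p < 1: it becomes the gap η/120 between 2 and the squared norms of the
  -- remaining vectors.
  η : ℚ
  η = ε ℚ.* ε ℚ.* ½

  0<η : 0ℚ ℚ.< η
  0<η = 0<ε/2 (pos* 0<ε 0<ε)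

  -- On the circle, 2 (1 - p) = (1 - p)² + (α² - 1)².
  1-p≥η : NonNeg (1ℝ - p - fromℚ η)
  1-p≥η = nonNeg-resp
    (λ n → solve 3 (λ a b e →
        con ½ :* ((con 1ℚ :- a :* b) :* (con 1ℚ :- a :* b) :+
          ((a :* a :- con 1ℚ :- e) :* (a :* a :- con 1ℚ :- e) :+
            (e :+ e) :* (a :* a :- con 1ℚ :- e)) :+
          :- (a :* a :* (a :* a :+ b :* b :- con 2ℚ))) :=
        con 1ℚ :- a :* b :- e :* e :* con ½) refl
      (seq α n) (seq ᾱ n) ε)
    (nonNeg-* (nonNeg-const (ℚ.<⇒≤ 0<½))
      (nonNeg-+ (nonNeg-+ (nonNeg-sq (1ℝ - p))
        (nonNeg-+ (nonNeg-sq (α * α - 1ℝ - fromℚ ε))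
          (nonNeg-* (nonNeg-const (ℚ.+-mono-≤ (ℚ.<⇒≤ 0<ε) (ℚ.<⇒≤ 0<ε))) α²-1≥ε)))
        (null⇒nonNeg (null-neg (null-* (α * α) circle-null)))))

  0≤1-p : NonNeg (1ℝ - p)
  0≤1-p = nonNeg-resp (λ n → solve 2 (λ p h → con 1ℚ :- p :- h :+ h := con 1ℚ :- p) refl
      (seq p n) η)
    (nonNeg-+ 1-p≥η (nonNeg-const (ℚ.<⇒≤ 0<η)))

  -- α d = (α² - 1) + (1 - p), and the factor α ≥ 1 can be cancelled.
  0≤d : NonNeg d
  0≤d = nonNeg-cancel α d 1≤α (nonNeg-resp
    (λ n → solve 3 (λ a b e →
        a :* a :- con 1ℚ :- e :+ e :+ (con 1ℚ :- a :* b) := a :* (a :- b)) refl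
      (seq α n) (seq ᾱ n) ε)
    (nonNeg-+ (nonNeg-+ α²-1≥ε (nonNeg-const (ℚ.<⇒≤ 0<ε))) 0≤1-p))

  0≤¼ : 0ℚ ℚ.≤ ½ ℚ.* ½
  0≤¼ = ℚ.<⇒≤ (pos* 0<½ 0<½)

  -- The product with ¼ equals 3/2 - α, so this rests on α ≤ 3/2.
  0≤2-d : NonNeg (2ℝ - d)
  0≤2-d = nonNeg-resp
    (λ n → solve 2 (λ a b →
        con ½ :* con ½ :* ((a :- con 2ℚ) :* (a :- con 2ℚ) :+ (con 2ℚ :- a :* a)) :+ con ½ :+ b :=
        con 2ℚ :- (a :- b)) refl
      (seq α n) (seq ᾱ n))
    (nonNeg-+ (nonNeg-+ (nonNeg-* (nonNeg-const 0≤¼) (nonNeg-+ (nonNeg-sq (α - 2ℝ)) α²≤2))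
      (nonNeg-const (ℚ.<⇒≤ 0<½))) 0≤ᾱ)

  -- On the circle, 4 (2 - s) = (s - 2)² + 2 (1 - p).
  0≤2-s : NonNeg (2ℝ - s)
  0≤2-s = nonNeg-resp
    (λ n → solve 2 (λ a b →
        con ½ :* con ½ :* ((a :+ b :- con 2ℚ) :* (a :+ b :- con 2ℚ) :+
          (con 1ℚ :- a :* b :+ (con 1ℚ :- a :* b)) :+ :- (a :* a :+ b :* b :- con 2ℚ)) :=
        con 2ℚ :- (a :+ b)) refl
      (seq α n) (seq ᾱ n))
    (nonNeg-* (nonNeg-const 0≤¼) (nonNeg-+ (nonNeg-+ (nonNeg-sq (s - 2ℝ)) (nonNeg-+ 0≤1-p 0≤1-p))
      (null⇒nonNeg (null-neg circle-null))))

  0≤s : NonNeg s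
  0≤s = nonNeg-+ {α} {ᾱ} 0≤α 0≤ᾱ

  -- Chords come from x (2 - x) ≥ 0 and tangents from (2 x - c)² ≥ 0, for
  -- x = s or x = d, together with s² = 2 + 2p and d² = 2 - 2p.
  slopeS-bound : ∀ {t σ₁ σ₀} → SlopeS t σ₁ σ₀ →
    NonNeg (fromℤ t * (fromℤ (+ 120) * s - (fromℤ σ₁ * p + fromℤ σ₀ * (1ℝ - p))))
  slopeS-bound {t} (chord 0≤t) = nonNeg-resp
    (λ n → solve 3 (λ a b t → t :* (con (ι (+ 60)) :*
        ((a :+ b) :* (con 2ℚ :- (a :+ b)) :+ (a :* a :+ b :* b :- con 2ℚ))) :=
        t :* (con (ι (+ 120)) :* (a :+ b) :-
          (con (ι (+ 240)) :* (a :* b) :+ con (ι (+ 120)) :* (con 1ℚ :- a :* b)))) refl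
      (seq α n) (seq ᾱ n) (ι t))
    (nonNeg-* (nonNeg-fromℤ 0≤t) (nonNeg-* (nonNeg-fromℤ {+ 60} (ℤ.+≤+ ℕ.z≤n))
      (nonNeg-+ (nonNeg-* 0≤s 0≤2-s) (null⇒nonNeg circle-null))))
  slopeS-bound {t} (tangent₁ t≤0) = nonNeg-resp
    (λ n → solve 3 (λ a b t → (con 0ℚ :- t) :* (con (ι (+ 30)) :*
        ((a :+ b :- con 2ℚ) :* (a :+ b :- con 2ℚ) :+ :- (a :* a :+ b :* b :- con 2ℚ))) :=
        t :* (con (ι (+ 120)) :* (a :+ b) :-
          (con (ι (+ 240)) :* (a :* b) :+ con (ι (+ 180)) :* (con 1ℚ :- a :* b)))) refl
      (seq α n) (seq ᾱ n) (ι t))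
    (nonNeg-* (nonNeg-ι t≤0) (nonNeg-* (nonNeg-fromℤ {+ 30} (ℤ.+≤+ ℕ.z≤n))
      (nonNeg-+ (nonNeg-sq (s - 2ℝ)) (null⇒nonNeg (null-neg circle-null)))))
  slopeS-bound {t} (tangent₂ t≤0) = nonNeg-resp
    (λ n → solve 3 (λ a b t → (con 0ℚ :- t) :* (con (ι (+ 10)) :*
        ((con 2ℚ :* (a :+ b) :- con (ι (+ 3))) :* (con 2ℚ :* (a :+ b) :- con (ι (+ 3))) :+
          :- (con (ι (+ 4)) :* (a :* a :+ b :* b :- con 2ℚ)))) :=
        t :* (con (ι (+ 120)) :* (a :+ b) :-
          (con (ι (+ 250)) :* (a :* b) :+ con (ι (+ 170)) :* (con 1ℚ :- a :* b)))) refl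
      (seq α n) (seq ᾱ n) (ι t))
    (nonNeg-* (nonNeg-ι t≤0) (nonNeg-* (nonNeg-fromℤ {+ 10} (ℤ.+≤+ ℕ.z≤n))
      (nonNeg-+ (nonNeg-sq (2ℝ * s - fromℤ (+ 3)))
        (null⇒nonNeg (null-neg (null-* (fromℤ (+ 4)) circle-null))))))

  slopeD-bound : ∀ {t δ₁ δ₀} → SlopeD t δ₁ δ₀ →
    NonNeg (fromℤ t * (fromℤ (+ 120) * d - (fromℤ δ₁ * p + fromℤ δ₀ * (1ℝ - p))))
  slopeD-bound {t} (chord 0≤t) = nonNeg-resp
    (λ n → solve 3 (λ a b t → t :* (con (ι (+ 60)) :*
        ((a :- b) :* (con 2ℚ :- (a :- b)) :+ (a :* a :+ b :* b :- con 2ℚ))) :=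
        t :* (con (ι (+ 120)) :* (a :- b) :-
          (con 0ℚ :* (a :* b) :+ con (ι (+ 120)) :* (con 1ℚ :- a :* b)))) refl
      (seq α n) (seq ᾱ n) (ι t))
    (nonNeg-* (nonNeg-fromℤ 0≤t) (nonNeg-* (nonNeg-fromℤ {+ 60} (ℤ.+≤+ ℕ.z≤n))
      (nonNeg-+ (nonNeg-* 0≤d 0≤2-d) (null⇒nonNeg circle-null))))
  slopeD-bound {t} (tangent t≤0) = nonNeg-resp
    (λ n → solve 3 (λ a b t → (con 0ℚ :- t) :* (con (ι (+ 3)) :*
        ((con (ι (+ 4)) :* (a :- b) :- con (ι (+ 5))) :*
            (con (ι (+ 4)) :* (a :- b) :- con (ι (+ 5))) :+
          :- (con (ι (+ 16)) :* (a :* a :+ b :* b :- con 2ℚ)))) :=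
        t :* (con (ι (+ 120)) :* (a :- b) :-
          (con (ι (+ 75)) :* (a :* b) :+ con (ι (+ 171)) :* (con 1ℚ :- a :* b)))) refl
      (seq α n) (seq ᾱ n) (ι t))
    (nonNeg-* (nonNeg-ι t≤0) (nonNeg-* (nonNeg-fromℤ {+ 3} (ℤ.+≤+ ℕ.z≤n))
      (nonNeg-+ (nonNeg-sq (fromℤ (+ 4) * d - fromℤ (+ 5)))
        (null⇒nonNeg (null-neg (null-* (fromℤ (+ 16)) circle-null))))))

  -- The coefficient of N is left as α² + ᾱ². It agrees with 2 only in the limit, whereas the
  -- formula for the norm is proved term by term for the rational sequences.
  form : (a² aA aB N M : ℤ) → ℝ
  form a² aA aB N M = 2ℝ * fromℤ a² + (α * α + ᾱ * ᾱ) * fromℤ N + 2ℝ * p * fromℤ M +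
    fromℤ aA * s + fromℤ aB * d

  -- 120 (form - 2) is p (F₁ - 240) + (1 - p) (F₀ - 241) + (1 - p), plus the slack of the two lines
  -- and a multiple of the circle relation. The last 1 - p is what the step from 240 to 241 leaves
  -- over, and it is at least η.
  form-bound : ∀ {a² aA aB N M} → Certificate a² aA aB N M →
    NonNeg (fromℤ (+ 120) * (form a² aA aB N M - 2ℝ) - fromℚ η)
  form-bound {q} {x} {y} {k} {m} (certificate {σ₁} {σ₀} {δ₁} {δ₀} slope-s slope-d f₁ f₀) =
    nonNeg-resp
      (λ n → solve 12 (λ a b q x y k m σ₁ σ₀ δ₁ δ₀ h →
          a :* b :* (con (ι (+ 240)) :* q :+ σ₁ :* x :+ δ₁ :* y :+ con (ι (+ 240)) :* k :+
            con (ι (+ 240)) :* m :- con (ι (+ 240))) :+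
          (con 1ℚ :- a :* b) :* (con (ι (+ 240)) :* q :+ σ₀ :* x :+ δ₀ :* y :+
            con (ι (+ 240)) :* k :- con (ι (+ 241))) :+
          (x :* (con (ι (+ 120)) :* (a :+ b) :- (σ₁ :* (a :* b) :+ σ₀ :* (con 1ℚ :- a :* b))) :+
           y :* (con (ι (+ 120)) :* (a :- b) :- (δ₁ :* (a :* b) :+ δ₀ :* (con 1ℚ :- a :* b)))) :+
          (con (ι (+ 120)) :* k :* (a :* a :+ b :* b :- con 2ℚ) :+ (con 1ℚ :- a :* b :- h)) :=
          con (ι (+ 120)) :* (con 2ℚ :* q :+ (a :* a :+ b :* b) :* k :+ con 2ℚ :* (a :* b) :* m :+
            x :* (a :+ b) :+ y :* (a :- b) :- con 2ℚ) :- h) refl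
        (seq α n) (seq ᾱ n) (ι q) (ι x) (ι y) (ι k) (ι m) (ι σ₁) (ι σ₀) (ι δ₁) (ι δ₀) η)
      (nonNeg-+ (nonNeg-+
        (nonNeg-+ (nonNeg-* {α * ᾱ} 0≤p F₁-real) (nonNeg-* {1ℝ - p} 0≤1-p F₀-real))
        (nonNeg-+ (slopeS-bound slope-s) (slopeD-bound slope-d)))
        (nonNeg-+ (null⇒nonNeg (null-* (fromℤ (+ 120) * fromℤ k) circle-null)) 1-p≥η))
    where
    F₁-real : NonNeg (fromℤ (+ 240) * fromℤ q + fromℤ σ₁ * fromℤ x + fromℤ δ₁ * fromℤ y +
      fromℤ (+ 240) * fromℤ k + fromℤ (+ 240) * fromℤ m - fromℤ (+ 240))
    F₁-real = nonNeg-resp (λ _ → cong (ℚ._- ι (+ 240)) (ι≡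
      (⟪ + 240 ⟫ ⊗ ⟪ q ⟫ ⊕ ⟪ σ₁ ⟫ ⊗ ⟪ x ⟫ ⊕ ⟪ δ₁ ⟫ ⊗ ⟪ y ⟫ ⊕ ⟪ + 240 ⟫ ⊗ ⟪ k ⟫ ⊕
        ⟪ + 240 ⟫ ⊗ ⟪ m ⟫))) (nonNeg-ι f₁)
    F₀-real : NonNeg (fromℤ (+ 240) * fromℤ q + fromℤ σ₀ * fromℤ x + fromℤ δ₀ * fromℤ y +
      fromℤ (+ 240) * fromℤ k - fromℤ (+ 241))
    F₀-real = nonNeg-resp (λ _ → cong (ℚ._- ι (+ 241)) (ι≡
      (⟪ + 240 ⟫ ⊗ ⟪ q ⟫ ⊕ ⟪ σ₀ ⟫ ⊗ ⟪ x ⟫ ⊕ ⟪ δ₀ ⟫ ⊗ ⟪ y ⟫ ⊕ ⟪ + 240 ⟫ ⊗ ⟪ k ⟫)))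
      (nonNeg-ι f₀)

-- Finite sums and linear combinations.

∑ : ∀ {n} → Vector ℚ n → ℚ
∑ = foldr ℚ._+_ 0ℚ

seq-sum : ∀ {n} (f : Vector ℝ n) m → seq (sum f) m ≡ ∑ (λ i → seq (f i) m)
seq-sum {zero}  f m = refl
seq-sum {suc n} f m = cong (seq (f zero) m ℚ.+_) (seq-sum (f ∘ suc) m)

∑-cong : ∀ {n} {f g : Vector ℚ n} → f ≗ g → ∑ f ≡ ∑ g
∑-cong {zero}  f≗g = refl
∑-cong {suc n} f≗g = cong₂ ℚ._+_ (f≗g zero) (∑-cong (f≗g ∘ suc))

∑-minus : ∀ {n} (f g : Vector ℚ n) → ∑ (λ i → f i ℚ.- g i) ≡ ∑ f ℚ.- ∑ g
∑-minus {zero}  f g = refl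
∑-minus {suc n} f g = trans (cong (f zero ℚ.- g zero ℚ.+_) (∑-minus (f ∘ suc) (g ∘ suc)))
  (solve 4 (λ a b x y → a :- b :+ (x :- y) := a :+ x :- (b :+ y)) refl
    (f zero) (g zero) (∑ (f ∘ suc)) (∑ (g ∘ suc)))

∑-neg : ∀ {n} (f : Vector ℚ n) → ∑ (ℚ.-_ ∘ f) ≡ ℚ.- ∑ f
∑-neg {zero}  f = refl
∑-neg {suc n} f = trans (cong (ℚ.- f zero ℚ.+_) (∑-neg (f ∘ suc)))
  (sym (ℚ.neg-distrib-+ (f zero) (∑ (f ∘ suc))))

∑-zero : ∀ {n} (f : Vector ℚ n) → ∑ (λ j → 0ℚ ℚ.* f j) ≡ 0ℚ
∑-zero {zero}  f = refl
∑-zero {suc n} f = cong₂ ℚ._+_ (ℚ.*-zeroˡ (f zero)) (∑-zero (f ∘ suc))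

∑-δ : ∀ {n} k (f : Vector ℚ n) → ∑ (λ j → ι (δ k j) ℚ.* f j) ≡ f k
∑-δ zero    f = trans (cong₂ ℚ._+_ (ℚ.*-identityˡ (f zero)) (∑-zero (f ∘ suc)))
  (ℚ.+-identityʳ (f zero))
∑-δ (suc k) f = trans (cong₂ ℚ._+_ (ℚ.*-zeroˡ (f zero)) (∑-δ k (f ∘ suc)))
  (ℚ.+-identityˡ (f (suc k)))

sum-null : ∀ {n} {f : Vector ℝ n} → (∀ i → Null (f i)) → Null (sum f)
sum-null {zero}      f-null = null-0 λ _ → refl
sum-null {suc n} {f} f-null = null-resp {f zero + sum (f ∘ suc)} (λ _ → refl)
  (null-+ {f zero} {sum (f ∘ suc)} (f-null zero) (sum-null {f = f ∘ suc} (f-null ∘ suc)))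

sum-nonNeg : ∀ {n} {f : Vector ℝ n} → (∀ i → NonNeg (f i)) → NonNeg (sum f)
sum-nonNeg {zero}      0≤f = nonNeg-pointwise λ _ → ℚ.≤-refl
sum-nonNeg {suc n} {f} 0≤f = nonNeg-resp {f zero + sum (f ∘ suc)} (λ _ → refl)
  (nonNeg-+ {f zero} {sum (f ∘ suc)} (0≤f zero) (sum-nonNeg {f = f ∘ suc} (0≤f ∘ suc)))

⟨⟩-cong : ∀ {n} (x y : Vector ℝ n) → x ≋ y → Null (⟨ x , x ⟩ - ⟨ y , y ⟩)
⟨⟩-cong x y x≋y = null-resp
  (λ n → trans (seq-sum (λ i → x i * x i - y i * y i) n)
    (trans (∑-minus (λ i → seq (x i * x i) n) (λ i → seq (y i * y i) n))
      (sym (cong₂ ℚ._-_ (seq-sum (λ i → x i * x i) n) (seq-sum (λ i → y i * y i) n)))))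
  (sum-null close)
  where
  close : ∀ i → Null (x i * x i - y i * y i)
  close i = null-resp
    (λ n → solve 2 (λ x y → (x :+ y) :* (x :- y) := x :* x :- y :* y) refl
      (seq (x i) n) (seq (y i) n))
    (null-* (x i + y i) (≈⇒null {x i} {y i} (x≋y i)))

⟨⟩-nonNeg : ∀ {n} (x : Vector ℝ n) → NonNeg ⟨ x , x ⟩
⟨⟩-nonNeg x = sum-nonNeg λ i → nonNeg-sq (x i)

seq-linComb : ∀ {m n} (c : Vector ℝ m) (b : Vector (Vector ℝ n) m) i k →
  seq (linComb c b i) k ≡ ∑ (λ j → seq (c j) k ℚ.* seq (b j i) k)
seq-linComb c b i k = seq-sum (λ j → c j * b j i) k

linComb-δ : ∀ {m n} k (b : Vector (Vector ℝ n) m) i l →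
  seq (linComb (λ j → fromℤ (δ k j)) b i) l ≡ seq (b k i) l
linComb-δ k b i l = trans (seq-linComb (λ j → fromℤ (δ k j)) b i l) (∑-δ k (λ j → seq (b j i) l))

linComb-neg : ∀ {m n} (c : Vector ℤ m) (b : Vector (Vector ℝ n) m) i k →
  seq (linComb (λ j → fromℤ (ℤ.- c j)) b i) k ≡ ℚ.- seq (linComb (λ j → fromℤ (c j)) b i) k
linComb-neg c b i k = begin
  seq (linComb (λ j → fromℤ (ℤ.- c j)) b i) k       ≡⟨ seq-linComb (λ j → fromℤ (ℤ.- c j)) b i k ⟩
  ∑ (λ j → ι (ℤ.- c j) ℚ.* seq (b j i) k)
    ≡⟨ ∑-cong (λ j → trans (cong (ℚ._* seq (b j i) k) (ι-neg (c j)))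
         (sym (ℚ.neg-distribˡ-* (ι (c j)) (seq (b j i) k)))) ⟩
  ∑ (λ j → ℚ.- (ι (c j) ℚ.* seq (b j i) k))    ≡⟨ ∑-neg (λ j → ι (c j) ℚ.* seq (b j i) k) ⟩
  ℚ.- ∑ (λ j → ι (c j) ℚ.* seq (b j i) k)
    ≡⟨ cong ℚ.-_ (seq-linComb (λ j → fromℤ (c j)) b i k) ⟨
  ℚ.- seq (linComb (λ j → fromℤ (c j)) b i) k          ∎
  where open ≡-Reasoning

linComb-cong : ∀ {m n} {c c′ : Vector ℤ m} (b : Vector (Vector ℝ n) m) → c ≗ c′ →
  ∀ i k → seq (linComb (λ j → fromℤ (c j)) b i) k ≡ seq (linComb (λ j → fromℤ (c′ j)) b i) k
linComb-cong {c = c} {c′} b c≗c′ i k = trans (seq-linComb (λ j → fromℤ (c j)) b i k)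
  (trans (∑-cong λ j → cong (λ z → ι z ℚ.* seq (b j i) k) (c≗c′ j))
    (sym (seq-linComb (λ j → fromℤ (c′ j)) b i k)))

linComb-minus : ∀ {m n} (c c′ : Vector ℝ m) (b : Vector (Vector ℝ n) m) i k →
  seq (linComb c b i) k ℚ.- seq (linComb c′ b i) k ≡ seq (linComb (λ j → c j - c′ j) b i) k
linComb-minus c c′ b i k = begin
  seq (linComb c b i) k ℚ.- seq (linComb c′ b i) k
    ≡⟨ cong₂ ℚ._-_ (seq-linComb c b i k) (seq-linComb c′ b i k) ⟩
  ∑ (λ j → seq (c j) k ℚ.* seq (b j i) k) ℚ.- ∑ (λ j → seq (c′ j) k ℚ.* seq (b j i) k)
    ≡⟨ ∑-minus (λ j → seq (c j) k ℚ.* seq (b j i) k) (λ j → seq (c′ j) k ℚ.* seq (b j i) k) ⟨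
  ∑ (λ j → seq (c j) k ℚ.* seq (b j i) k ℚ.- seq (c′ j) k ℚ.* seq (b j i) k)
    ≡⟨ ∑-cong (λ j → solve 3 (λ x y b → x :* b :- y :* b := (x :- y) :* b) refl
         (seq (c j) k) (seq (c′ j) k) (seq (b j i) k)) ⟩
  ∑ (λ j → seq (c j - c′ j) k ℚ.* seq (b j i) k)
    ≡⟨ seq-linComb (λ j → c j - c′ j) b i k ⟨
  seq (linComb (λ j → c j - c′ j) b i) k ∎
  where open ≡-Reasoning

p-0≡p : ∀ p → p ℚ.- 0ℚ ≡ p
p-0≡p = solve 1 (λ p → p :- con 0ℚ := p) refl

≈0⇒null : ∀ x → x ≈ 0ℝ → Null x
≈0⇒null x x≈0 = null-resp (λ n → p-0≡p (seq x n)) (≈⇒null {x} {0ℝ} x≈0)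

null⇒≈0 : ∀ x → Null x → x ≈ 0ℝ
null⇒≈0 x x-null = null⇒≈ {x} {0ℝ} (null-resp (λ n → sym (p-0≡p (seq x n))) x-null)

linComb-injective : ∀ {m n} {b : Vector (Vector ℝ n) m} → LinearlyIndependent b →
  ∀ c c′ → linComb c b ≋ linComb c′ b → c ≋ c′
linComb-injective {b = b} independent c c′ eq j = null⇒≈ {c j} {c′ j}
  (≈0⇒null (c j - c′ j) (independent (λ j → c j - c′ j) vanishes j))
  where
  vanishes : linComb (λ j → c j - c′ j) b ≋ 0ᵛ
  vanishes i = null⇒≈0 (linComb (λ j → c j - c′ j) b i) (null-resp (linComb-minus c c′ b i)
    (≈⇒null {linComb c b i} {linComb c′ b i} (eq i)))

-- The basis in coordinates.

-- With ᾱ free, the coordinate and norm formulas are identities in two independent variables.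
basisOf : ℝ → ℝ → Vector (Vector ℝ 8) 8
basisOf α ᾱ zero    = basis α zero
basisOf α ᾱ (suc k) = α · e (inject₁ k) +ᵛ ᾱ · e (suc k)

basis≡basisOf : ∀ α j → basis α j ≡ basisOf α (conj α) j
basis≡basisOf α zero    = refl
basis≡basisOf α (suc k) = refl

-- Positions are natural numbers with a default beyond the range, so that elimination can recurse on
-- the position. The type is left open because the solver's polynomials share these definitions with
-- the reals.
extend : ∀ {A : Set} {n} → A → Vector A n → ℕ → A
extend {n = zero}  z c k       = z
extend {n = suc n} z c zero    = c zero
extend {n = suc n} z c (suc k) = extend z (c ∘ suc) k

extend-toℕ : ∀ {A : Set} {n} (z : A) (c : Vector A n) i → extend z c (toℕ i) ≡ c i
extend-toℕ z c zero    = refl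
extend-toℕ z c (suc i) = extend-toℕ z (c ∘ suc) i

extend-∘toℕ : ∀ {A : Set} {n} (z : A) (f : ℕ → A) k → k ℕ.< n →
  extend {n = n} z (f ∘ toℕ) k ≡ f k
extend-∘toℕ {n = suc n} z f zero    _         = refl
extend-∘toℕ {n = suc n} z f (suc k) (ℕ.s≤s k<n) = extend-∘toℕ z (f ∘ suc) k k<n

-- The coefficients of b₂, …, b₈ in positions 1, …, 7, flanked by zeros.
chain : ∀ {A : Set} → A → Vector A 8 → ℕ → A
chain z c zero    = z
chain z c (suc k) = extend z (c ∘ suc) k

-- Position 6, counted from 0, is the seventh coordinate, the one where b₁ is negative.
sign : ∀ {A : Set} → A → A → ℕ → A
sign one minus-one k = if k ℕ.≡ᵇ 6 then minus-one else one

row : (α ᾱ h : ℝ) → (ℕ → ℝ) → ℕ → ℝ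
row α ᾱ h c k = sign 1ℝ (- 1ℝ) k * h + (ᾱ * c k + α * c (suc k))

coordinates : (α ᾱ : ℝ) → Vector ℝ 8 → Vector ℝ 8
coordinates α ᾱ c i = row α ᾱ (fromℚ ½ * c zero) (chain 0ℝ c) (toℕ i)

-- Copies with polynomial entries: at each fixed coordinate they evaluate to a concrete polynomial
-- that the ring solver can handle.
module _ {n : ℕ} (a b : Polynomial n) where
  eᴾ : Fin 8 → Fin 8 → Polynomial n
  eᴾ i j = if does (i Fin.≟ j) then con 1ℚ else con 0ℚ

  basisᴾ : Fin 8 → Fin 8 → Polynomial n
  basisᴾ zero    i = con ½ :* lookup (con 1ℚ ∷ con 1ℚ ∷ con 1ℚ ∷ con 1ℚ ∷ con 1ℚ ∷ con 1ℚ ∷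
    :- con 1ℚ ∷ con 1ℚ ∷ []) i
  basisᴾ (suc k) i = a :* eᴾ (inject₁ k) i :+ b :* eᴾ (suc k) i

  linCombᴾ coordinatesᴾ : Vector (Polynomial n) 8 → Vector (Polynomial n) 8
  linCombᴾ c i     = foldr _:+_ (con 0ℚ) λ j → c j :* basisᴾ j i
  coordinatesᴾ c i = sign (con 1ℚ) (:- con 1ℚ) (toℕ i) :* (con ½ :* c zero) :+
    (b :* chain (con 0ℚ) c (toℕ i) :+ a :* chain (con 0ℚ) c (suc (toℕ i)))

linComb-coordinates : ∀ α ᾱ c i n →
  seq (linComb c (basisOf α ᾱ) i) n ≡ seq (coordinates α ᾱ c i) n
linComb-coordinates α ᾱ c i n = at i
  where
  equation : Fin 8 → (a b c₀ c₁ c₂ c₃ c₄ c₅ c₆ c₇ : Polynomial 10) → _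
  equation i a b c₀ c₁ c₂ c₃ c₄ c₅ c₆ c₇ =
    linCombᴾ a b (lookup (c₀ ∷ c₁ ∷ c₂ ∷ c₃ ∷ c₄ ∷ c₅ ∷ c₆ ∷ c₇ ∷ [])) i :=
    coordinatesᴾ a b (lookup (c₀ ∷ c₁ ∷ c₂ ∷ c₃ ∷ c₄ ∷ c₅ ∷ c₆ ∷ c₇ ∷ [])) i
  a = seq α n
  b = seq ᾱ n
  k : Fin 8 → ℚ
  k j = seq (c j) n
  at : ∀ i → seq (linComb c (basisOf α ᾱ) i) n ≡ seq (coordinates α ᾱ c i) n
  at 0F = solve 10 (equation 0F) refl a b (k 0F) (k 1F) (k 2F) (k 3F) (k 4F) (k 5F) (k 6F) (k 7F)
  at 1F = solve 10 (equation 1F) refl a b (k 0F) (k 1F) (k 2F) (k 3F) (k 4F) (k 5F) (k 6F) (k 7F)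
  at 2F = solve 10 (equation 2F) refl a b (k 0F) (k 1F) (k 2F) (k 3F) (k 4F) (k 5F) (k 6F) (k 7F)
  at 3F = solve 10 (equation 3F) refl a b (k 0F) (k 1F) (k 2F) (k 3F) (k 4F) (k 5F) (k 6F) (k 7F)
  at 4F = solve 10 (equation 4F) refl a b (k 0F) (k 1F) (k 2F) (k 3F) (k 4F) (k 5F) (k 6F) (k 7F)
  at 5F = solve 10 (equation 5F) refl a b (k 0F) (k 1F) (k 2F) (k 3F) (k 4F) (k 5F) (k 6F) (k 7F)
  at 6F = solve 10 (equation 6F) refl a b (k 0F) (k 1F) (k 2F) (k 3F) (k 4F) (k 5F) (k 6F) (k 7F)
  at 7F = solve 10 (equation 7F) refl a b (k 0F) (k 1F) (k 2F) (k 3F) (k 4F) (k 5F) (k 6F) (k 7F)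

quadratic : (a b q k m x y : ℚ) → ℚ
quadratic a b q k m x y = 2ℚ ℚ.* q ℚ.+ (a ℚ.* a ℚ.+ b ℚ.* b) ℚ.* k ℚ.+ 2ℚ ℚ.* (a ℚ.* b) ℚ.* m ℚ.+
  x ℚ.* (a ℚ.+ b) ℚ.+ y ℚ.* (a ℚ.- b)

coordinates-norm : ∀ α ᾱ c n → let k = λ j → seq (c j) n in
  seq ⟨ coordinates α ᾱ c , coordinates α ᾱ c ⟩ n ≡ quadratic (seq α n) (seq ᾱ n)
    (k 0F ℚ.* k 0F)
    (k 1F ℚ.* k 1F ℚ.+ k 2F ℚ.* k 2F ℚ.+ k 3F ℚ.* k 3F ℚ.+ k 4F ℚ.* k 4F ℚ.+ k 5F ℚ.* k 5F ℚ.+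
      k 6F ℚ.* k 6F ℚ.+ k 7F ℚ.* k 7F)
    (k 1F ℚ.* k 2F ℚ.+ k 2F ℚ.* k 3F ℚ.+ k 3F ℚ.* k 4F ℚ.+ k 4F ℚ.* k 5F ℚ.+ k 5F ℚ.* k 6F ℚ.+
      k 6F ℚ.* k 7F)
    (k 0F ℚ.* (k 1F ℚ.+ k 2F ℚ.+ k 3F ℚ.+ k 4F ℚ.+ k 5F))
    (k 0F ℚ.* (k 6F ℚ.- k 7F))
coordinates-norm α ᾱ c n = solve 10 (λ a b c₀ c₁ c₂ c₃ c₄ c₅ c₆ c₇ →
  let x = coordinatesᴾ a b (lookup (c₀ ∷ c₁ ∷ c₂ ∷ c₃ ∷ c₄ ∷ c₅ ∷ c₆ ∷ c₇ ∷ [])) in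
  foldr _:+_ (con 0ℚ) (λ i → x i :* x i) :=
  con 2ℚ :* (c₀ :* c₀) :+ (a :* a :+ b :* b) :*
    (c₁ :* c₁ :+ c₂ :* c₂ :+ c₃ :* c₃ :+ c₄ :* c₄ :+ c₅ :* c₅ :+ c₆ :* c₆ :+ c₇ :* c₇) :+
  con 2ℚ :* (a :* b) :* (c₁ :* c₂ :+ c₂ :* c₃ :+ c₃ :* c₄ :+ c₄ :* c₅ :+ c₅ :* c₆ :+ c₆ :* c₇) :+
  c₀ :* (c₁ :+ c₂ :+ c₃ :+ c₄ :+ c₅) :* (a :+ b) :+ c₀ :* (c₆ :- c₇) :* (a :- b)) refl
  (seq α n) (seq ᾱ n) (k 0F) (k 1F) (k 2F) (k 3F) (k 4F) (k 5F) (k 6F) (k 7F)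
  where
  k : Fin 8 → ℚ
  k j = seq (c j) n

basis-norm-tail : ∀ α ᾱ k n → seq ⟨ basisOf α ᾱ (suc k) , basisOf α ᾱ (suc k) ⟩ n ≡
  seq α n ℚ.* seq α n ℚ.+ seq ᾱ n ℚ.* seq ᾱ n
basis-norm-tail α ᾱ k n = at k
  where
  equation : Fin 7 → (a b : Polynomial 2) → _
  equation k a b = foldr _:+_ (con 0ℚ) (λ i → basisᴾ a b (suc k) i :* basisᴾ a b (suc k) i) :=
    a :* a :+ b :* b
  at : ∀ k → seq ⟨ basisOf α ᾱ (suc k) , basisOf α ᾱ (suc k) ⟩ n ≡
    seq α n ℚ.* seq α n ℚ.+ seq ᾱ n ℚ.* seq ᾱ n
  at 0F = solve 2 (equation 0F) refl (seq α n) (seq ᾱ n)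
  at 1F = solve 2 (equation 1F) refl (seq α n) (seq ᾱ n)
  at 2F = solve 2 (equation 2F) refl (seq α n) (seq ᾱ n)
  at 3F = solve 2 (equation 3F) refl (seq α n) (seq ᾱ n)
  at 4F = solve 2 (equation 4F) refl (seq α n) (seq ᾱ n)
  at 5F = solve 2 (equation 5F) refl (seq α n) (seq ᾱ n)
  at 6F = solve 2 (equation 6F) refl (seq α n) (seq ᾱ n)

-- Order, square roots and equality of reals.

≤-trans : ∀ {x y z} → x ≤ y → y ≤ z → x ≤ z
≤-trans {x} {y} {z} x≤y y≤z = nonNeg⇒≤ {x} {z} (nonNeg-resp
  (λ n → solve 3 (λ x y z → z :- y :+ (y :- x) := z :- x) refl (seq x n) (seq y n) (seq z n))
  (nonNeg-+ (≤⇒nonNeg {y} {z} y≤z) (≤⇒nonNeg {x} {y} x≤y)))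

≈⇒≤ : ∀ {x y} → x ≈ y → x ≤ y
≈⇒≤ {x} {y} x≈y = nonNeg⇒≤ {x} {y} (null⇒nonNeg (≈⇒null {y} {x} (≈-sym {x} {y} x≈y)))

≤-antisym : ∀ {x y} → x ≤ y → y ≤ x → x ≈ y
≤-antisym {x} {y} x≤y y≤x = null⇒≈ {x} {y} (nonNeg-antisym (≤⇒nonNeg {y} {x} y≤x) (nonNeg-resp
  (λ n → solve 2 (λ x y → y :- x := :- (x :- y)) refl (seq x n) (seq y n))
  (≤⇒nonNeg {x} {y} x≤y)))

√-cong : ∀ {x y} → x ≈ y → √ x ≈ √ y
√-cong {x} {y} x≈y = ≤-antisym {√ x} {√ y} (√-mono {x} {y} (≈⇒≤ {x} {y} x≈y))
  (√-mono {y} {x} (≈⇒≤ {y} {x} (≈-sym {x} {y} x≈y)))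

√-squared : ∀ {x} → NonNeg x → Null (√ x * √ x - x)
√-squared {x} 0≤x = ≈⇒null {√ x * √ x} {x} (√-square x (nonNeg⇒≤ {0ℝ} {x} (nonNeg-resp
  (λ n → sym (p-0≡p (seq x n))) 0≤x)))

nonNeg-√ : ∀ x → NonNeg (√ x)
nonNeg-√ x = nonNeg-pointwise λ n → √approx-nonNeg (seq x n ⁺) n

difference-of-squares : ∀ {r s x y} → NonNeg r → NonNeg s → Null (r * r - x) → Null (s * s - y) →
  r ≤ s → NonNeg (y - x)
difference-of-squares {r} {s} {x} {y} 0≤r 0≤s r²≈x s²≈y r≤s = nonNeg-resp
  (λ n → solve 4 (λ r s x y → (s :- r) :* (s :+ r) :+ (r :* r :- x :+ :- (s :* s :- y)) := y :- x)
    refl (seq r n) (seq s n) (seq x n) (seq y n))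
  (nonNeg-+ (nonNeg-* (≤⇒nonNeg {r} {s} r≤s) (nonNeg-+ 0≤s 0≤r))
    (null⇒nonNeg (null-+ r²≈x (null-neg s²≈y))))

√-cancel-≤ : ∀ x y → NonNeg x → NonNeg y → √ x ≤ √ y → NonNeg (y - x)
√-cancel-≤ x y 0≤x 0≤y = difference-of-squares {√ x} {√ y} {x} {y} (nonNeg-√ x) (nonNeg-√ y)
  (√-squared {x} 0≤x) (√-squared {y} 0≤y)

null-const : ∀ {q} → Null (fromℚ q) → q ≡ 0ℚ
null-const {q} (null h) with q ℚ.≟ 0ℚ
... | yes q≡0 = q≡0
-- The tolerance ∣ q ∣ itself yields ∣ q ∣ < ∣ q ∣.
... | no  q≢0 = contradiction (proj₂ (h ℚ.∣ q ∣ 0<∣q∣) _ ℕ.≤-refl) (ℚ.<-irrefl refl)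
  where
  0<∣q∣ : 0ℚ ℚ.< ℚ.∣ q ∣
  0<∣q∣ = ℚ.≰⇒> λ ∣q∣≤0 → q≢0 (ℚ.∣p∣≡0⇒p≡0 q (ℚ.≤-antisym ∣q∣≤0 (ℚ.0≤∣p∣ q)))

fromℤ-injective : ∀ {i j} → fromℤ i ≈ fromℤ j → i ≡ j
fromℤ-injective {i} {j} eq = ι-injective (p-q≡0⇒p≡q (null-const (null-resp (λ _ → refl)
  (≈⇒null {fromℤ i} {fromℤ j} eq))))
  where
  p-q≡0⇒p≡q : ∀ {p q} → p ℚ.- q ≡ 0ℚ → p ≡ q
  p-q≡0⇒p≡q {p} {q} eq = trans (solve 2 (λ p q → p := p :- q :+ q) refl p q)
    (trans (cong (ℚ._+ q) eq) (ℚ.+-identityˡ q))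

≈-resp : ∀ {x} y {z} → x ≈ y → (∀ n → seq y n ≡ seq z n) → x ≈ z
≈-resp {x} y {z} x≈y eq = null⇒≈ {x} {z} (null-resp (λ n → cong (λ q → seq x n ℚ.- q) (eq n))
  (≈⇒null {x} {y} x≈y))

-- The sixteen signed unit coefficient vectors.

-- `Fin 8 ⊎ Fin 8` corresponds to `Fin 16` through `splitAt 8`, which later counts the minimal
-- vectors.
coefficient-of : Fin 8 ⊎ Fin 8 → Vector ℤ 8
coefficient-of (inj₁ k) j = δ k j
coefficient-of (inj₂ k) j = ℤ.- δ k j

δ-diagonal : ∀ {n} (k : Fin n) → δ k k ≡ + 1
δ-diagonal zero    = refl
δ-diagonal (suc k) = δ-diagonal k

δ-cases : ∀ {n} (k j : Fin n) → k ≡ j ⊎ δ k j ≡ + 0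
δ-cases zero    zero    = inj₁ refl
δ-cases zero    (suc j) = inj₂ refl
δ-cases (suc k) zero    = inj₂ refl
δ-cases (suc k) (suc j) with δ-cases k j
... | inj₁ k≡j = inj₁ (cong suc k≡j)
... | inj₂ δ≡0 = inj₂ δ≡0

coefficient-of-injective : ∀ s t → coefficient-of s ≗ coefficient-of t → s ≡ t
coefficient-of-injective (inj₁ k) (inj₁ l) eq with δ-cases l k
... | inj₁ refl = refl
... | inj₂ δ≡0  = contradiction (trans (sym (δ-diagonal k)) (trans (eq k) δ≡0)) λ ()
coefficient-of-injective (inj₂ k) (inj₂ l) eq with δ-cases l k
... | inj₁ refl = refl
... | inj₂ δ≡0  = contradiction
  (trans (sym (cong ℤ.-_ (δ-diagonal k))) (trans (eq k) (cong ℤ.-_ δ≡0))) λ ()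
coefficient-of-injective (inj₁ k) (inj₂ l) eq with δ-cases l k
... | inj₁ refl = contradiction
  (trans (sym (δ-diagonal k)) (trans (eq k) (cong ℤ.-_ (δ-diagonal k)))) λ ()
... | inj₂ δ≡0  = contradiction
  (trans (sym (δ-diagonal k)) (trans (eq k) (cong ℤ.-_ δ≡0))) λ ()
coefficient-of-injective (inj₂ k) (inj₁ l) eq with δ-cases l k
... | inj₁ refl = contradiction
  (trans (sym (cong ℤ.-_ (δ-diagonal k))) (trans (eq k) (δ-diagonal k))) λ ()
... | inj₂ δ≡0  = contradiction
  (trans (sym (cong ℤ.-_ (δ-diagonal k))) (trans (eq k) δ≡0)) λ ()

-- Elimination: linear independence and spanning.

power : ℝ → ℕ → ℝ
power α zero    = 1ℝ
power α (suc k) = α * power α k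

-- Adding α^k times row k to -ᾱ times the previous combination eliminates the
-- coefficients one after another; weight k is what is left at that of b₁ / 2.
weight : ℝ → ℝ → ℕ → ℝ
weight α ᾱ zero    = 0ℝ
weight α ᾱ (suc k) = sign 1ℝ (- 1ℝ) k * power α k - ᾱ * weight α ᾱ k

powerᴾ : ∀ {n} → Polynomial n → ℕ → Polynomial n
powerᴾ a zero    = con 1ℚ
powerᴾ a (suc k) = a :* powerᴾ a k

weightᴾ : ∀ {n} → Polynomial n → Polynomial n → ℕ → Polynomial n
weightᴾ a b zero    = con 0ℚ
weightᴾ a b (suc k) = sign (con 1ℚ) (:- con 1ℚ) k :* powerᴾ a k :- b :* weightᴾ a b k

-- The family b is tied to `basisOf` by an equation only, so its vectors remain symbols in the
-- statements below.
module Lattice (α ᾱ : ℝ) (ε : ℚ) (0<ε : 0ℚ ℚ.< ε) (1+ε≤α : NonNeg (α - 1ℝ - fromℚ ε))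
  (0≤ᾱ : NonNeg ᾱ) (circle-null : Null (α * α + ᾱ * ᾱ - 2ℝ))
  (b : Vector (Vector ℝ 8) 8) (b≡basisOf : ∀ j → b j ≡ basisOf α ᾱ j) where

  open Circle α ᾱ ε 0<ε 1+ε≤α 0≤ᾱ circle-null

  linComb-row : ∀ c i n → seq (linComb c b i) n ≡ seq (coordinates α ᾱ c i) n
  linComb-row c i n = trans (seq-linComb c b i n)
    (trans (∑-cong λ j → cong (λ x → seq (c j) n ℚ.* seq (x i) n) (b≡basisOf j))
      (trans (sym (seq-linComb c (basisOf α ᾱ) i n)) (linComb-coordinates α ᾱ c i n)))

  1≤power : ∀ k → NonNeg (power α k - 1ℝ)
  1≤power zero    = nonNeg-pointwise λ _ → ℚ.≤-refl
  1≤power (suc k) = nonNeg-resp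
    (λ n → solve 2 (λ a q → (a :- con 1ℚ) :* (q :- con 1ℚ :+ con 1ℚ) :+ (q :- con 1ℚ) :=
      a :* q :- con 1ℚ) refl (seq α n) (seq (power α k) n))
    (nonNeg-+ (nonNeg-* 1≤α (nonNeg-+ (1≤power k) (nonNeg-fromℤ {+ 1} (ℤ.+≤+ ℕ.z≤n)))) (1≤power k))

  0≤power : ∀ k → NonNeg (power α k)
  0≤power k = nonNeg-resp
    (λ n → solve 1 (λ q → q :- con 1ℚ :+ con 1ℚ := q) refl (seq (power α k) n))
    (nonNeg-+ (1≤power k) (nonNeg-fromℤ {+ 1} (ℤ.+≤+ ℕ.z≤n)))

  -- weight 8 = α⁷ + α⁶ᾱ + (α⁴ᾱ² + α²ᾱ⁴ + ᾱ⁶) (α - ᾱ).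
  1≤weight : NonNeg (weight α ᾱ 8 - 1ℝ)
  1≤weight = nonNeg-resp
    (λ n → solve 2 (λ a b →
        powerᴾ a 7 :- con 1ℚ :+ (powerᴾ a 6 :* b :+
          (powerᴾ a 4 :* (b :* b) :+ powerᴾ a 2 :* (b :* b :* (b :* b)) :+
            b :* b :* (b :* b) :* (b :* b)) :* (a :- b)) :=
        weightᴾ a b 8 :- con 1ℚ) refl (seq α n) (seq ᾱ n))
    (nonNeg-+ (1≤power 7) (nonNeg-+ (nonNeg-* (0≤power 6) 0≤ᾱ)
      (nonNeg-* (nonNeg-+ (nonNeg-+ (nonNeg-* (0≤power 4) (nonNeg-sq ᾱ))
        (nonNeg-* (0≤power 2) (nonNeg-sq (ᾱ * ᾱ))))
        (nonNeg-* (nonNeg-sq (ᾱ * ᾱ)) (nonNeg-sq ᾱ))) 0≤d)))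

  -- The invariant says that α^k c_k = -h · weight k up to a null sequence. Row k times α^k minus ᾱ
  -- times the invariant at k removes c_k and yields the invariant at k + 1.
  eliminate : ∀ h c → Null (c 0) → (∀ (i : Fin 8) → Null (row α ᾱ h c (toℕ i))) →
    ∀ k → k ℕ.≤ 8 → Null (h * weight α ᾱ k + power α k * c k)
  eliminate h c c₀-null rows zero    _   = null-resp
    (λ n → solve 2 (λ h x → x := h :* con 0ℚ :+ con 1ℚ :* x) refl (seq h n) (seq (c 0) n)) c₀-null
  eliminate h c c₀-null rows (suc k) k<8 = null-resp
    (λ n → solve 8 (λ a b h s q w x y →
        q :* (s :* h :+ (b :* x :+ a :* y)) :+ :- (b :* (h :* w :+ q :* x)) :=
        h :* (s :* q :- b :* w) :+ a :* q :* y) refl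
      (seq α n) (seq ᾱ n) (seq h n) (seq (sign 1ℝ (- 1ℝ) k) n) (seq (power α k) n)
      (seq (weight α ᾱ k) n) (seq (c k) n) (seq (c (suc k)) n))
    (null-+ (null-* (power α k) row-null)
      (null-neg (null-* ᾱ (eliminate h c c₀-null rows k (ℕ.<⇒≤ k<8)))))
    where
    row-null : Null (row α ᾱ h c k)
    row-null = subst (λ k → Null (row α ᾱ h c k)) (Fin.toℕ-fromℕ< k<8) (rows (fromℕ< k<8))

  -- Past the end of the chain the coefficient is 0, so only h · weight 8 is left. Up to sign,
  -- `weight α ᾱ 8` is twice the determinant of the basis.
  pivot : ∀ h q x → x ≡ 0ℝ → Null (h * weight α ᾱ 8 + q * x) → Null h
  pivot h q _ refl hw-null = null-cancel (weight α ᾱ 8) h 1≤weight (null-resp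
    (λ n → solve 3 (λ h w q → h :* w :+ q :* con 0ℚ := w :* h) refl
      (seq h n) (seq (weight α ᾱ 8) n) (seq q n)) hw-null)

  back-substitute : ∀ h k x → Null h → Null (h * weight α ᾱ k + power α k * x) → Null x
  back-substitute h k x h-null reduced = null-cancel (power α k) x (1≤power k) (null-resp
    (λ n → solve 4 (λ h w q x → h :* w :+ q :* x :+ :- (w :* h) := q :* x) refl
      (seq h n) (seq (weight α ᾱ k) n) (seq (power α k) n) (seq x n))
    (null-+ reduced (null-neg (null-* (weight α ᾱ k) h-null))))

  coordinates-injective : ∀ c → (∀ i → Null (coordinates α ᾱ c i)) → ∀ j → Null (c j)
  coordinates-injective c rows = coefficient-null
    where
    reduced : ∀ k → k ℕ.≤ 8 →
      Null (fromℚ ½ * c zero * weight α ᾱ k + power α k * chain 0ℝ c k)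
    reduced = eliminate (fromℚ ½ * c zero) (chain 0ℝ c) (null-0 λ _ → refl) rows
    half-null : Null (fromℚ ½ * c zero)
    half-null = pivot (fromℚ ½ * c zero) (power α 8) (chain 0ℝ c 8) refl (reduced 8 ℕ.≤-refl)
    coefficient-null : ∀ j → Null (c j)
    coefficient-null zero    = null-resp
      (λ n → solve 1 (λ x → con 2ℚ :* (con ½ :* x) := x) refl (seq (c zero) n))
      (null-* 2ℝ half-null)
    coefficient-null (suc j) = subst Null (extend-toℕ 0ℝ (c ∘ suc) j)
      (back-substitute (fromℚ ½ * c zero) (suc (toℕ j)) (chain 0ℝ c (suc (toℕ j))) half-null
        (reduced (suc (toℕ j)) (ℕ.≤-trans (Fin.toℕ<n j) (ℕ.n≤1+n 7))))

  independent : LinearlyIndependent b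
  independent c eq j = null⇒≈0 (c j) (coordinates-injective c coordinate-null j)
    where
    coordinate-null : ∀ i → Null (coordinates α ᾱ c i)
    coordinate-null i = null-resp (linComb-row c i) (≈0⇒null (linComb c b i) (eq i))

  -- The same elimination with right-hand side x, which `target` collects. The equation at k = 8
  -- determines h, and those at k = 1, ..., 7 then give the coefficients after division by α^k.
  module Solve (x : Vector ℝ 8) where
    target : ℕ → ℝ
    target zero    = 0ℝ
    target (suc k) = power α k * extend 0ℝ x k - ᾱ * target k

    h : ℝ
    h = recip (weight α ᾱ 8) * target 8

    coefficient : ℕ → ℝ
    coefficient k = recip (power α k) * (target k - h * weight α ᾱ k)

    solution : Vector ℝ 8
    -- h stands for half the coefficient of b₁.
    solution zero    = 2ℝ * h
    solution (suc j) = coefficient (suc (toℕ j))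

    residual : ℕ → ℝ → ℝ
    residual k y = power α k * y - (target k - h * weight α ᾱ k)

    residual-inner : ∀ k y → y ≡ coefficient k → Null (residual k y)
    residual-inner k _ refl = null-resp
      (λ n → solve 3 (λ q r t → t :* (q :* r :- con 1ℚ) := q :* (r :* t) :- t) refl
        (seq (power α k) n) (seq (recip (power α k)) n) (seq (target k - h * weight α ᾱ k) n))
      (null-* (target k - h * weight α ᾱ k) (*-recip (power α k) (1≤power k)))

    residual-first : ∀ y → y ≡ 0ℝ → Null (residual zero y)
    residual-first _ refl = null-0 λ n →
      solve 1 (λ h → con 1ℚ :* con 0ℚ :- (con 0ℚ :- h :* con 0ℚ) := con 0ℚ) refl (seq h n)

    residual-last : ∀ k y → k ≡ 8 → y ≡ 0ℝ → Null (residual k y)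
    residual-last _ _ refl refl = null-resp
      (λ n → solve 4 (λ q w r t → t :* (w :* r :- con 1ℚ) := q :* con 0ℚ :- (t :- r :* t :* w)) refl
        (seq (power α 8) n) (seq (weight α ᾱ 8) n) (seq (recip (weight α ᾱ 8)) n)
        (seq (target 8) n))
      (null-* (target 8) (*-recip (weight α ᾱ 8) 1≤weight))

    c : ℕ → ℝ
    c = chain 0ℝ solution

    residual-null : ∀ k → k ℕ.≤ 8 → Null (residual k (c k))
    residual-null zero    _ = residual-first (c zero) refl
    residual-null (suc k) (ℕ.s≤s k≤7) = by-cases (ℕ.m≤n⇒m<n∨m≡n k≤7)
      where
      by-cases : k ℕ.< 7 ⊎ k ≡ 7 → Null (residual (suc k) (c (suc k)))
      by-cases (inj₁ k<7) = residual-inner (suc k) (c (suc k))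
        (extend-∘toℕ 0ℝ (coefficient ∘ suc) k k<7)
      by-cases (inj₂ k≡7) = residual-last (suc k) (c (suc k)) (cong suc k≡7)
        (trans (cong (c ∘ suc) k≡7) refl)

    -- Residual k + 1 plus ᾱ times residual k is -α^k times the defect of row k.
    row-solved : ∀ k → k ℕ.< 8 → Null (extend 0ℝ x k - row α ᾱ h c k)
    row-solved k k<8 = null-cancel (power α k) (extend 0ℝ x k - row α ᾱ h c k) (1≤power k)
      (null-resp
        (λ n → solve 10 (λ a b h s q w t x y z →
            :- (b :* (q :* y :- (t :- h :* w)) :+
              (a :* q :* z :- (q :* x :- b :* t :- h :* (s :* q :- b :* w)))) :=
            q :* (x :- (s :* h :+ (b :* y :+ a :* z)))) refl
          (seq α n) (seq ᾱ n) (seq h n) (seq (sign 1ℝ (- 1ℝ) k) n) (seq (power α k) n)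
          (seq (weight α ᾱ k) n) (seq (target k) n) (seq (extend 0ℝ x k) n)
          (seq (c k) n) (seq (c (suc k)) n))
        (null-neg (null-+ (null-* ᾱ (residual-null k (ℕ.<⇒≤ k<8))) (residual-null (suc k) k<8))))

    solved : x ≋ linComb solution b
    solved i = null⇒≈ {x i} {linComb solution b i} (null-resp
      (λ n → cong₂ (λ y z → y ℚ.- z) (cong (λ y → seq y n) (extend-toℕ 0ℝ x i)) (trans
        (cong (λ g → seq (sign 1ℝ (- 1ℝ) (toℕ i)) n ℚ.* g ℚ.+
            (seq ᾱ n ℚ.* seq (c (toℕ i)) n ℚ.+ seq α n ℚ.* seq (c (suc (toℕ i))) n))
          (solve 1 (λ h → h := con ½ :* (con 2ℚ :* h)) refl (seq h n)))
        (sym (linComb-row solution i n))))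
      (row-solved (toℕ i) (Fin.toℕ<n i)))

  -- Norms of lattice vectors.

  formℚ : Vector ℤ 8 → ℕ → ℚ
  formℚ c n = quadratic (seq α n) (seq ᾱ n) (ι (c 0F ℤ.* c 0F))
    (ι (N (c 1F) (c 2F) (c 3F) (c 4F) (c 5F) (c 6F) (c 7F)))
    (ι (M (c 1F) (c 2F) (c 3F) (c 4F) (c 5F) (c 6F) (c 7F)))
    (ι (c 0F ℤ.* A (c 1F) (c 2F) (c 3F) (c 4F) (c 5F))) (ι (c 0F ℤ.* (c 6F ℤ.- c 7F)))

  quadratic-cong : ∀ {a b q q′ k k′ m m′ x x′ y y′} → q ≡ q′ → k ≡ k′ → m ≡ m′ → x ≡ x′ → y ≡ y′ →
    quadratic a b q k m x y ≡ quadratic a b q′ k′ m′ x′ y′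
  quadratic-cong refl refl refl refl refl = refl

  linComb-norm : ∀ (c : Vector ℤ 8) n → let x = linComb (λ j → fromℤ (c j)) b in
    seq ⟨ x , x ⟩ n ≡ formℚ c n
  linComb-norm c n = begin
    seq ⟨ x , x ⟩ n                        ≡⟨ seq-sum (λ i → x i * x i) n ⟩
    ∑ (λ i → seq (x i) n ℚ.* seq (x i) n)
      ≡⟨ ∑-cong (λ i → cong (λ q → q ℚ.* q) (linComb-row cᴿ i n)) ⟩
    ∑ (λ i → seq (y i) n ℚ.* seq (y i) n)  ≡⟨ seq-sum (λ i → y i * y i) n ⟨
    seq ⟨ y , y ⟩ n                        ≡⟨ coordinates-norm α ᾱ cᴿ n ⟩
    quadratic (seq α n) (seq ᾱ n)
      (ι c₀ ℚ.* ι c₀)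
      (ι c₁ ℚ.* ι c₁ ℚ.+ ι c₂ ℚ.* ι c₂ ℚ.+ ι c₃ ℚ.* ι c₃ ℚ.+ ι c₄ ℚ.* ι c₄ ℚ.+ ι c₅ ℚ.* ι c₅ ℚ.+
        ι c₆ ℚ.* ι c₆ ℚ.+ ι c₇ ℚ.* ι c₇)
      (ι c₁ ℚ.* ι c₂ ℚ.+ ι c₂ ℚ.* ι c₃ ℚ.+ ι c₃ ℚ.* ι c₄ ℚ.+ ι c₄ ℚ.* ι c₅ ℚ.+ ι c₅ ℚ.* ι c₆ ℚ.+
        ι c₆ ℚ.* ι c₇)
      (ι c₀ ℚ.* (ι c₁ ℚ.+ ι c₂ ℚ.+ ι c₃ ℚ.+ ι c₄ ℚ.+ ι c₅))
      (ι c₀ ℚ.* (ι c₆ ℚ.- ι c₇))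
      ≡⟨ quadratic-cong {seq α n} {seq ᾱ n}
           (ι≡ (⟪ c₀ ⟫ ⊗ ⟪ c₀ ⟫))
           (ι≡ (⟪ c₁ ⟫ ⊗ ⟪ c₁ ⟫ ⊕ ⟪ c₂ ⟫ ⊗ ⟪ c₂ ⟫ ⊕ ⟪ c₃ ⟫ ⊗ ⟪ c₃ ⟫ ⊕ ⟪ c₄ ⟫ ⊗ ⟪ c₄ ⟫ ⊕
             ⟪ c₅ ⟫ ⊗ ⟪ c₅ ⟫ ⊕ ⟪ c₆ ⟫ ⊗ ⟪ c₆ ⟫ ⊕ ⟪ c₇ ⟫ ⊗ ⟪ c₇ ⟫))
           (ι≡ (⟪ c₁ ⟫ ⊗ ⟪ c₂ ⟫ ⊕ ⟪ c₂ ⟫ ⊗ ⟪ c₃ ⟫ ⊕ ⟪ c₃ ⟫ ⊗ ⟪ c₄ ⟫ ⊕ ⟪ c₄ ⟫ ⊗ ⟪ c₅ ⟫ ⊕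
             ⟪ c₅ ⟫ ⊗ ⟪ c₆ ⟫ ⊕ ⟪ c₆ ⟫ ⊗ ⟪ c₇ ⟫))
           (ι≡ (⟪ c₀ ⟫ ⊗ (⟪ c₁ ⟫ ⊕ ⟪ c₂ ⟫ ⊕ ⟪ c₃ ⟫ ⊕ ⟪ c₄ ⟫ ⊕ ⟪ c₅ ⟫)))
           (ι≡ (⟪ c₀ ⟫ ⊗ (⟪ c₆ ⟫ ⊖ ⟪ c₇ ⟫))) ⟨
    formℚ c n                              ∎
    where
    open ≡-Reasoning
    cᴿ x y : Vector ℝ 8
    cᴿ j = fromℤ (c j)
    x = linComb cᴿ b
    y = coordinates α ᾱ cᴿ
    c₀ = c 0F
    c₁ = c 1F
    c₂ = c 2F
    c₃ = c 3F
    c₄ = c 4F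
    c₅ = c 5F
    c₆ = c 6F
    c₇ = c 7F

  -- A gap common to all vectors: it gives the lower bound 2 and also refutes equality with 2.
  Long : ℝ → Set
  Long q = NonNeg (fromℤ (+ 120) * (q - 2ℝ) - fromℚ η)

  long-norm : ∀ x c → x ≋ linComb (λ j → fromℤ (c j)) b → + 2 ℤ.≤ sumSq c →
    Long ⟨ x , x ⟩
  long-norm x c x≋ 2≤ = nonNeg-resp
    (λ n → trans
      (cong (λ l → ι (+ 120) ℚ.* (formℚ c n ℚ.- 2ℚ) ℚ.- η ℚ.+ ι (+ 120) ℚ.* (seq ⟨ x , x ⟩ n ℚ.- l))
        (linComb-norm c n))
      (solve 5 (λ k f t h q → k :* (f :- t) :- h :+ k :* (q :- f) := k :* (q :- t) :- h) refl
        (ι (+ 120)) (formℚ c n) 2ℚ η (seq ⟨ x , x ⟩ n)))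
    (nonNeg-+
      (form-bound (certified (c 0F) (c 1F) (c 2F) (c 3F) (c 4F) (c 5F) (c 6F) (c 7F)
        (subst (+ 2 ℤ.≤_)
          (reassociate (c 0F) (c 1F) (c 2F) (c 3F) (c 4F) (c 5F) (c 6F) (c 7F)) 2≤)))
      (null⇒nonNeg (null-* (fromℤ (+ 120)) (⟨⟩-cong x (linComb (λ j → fromℤ (c j)) b) x≋))))
    where
    reassociate : ∀ a u₁ u₂ u₃ u₄ u₅ v w → a ℤ.* a ℤ.+ (u₁ ℤ.* u₁ ℤ.+ (u₂ ℤ.* u₂ ℤ.+
      (u₃ ℤ.* u₃ ℤ.+ (u₄ ℤ.* u₄ ℤ.+ (u₅ ℤ.* u₅ ℤ.+ (v ℤ.* v ℤ.+ (w ℤ.* w ℤ.+ + 0))))))) ≡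
      a ℤ.* a ℤ.+ (u₁ ℤ.* u₁ ℤ.+ u₂ ℤ.* u₂ ℤ.+ u₃ ℤ.* u₃ ℤ.+ u₄ ℤ.* u₄ ℤ.+ u₅ ℤ.* u₅ ℤ.+
        v ℤ.* v ℤ.+ w ℤ.* w)
    reassociate = ℤ-Ring.solve-∀

  Λ : Vector ℝ 8 → Set
  Λ = ℤ-span b

  signed : Fin 8 ⊎ Fin 8 → Vector ℝ 8
  signed (inj₁ k) = b k
  signed (inj₂ k) = -ᵛ b k

  linComb-signed : ∀ s i n →
    seq (linComb (λ j → fromℤ (coefficient-of s j)) b i) n ≡ seq (signed s i) n
  linComb-signed (inj₁ k) i n = linComb-δ k b i n
  linComb-signed (inj₂ k) i n = trans (linComb-neg (δ k) b i n) (cong ℚ.-_ (linComb-δ k b i n))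

  basisOf-norm : ∀ k → Null (⟨ basisOf α ᾱ k , basisOf α ᾱ k ⟩ - 2ℝ)
  -- 8 · ¼ = 2, and the approximating sequence is constant.
  basisOf-norm zero    = null-0 λ _ → refl
  basisOf-norm (suc k) =
    null-resp (λ n → cong (ℚ._- 2ℚ) (sym (basis-norm-tail α ᾱ k n))) circle-null

  b-norm : ∀ k → Null (⟨ b k , b k ⟩ - 2ℝ)
  b-norm k = subst (λ v → Null (⟨ v , v ⟩ - 2ℝ)) (sym (b≡basisOf k)) (basisOf-norm k)

  neg-norm : ∀ (v : Vector ℝ 8) → Null (⟨ v , v ⟩ - 2ℝ) → Null (⟨ -ᵛ v , -ᵛ v ⟩ - 2ℝ)
  neg-norm v = null-resp
    (λ n → cong (ℚ._- 2ℚ) (trans (seq-sum (λ i → v i * v i) n)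
      (trans (∑-cong λ i → solve 1 (λ x → x :* x := :- x :* :- x) refl (seq (v i) n))
        (sym (seq-sum (λ i → (-ᵛ v) i * (-ᵛ v) i) n)))))

  norm-subst : ∀ (v w : Vector ℝ 8) → w ≡ v → Null (⟨ v , v ⟩ - 2ℝ) → Null (⟨ w , w ⟩ - 2ℝ)
  norm-subst _ _ refl h = h

  signed-norm : ∀ s → Null (⟨ signed s , signed s ⟩ - 2ℝ)
  signed-norm (inj₁ k) = norm-subst (b k) (signed (inj₁ k)) refl (b-norm k)
  signed-norm (inj₂ k) = norm-subst (-ᵛ b k) (signed (inj₂ k)) refl (neg-norm (b k) (b-norm k))

  ≋signed-norm : ∀ x s → x ≋ signed s → Null (⟨ x , x ⟩ - 2ℝ)
  ≋signed-norm x s x≋ = null-resp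
    (λ n → solve 3 (λ x y t → x :- y :+ (y :- t) := x :- t) refl
      (seq ⟨ x , x ⟩ n) (seq ⟨ signed s , signed s ⟩ n) 2ℚ)
    (null-+ (⟨⟩-cong x (signed s) x≋) (signed-norm s))

  -- The alternatives are read off from integer coefficients; real coordinates alone would not
  -- decide between them.
  Classified : Vector ℝ 8 → Set
  Classified x = x ≋ 0ᵛ ⊎ (∃[ s ] x ≋ signed s) ⊎ Long ⟨ x , x ⟩

  classify-coefficients : ∀ x (c : Vector ℤ 8) → x ≋ linComb (λ j → fromℤ (c j)) b →
    Short c ⊎ + 2 ℤ.≤ sumSq c → Classified x
  classify-coefficients x c x≋ (inj₁ (inj₁ c≡0)) = inj₁ λ i →
    ≈-resp {x i} (linComb (λ j → fromℤ (c j)) b i) {0ℝ} (x≋ i) λ n →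
      trans (linComb-cong b c≡0 i n) (trans (seq-linComb (λ _ → fromℤ (+ 0)) b i n)
        (∑-zero (λ j → seq (b j i) n)))
  classify-coefficients x c x≋ (inj₁ (inj₂ (k , inj₁ c≡δ))) = inj₂ (inj₁ (inj₁ k , λ i →
    ≈-resp {x i} (linComb (λ j → fromℤ (c j)) b i) {b k i} (x≋ i) λ n →
      trans (linComb-cong b c≡δ i n) (linComb-signed (inj₁ k) i n)))
  classify-coefficients x c x≋ (inj₁ (inj₂ (k , inj₂ c≡-δ))) = inj₂ (inj₁ (inj₂ k , λ i →
    ≈-resp {x i} (linComb (λ j → fromℤ (c j)) b i) {signed (inj₂ k) i} (x≋ i) λ n →
      trans (linComb-cong b c≡-δ i n) (linComb-signed (inj₂ k) i n)))
  classify-coefficients x c x≋ (inj₂ 2≤) = inj₂ (inj₂ (long-norm x c x≋ 2≤))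

  classify : ∀ x → Λ x → Classified x
  classify x (c , x≋) = classify-coefficients x c x≋ (short? c)

  signed∈Λ : ∀ x s → x ≋ signed s → Λ x
  signed∈Λ x s x≋ = coefficient-of s , λ i →
    ≈-resp {x i} (signed s i) {linComb (λ j → fromℤ (coefficient-of s j)) b i} (x≋ i)
      λ n → sym (linComb-signed s i n)

  long⇒2≤ : ∀ q → Long q → NonNeg (q - 2ℝ)
  long⇒2≤ q h = nonNeg-resp
    (λ n → solve 2 (λ q h → con (+ 1 ℚ./ 120) :* (con (ι (+ 120)) :* (q :- con 2ℚ) :- h :+ h) :=
      q :- con 2ℚ) refl (seq q n) η)
    (nonNeg-* (nonNeg-const (ℚ.nonNegative⁻¹ (+ 1 ℚ./ 120)))
      (nonNeg-+ h (nonNeg-const (ℚ.<⇒≤ 0<η))))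

  long⇒≰2 : ∀ q → Long q → ¬ NonNeg (2ℝ - q)
  long⇒≰2 q h q≤2 = ¬nonNeg-negative 0<η (nonNeg-resp
    (λ n → solve 2 (λ q h → con (ι (+ 120)) :* (q :- con 2ℚ) :- h :+
      con (ι (+ 120)) :* (con 2ℚ :- q) := :- h) refl (seq q n) η)
    (nonNeg-+ h (nonNeg-* (nonNeg-fromℤ {+ 120} (ℤ.+≤+ ℕ.z≤n)) q≤2)))

  -- Minimal vectors: classification, number and span.

  0≤2 : NonNeg 2ℝ
  0≤2 = nonNeg-fromℤ {+ 2} (ℤ.+≤+ ℕ.z≤n)

  zero-norm : ∀ (x : Vector ℝ 8) → x ≋ 0ᵛ → ¬ NonNeg (⟨ x , x ⟩ - 2ℝ)
  zero-norm x x≋0 2≤ = ¬nonNeg-negative {2ℚ} (ℚ.positive⁻¹ 2ℚ) (nonNeg-resp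
    (λ n → solve 2 (λ q t → q :- t :+ :- (q :- con 0ℚ) := :- t) refl (seq ⟨ x , x ⟩ n) 2ℚ)
    (nonNeg-+ 2≤ (null⇒nonNeg (null-neg (⟨⟩-cong x 0ᵛ x≋0)))))

  signed-length : ∀ x s → x ≋ signed s → ‖ x ‖ ≈ √ 2ℝ
  signed-length x s x≋ = √-cong {⟨ x , x ⟩} {2ℝ} (null⇒≈ {⟨ x , x ⟩} {2ℝ} (≋signed-norm x s x≋))

  2≤⇒√2≤ : ∀ (x : Vector ℝ 8) → NonNeg (⟨ x , x ⟩ - 2ℝ) → √ 2ℝ ≤ ‖ x ‖
  2≤⇒√2≤ x 2≤ = √-mono {2ℝ} {⟨ x , x ⟩} (nonNeg⇒≤ {2ℝ} {⟨ x , x ⟩} 2≤)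

  ≋-refl : ∀ (x : Vector ℝ 8) → x ≋ x
  ≋-refl x i = ≈-refl {x i}

  √2≤norm : ∀ x → Λ x → ¬ x ≋ 0ᵛ → √ 2ℝ ≤ ‖ x ‖
  √2≤norm x x∈Λ x≢0 = by-cases (classify x x∈Λ)
    where
    by-cases : Classified x → √ 2ℝ ≤ ‖ x ‖
    by-cases (inj₁ x≋0)             = contradiction x≋0 x≢0
    by-cases (inj₂ (inj₁ (s , x≋))) = 2≤⇒√2≤ x (null⇒nonNeg (≋signed-norm x s x≋))
    by-cases (inj₂ (inj₂ h))        = 2≤⇒√2≤ x (long⇒2≤ ⟨ x , x ⟩ h)

  b₀∈Λ : Λ (b zero)
  b₀∈Λ = signed∈Λ (b zero) (inj₁ zero) (≋-refl (b zero))

  b₀≢0 : ¬ (b zero) ≋ 0ᵛ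
  b₀≢0 b₀≋0 = zero-norm (b zero) b₀≋0 (null⇒nonNeg (b-norm zero))

  b₀-length : ‖ b zero ‖ ≈ √ 2ℝ
  b₀-length = signed-length (b zero) (inj₁ zero) (≋-refl (b zero))

  √2-minimal : IsMinNorm Λ (√ 2ℝ)
  √2-minimal = ((b zero) , b₀∈Λ , b₀≢0 , b₀-length) , √2≤norm

  signed∈S : ∀ x s → x ≋ signed s → S Λ x
  signed∈S x s x≋ = signed∈Λ x s x≋ , √ 2ℝ , √2-minimal , signed-length x s x≋

  -- Membership in `S` comes with some ℓ of its own. It is at most the norm of b₁, and it is
  -- attained by a nonzero lattice vector, whose norm is at least √2.
  minNorm≈√2 : ∀ ℓ → IsMinNorm Λ ℓ → ℓ ≈ √ 2ℝ
  minNorm≈√2 ℓ ((x , x∈Λ , x≢0 , x≈ℓ) , ℓ≤) = ≤-antisym {ℓ} {√ 2ℝ}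
    (≤-trans {ℓ} {‖ b zero ‖} {√ 2ℝ} (ℓ≤ (b zero) b₀∈Λ b₀≢0) (≈⇒≤ {‖ b zero ‖} {√ 2ℝ} b₀-length))
    (≤-trans {√ 2ℝ} {‖ x ‖} {ℓ} (√2≤norm x x∈Λ x≢0) (≈⇒≤ {‖ x ‖} {ℓ} x≈ℓ))

  S⇒signed : ∀ x → S Λ x → ∃[ s ] x ≋ signed s
  S⇒signed x (x∈Λ , ℓ , ℓ-minimal , x≈ℓ) = by-cases (classify x x∈Λ)
    where
    x≈√2 : ‖ x ‖ ≈ √ 2ℝ
    x≈√2 = ≈-trans {‖ x ‖} {ℓ} {√ 2ℝ} x≈ℓ (minNorm≈√2 ℓ ℓ-minimal)
    by-cases : Classified x → ∃[ s ] x ≋ signed s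
    -- The definition of `S` does not mention nonzero vectors; zero is excluded because its norm
    -- would have to be √2.
    by-cases (inj₁ x≋0) = contradiction
      (√-cancel-≤ 2ℝ ⟨ x , x ⟩ 0≤2 (⟨⟩-nonNeg x)
        (≈⇒≤ {√ 2ℝ} {‖ x ‖} (≈-sym {‖ x ‖} {√ 2ℝ} x≈√2)))
      (zero-norm x x≋0)
    by-cases (inj₂ (inj₁ short)) = short
    by-cases (inj₂ (inj₂ h)) = contradiction
      (√-cancel-≤ ⟨ x , x ⟩ 2ℝ (⟨⟩-nonNeg x) 0≤2 (≈⇒≤ {‖ x ‖} {√ 2ℝ} x≈√2))
      (long⇒≰2 ⟨ x , x ⟩ h)

  -- Linear independence turns equal vectors into equal coefficients, and the sixteen coefficient
  -- vectors are distinct.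
  signed-injective : ∀ s t → signed s ≋ signed t → s ≡ t
  signed-injective s t eq = coefficient-of-injective s t λ j → fromℤ-injective
    {coefficient-of s j} {coefficient-of t j}
    (linComb-injective {b = b} independent (λ j → fromℤ (coefficient-of s j))
      (λ j → fromℤ (coefficient-of t j)) same j)
    where
    same : linComb (λ j → fromℤ (coefficient-of s j)) b ≋
      linComb (λ j → fromℤ (coefficient-of t j)) b
    same i = null⇒≈ {linComb (λ j → fromℤ (coefficient-of s j)) b i}
      {linComb (λ j → fromℤ (coefficient-of t j)) b i} (null-resp
        (λ n → sym (cong₂ ℚ._-_ (linComb-signed s i n) (linComb-signed t i n)))
        (≈⇒null {signed s i} {signed t i} (eq i)))

  cardinality : HasCardinality (S Λ) 16
  cardinality = record
    { to        = λ i → signed (splitAt 8 i) , signed∈S (signed (splitAt 8 i)) (splitAt 8 i)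
        (≋-refl (signed (splitAt 8 i)))
    ; cong      = λ { {i} refl → ≋-refl (signed (splitAt 8 i)) }
    ; bijective =
        (λ {i} {j} eq → trans (sym (Fin.join-splitAt 8 8 i)) (trans
          (cong (join 8 8) (signed-injective (splitAt 8 i) (splitAt 8 j) eq))
          (Fin.join-splitAt 8 8 j))) ,
        λ (x , x∈S) → let s , x≋ = S⇒signed x x∈S in
          join 8 8 s , λ { refl → subst (λ t → signed t ≋ x) (sym (Fin.splitAt-join 8 8 s))
            (λ i → ≈-sym {x i} {signed s i} (x≋ i)) }
    }

  spans : Spans (S Λ)
  spans x =
    8 , b , Solve.solution x , (λ j → signed∈S (b j) (inj₁ j) (≋-refl (b j))) , Solve.solved x

  genericWellRounded : GenericWellRounded Λ
  genericWellRounded = (8 , b , independent , (λ x∈Λ → x∈Λ) , (λ x∈Λ → x∈Λ)) , spans , cardinality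

-- From the hypotheses on α to the circle.

0≤2-α² : ∀ α → 1ℝ < α → α ≤ √ 2ℝ → NonNeg (2ℝ - α * α)
0≤2-α² α 1<α α≤√2 = difference-of-squares {α} {√ 2ℝ} {α * α} {2ℝ} 0≤α (nonNeg-√ 2ℝ)
  (null-0 λ n → ℚ.+-inverseʳ (seq (α * α) n)) (√-squared {2ℝ} (nonNeg-fromℤ {+ 2} (ℤ.+≤+ ℕ.z≤n)))
  α≤√2
  where
  0≤α : NonNeg α
  0≤α = nonNeg-eventually (let ε , 0<ε , N , h = 1<α in N , λ n N≤n →
    ℚ.≤-trans (ℚ.+-mono-≤ (ℚ.<⇒≤ (ℚ.positive⁻¹ 1ℚ)) (ℚ.<⇒≤ 0<ε)) (h n N≤n))

1+ε≤α : ∀ α (1<α : 1ℝ < α) → NonNeg (α - 1ℝ - fromℚ (proj₁ 1<α))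
1+ε≤α α (ε , 0<ε , N , h) = nonNeg-eventually (N , λ n N≤n →
  subst₂ ℚ._≤_ (ℚ.+-inverseʳ (1ℚ ℚ.+ ε))
    (solve 2 (λ a e → a :- (con 1ℚ :+ e) := a :- con 1ℚ :- e) refl (seq α n) ε)
    (ℚ.+-monoˡ-≤ (ℚ.- (1ℚ ℚ.+ ε)) (h n N≤n)))

on-circle : ∀ α β → β ≡ √ (2ℝ - α * α) → NonNeg (2ℝ - α * α) → Null (α * α + β * β - 2ℝ)
on-circle α _ refl 0≤ = null-resp
  (λ n → solve 3 (λ a b t → b :* b :- (t :- a :* a) := a :* a :+ b :* b :- t) refl
    (seq α n) (seq (√ (2ℝ - α * α)) n) 2ℚ)
  (√-squared {2ℝ - α * α} 0≤)

nonNeg-conj : ∀ α → NonNeg (conj α)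
nonNeg-conj α = nonNeg-√ (2ℝ - α * α)

genericWellRounded-resp : ∀ {n} (P Q : Vector ℝ n → Set) → P ≡ Q →
  GenericWellRounded P → GenericWellRounded Q
genericWellRounded-resp P _ refl P-gwr = P-gwr

mainTheorem19 : (α : ℝ) → 1ℝ < α → α ≤ √ 2ℝ →
    S (E₈ α) ≐ ±basis α ×
    (∃[ λ₁ ] IsMinNorm (E₈ α) λ₁ × λ₁ * λ₁ ≈ 2ℝ) ×
    GenericWellRounded (E₈ α)
mainTheorem19 α 1<α α≤√2 =
  ((λ {x} → to-±basis x) , λ {x} → from-±basis x) ,
  (√ 2ℝ , √2-minimal , null⇒≈ {√ 2ℝ * √ 2ℝ} {2ℝ} (√-squared {2ℝ} 0≤2)) ,
  genericWellRounded-resp Λ (E₈ α) refl genericWellRounded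
  where
  -- The rational margin contained in 1 < α becomes ε.
  open Lattice α (conj α) (proj₁ 1<α) (proj₁ (proj₂ 1<α)) (1+ε≤α α 1<α) (nonNeg-conj α)
    (on-circle α (conj α) refl (0≤2-α² α 1<α α≤√2)) (basis α) (basis≡basisOf α)
  signed⇒±basis : ∀ x → ∃[ s ] x ≋ signed s → ±basis α x
  signed⇒±basis x (inj₁ k , x≋) = k , inj₁ x≋
  signed⇒±basis x (inj₂ k , x≋) = k , inj₂ x≋
  to-±basis : ∀ x → S (E₈ α) x → ±basis α x
  to-±basis x x∈S = signed⇒±basis x (S⇒signed x x∈S)
  from-±basis : ∀ x → ±basis α x → S (E₈ α) x
  from-±basis x (k , inj₁ x≋) = signed∈S x (inj₁ k) x≋
  from-±basis x (k , inj₂ x≋) = signed∈S x (inj₂ k) x≋
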